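{- Let $q$ be an even prime power and let $L$ be a line of $\mathrm{PG}(5,q)$ in the $K$-orbit $o_{13,3}$. Then the hyperplane-orbit distribution of $L$ is $OD_4(L)=\left[1,\,\frac{q^2+3q}{2},\,\frac{q^2+q}{2},\,q^3-q\right]$.
   Context: A point $(y_0,\dots,y_5)$ of $\mathrm{PG}(5,q)$ is identified with the nonzero symmetric matrix $\begin{bmatrix} y_0&y_1&y_2\\ y_1&y_3&y_4\\ y_2&y_4&y_5\end{bmatrix}$ up to scalar. $K\cong\mathrm{PGL}(3,q)$ acts by $M\mapsto AMA^T$, $A\in\mathrm{GL}(3,q)$. The orbit $o_{13,3}$ (defined only for $q$ even) is the $K$-orbit of the line $\left\{\begin{bmatrix} 0&x&0\\ x&x+y&0\\ 0&0&y\end{bmatrix}:(x,y)\in\mathrm{PG}(1,q)\right\}$. Hyperplanes correspond to conics of $\mathrm{PG}(2,q)$ (nonzero quadratic forms up to scalar): $\sum_{0\le i\le j\le2}a_{ij}X_iX_j$ corresponds to $a_{00}Y_0+a_{01}Y_1+a_{02}Y_2+a_{11}Y_3+a_{12}Y_4+a_{22}Y_5=0$. $\mathcal H_1,\mathcal H_{2,r},\mathcal H_{2,i},\mathcal H_3$ are the sets of hyperplanes corresponding respectively to double lines (scalar multiples of squares of linear forms), pairs of distinct real lines (products of two non-proportional linear forms over $\mathbb F_q$), pairs of conjugate imaginary lines (scalar multiples of products of two non-proportional linear forms conjugate over $\mathbb F_{q^2}$), and non-singular conics (those with $4a_{00}a_{11}a_{22}+a_{01}a_{02}a_{12}-a_{00}a_{12}^2-a_{11}a_{02}^2-a_{22}a_{01}^2\ne0$).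 $OD_4(L)=[h_1,h_{2,r},h_{2,i},h_3]$ lists the numbers of hyperplanes in $\mathcal H_1,\mathcal H_{2,r},\mathcal H_{2,i},\mathcal H_3$ containing $L$. -}

module Defs where

open import Algebra.Apartness.Bundles using (HeytingField; HeytingCommutativeRing)
open import Algebra.Bundles using (CommutativeRing)
open import Algebra.Morphism.Structures using (IsRingMonomorphism)
open import Data.Bool.Base using (if_then_else_)
open import Data.Fin.Base using (Fin)
open import Data.Fin.Patterns using (0F; 1F; 2F; 3F; 4F; 5F)
open import Data.Fin.Properties using (_≟_)
open import Data.Nat.Base as ℕ using (ℕ; suc)
open import Data.Nat.Primality using (Prime)
open import Data.Product.Base using (∃; ∃₂; _×_; _,_; proj₁)
open import Data.Sum.Base using (_⊎_)
open import Data.Vec.Base using (Vec) renaming ([] to []ᵛ; _∷_ to _∷ᵛ_)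
open import Data.Vec.Functional using (Vector; []; _∷_)
open import Function.Bundles using (Inverse; _⇔_)
open import Level using (Level; _⊔_)
open import Relation.Binary.Bundles using (Setoid)
open import Relation.Binary.PropositionalEquality.Core using (_≡_)
import Relation.Binary.PropositionalEquality.Properties as ≡
import Relation.Binary.Construct.On as On
import Relation.Binary.Reasoning.Setoid as ≈-Reasoning
open import Relation.Nullary using (¬_; does)
open import Relation.Unary using (Pred)
import Algebra.Apartness.Properties.HeytingCommutativeRing as HeytingProperties
import Algebra.Properties.Semiring.Sum as Sum
import Algebra.Properties.Semiring.Mult as Mult
import Algebra.Properties.Semiring.Exp as Exp
import Data.Vec.Functional.Relation.Binary.Equality.Setoid as VecEquality

IsPrimePower : ℕ → Set
IsPrimePower q = ∃₂ λ p h → Prime p × 0 ℕ.< h × q ≡ p ℕ.^ h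

HasCardinality : ∀ {a ℓ} → Setoid a ℓ → ℕ → Set (a ⊔ ℓ)
HasCardinality S n = Inverse S (≡.setoid (Fin n))

ring : ∀ {c ℓ₁ ℓ₂} → HeytingField c ℓ₁ ℓ₂ → CommutativeRing c ℓ₁
ring F = HeytingCommutativeRing.commutativeRing (HeytingField.heytingCommutativeRing F)

setoidOf : ∀ {c ℓ₁ ℓ₂} → HeytingField c ℓ₁ ℓ₂ → Setoid c ℓ₁
setoidOf F = CommutativeRing.setoid (ring F)

-- "Nonzero" is rendered by the apartness x # 0#, i.e. "x is invertible".  In a
-- field with HasCardinality (setoidOf F) q equality is decidable and x # 0# is
-- the same as ¬ x ≈ 0#.

module LinearAlgebra {c ℓ₁ ℓ₂} (F : HeytingField c ℓ₁ ℓ₂) where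

  open CommutativeRing (ring F)
  open HeytingField F using (_#_; #⇒invertible; heytingCommutativeRing)
  open HeytingProperties heytingCommutativeRing using (1#0; x#0y#0→xy#0; invertibleʳ⇒#; x-0≈x)
  open Sum semiring using (sum)
  open VecEquality setoid using (_≋_)

  infixr 7 _∙_
  infixl 6 _⊕_

  _∙_ : ∀ {n} → Carrier → Vector Carrier n → Vector Carrier n
  (a ∙ v) i = a * v i

  _⊕_ : ∀ {n} → Vector Carrier n → Vector Carrier n → Vector Carrier n
  (u ⊕ v) i = u i + v i

  Proportional : ∀ {n} → Vector Carrier n → Vector Carrier n → Set (c ⊔ ℓ₁)
  Proportional u v = ∃ λ a → u ≋ a ∙ v ⊎ v ≋ a ∙ u

  Matrix : Set c
  Matrix = Fin 3 → Fin 3 → Carrier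

  infix  4 _≈ᴹ_
  infixl 7 _⊗_

  _≈ᴹ_ : Matrix → Matrix → Set ℓ₁
  M ≈ᴹ N = ∀ i j → M i j ≈ N i j

  1ᴹ : Matrix
  1ᴹ i j = if does (i ≟ j) then 1# else 0#

  _⊗_ : Matrix → Matrix → Matrix
  (A ⊗ B) i j = sum λ k → A i k * B k j

  _ᵀ : Matrix → Matrix
  (A ᵀ) i j = A j i

  IsInvertible : Matrix → Set (c ⊔ ℓ₁)
  IsInvertible A = ∃ λ B → A ⊗ B ≈ᴹ 1ᴹ × B ⊗ A ≈ᴹ 1ᴹ

  -- Points of PG(n,q).
  record Point (n : ℕ) : Set (c ⊔ ℓ₂) where
    field
      coords  : Vector Carrier (suc n)
      nonzero : ∃ λ i → coords i # 0#

  open Point public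

  infix 4 _∼_

  _∼_ : ∀ {n} → Point n → Point n → Set (c ⊔ ℓ₁ ⊔ ℓ₂)
  P ∼ Q = ∃ λ a → a # 0# × coords P ≋ a ∙ coords Q

  PG : ℕ → Setoid (c ⊔ ℓ₂) (c ⊔ ℓ₁ ⊔ ℓ₂)
  PG n = record
    { Carrier       = Point n
    ; _≈_           = _∼_
    ; isEquivalence = record
      { refl  = 1# , 1#0 , λ i → sym (*-identityˡ _)
      ; sym   = λ {P} {Q} → ∼-sym {P} {Q}
      ; trans = λ (a , a#0 , P≋aQ) (b , b#0 , Q≋bR) →
          a * b , x#0y#0→xy#0 a#0 b#0 ,
          λ i → trans (P≋aQ i) (trans (*-congˡ (Q≋bR i)) (sym (*-assoc a b _)))
      }
    }
    where
    ∼-sym : {P Q : Point n} → P ∼ Q → Q ∼ P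
    ∼-sym {P} {Q} (a , a#0 , P≋aQ) with #⇒invertible a#0
    ... | a⁻¹ , a⁻¹a≈1 , _ = a⁻¹ , invertibleʳ⇒# (a , inverse) , λ i → sym (begin
          a⁻¹ * coords P i       ≈⟨ *-congˡ (P≋aQ i) ⟩
          a⁻¹ * (a * coords Q i) ≈⟨ *-assoc a⁻¹ a _ ⟨
          a⁻¹ * a * coords Q i   ≈⟨ *-congʳ a⁻¹*a≈1 ⟩
          1# * coords Q i        ≈⟨ *-identityˡ _ ⟩
          coords Q i             ∎)
      where
      open ≈-Reasoning setoid
      a⁻¹*a≈1 : a⁻¹ * a ≈ 1#
      a⁻¹*a≈1 = trans (*-congˡ (sym (x-0≈x a))) a⁻¹a≈1
      inverse : (a⁻¹ - 0#) * a ≈ 1#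
      inverse = trans (*-congʳ (x-0≈x a⁻¹)) a⁻¹*a≈1

  -- The coefficients of X₀², X₀X₁, X₀X₂, X₁², X₁X₂, X₂² in the polynomial
  -- (l₀X₀ + l₁X₁ + l₂X₂)(m₀X₀ + m₁X₁ + m₂X₂).
  product : Vector Carrier 3 → Vector Carrier 3 → Vector Carrier 6
  product l m =
      l 0F * m 0F
    ∷ l 0F * m 1F + l 1F * m 0F
    ∷ l 0F * m 2F + l 2F * m 0F
    ∷ l 1F * m 1F
    ∷ l 1F * m 2F + l 2F * m 1F
    ∷ l 2F * m 2F
    ∷ []

module PG5 {c ℓ₁ ℓ₂} (F : HeytingField c ℓ₁ ℓ₂) where

  open CommutativeRing (ring F)
  open HeytingField F using (_#_)
  open Sum semiring using (sum)
  open Mult semiring renaming (_×_ to _·_)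
  open VecEquality setoid using (_≋_)
  open LinearAlgebra F public

  matrix : Vector Carrier 6 → Matrix
  matrix y = (y 0F ∷ y 1F ∷ y 2F ∷ [])
           ∷ (y 1F ∷ y 3F ∷ y 4F ∷ [])
           ∷ (y 2F ∷ y 4F ∷ y 5F ∷ [])
           ∷ []

  -- A line is given as the join of two distinct points.
  record Line : Set (c ⊔ ℓ₁ ⊔ ℓ₂) where
    field
      P Q      : Point 5
      distinct : ¬ P ∼ Q

  infix 4 _∈ˡ_ _∈ʰ_ _⊆ʰ_

  _∈ˡ_ : Point 5 → Line → Set (c ⊔ ℓ₁)
  X ∈ˡ L = ∃₂ λ a b → coords X ≋ a ∙ coords P ⊕ b ∙ coords Q
    where open Line L

  -- The image of a point set S under the projectivity M ↦ A M Aᵀ.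
  Image : ∀ {ℓ} → Matrix → Pred (Point 5) ℓ → Pred (Point 5) (c ⊔ ℓ₁ ⊔ ℓ₂ ⊔ ℓ)
  Image A S X = ∃ λ Y → S Y × ∃ λ a → a # 0# ×
    matrix (coords X) ≈ᴹ λ i j → a * (A ⊗ matrix (coords Y) ⊗ A ᵀ) i j

  InOrbitOf : ∀ {ℓ} → Pred (Point 5) ℓ → Pred Line (c ⊔ ℓ₁ ⊔ ℓ₂ ⊔ ℓ)
  InOrbitOf S L = ∃ λ A → IsInvertible A × (∀ X → X ∈ˡ L ⇔ Image A S X)

  -- No scalar and no condition (x,y) ≠ (0,0) is needed: the family is closed
  -- under scaling and coords X ≠ 0.
  representative₁₃,₃ : Pred (Point 5) (c ⊔ ℓ₁)
  representative₁₃,₃ X = ∃₂ λ x y → matrix (coords X) ≈ᴹ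
    ( (0# ∷ x     ∷ 0# ∷ [])
    ∷ (x  ∷ x + y ∷ 0# ∷ [])
    ∷ (0# ∷ 0#    ∷ y  ∷ [])
    ∷ [])

  o₁₃,₃ : Pred Line (c ⊔ ℓ₁ ⊔ ℓ₂)
  o₁₃,₃ = InOrbitOf representative₁₃,₃

  -- The coordinates of a hyperplane are (a₀₀ , a₀₁ , a₀₂ , a₁₁ , a₁₂ , a₂₂), both
  -- the coefficients of its equation in Y₀ , … , Y₅ and those of its conic.
  Hyperplane : Set (c ⊔ ℓ₂)
  Hyperplane = Point 5

  _∈ʰ_ : Point 5 → Hyperplane → Set ℓ₁
  X ∈ʰ H = sum (λ k → coords H k * coords X k) ≈ 0#

  _⊆ʰ_ : Line → Hyperplane → Set (c ⊔ ℓ₁ ⊔ ℓ₂)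
  L ⊆ʰ H = ∀ X → X ∈ˡ L → X ∈ʰ H

  ℋ₁ : Pred Hyperplane (c ⊔ ℓ₁)
  ℋ₁ H = ∃₂ λ a l → coords H ≋ a ∙ product l l

  ℋ₂ᵣ : Pred Hyperplane (c ⊔ ℓ₁)
  ℋ₂ᵣ H = ∃₂ λ l m → ¬ Proportional l m × coords H ≋ product l m

  ℋ₃ : Pred Hyperplane ℓ₂
  ℋ₃ H = 4 · (a₀₀ * a₁₁ * a₂₂) + a₀₁ * a₀₂ * a₁₂
           - a₀₀ * (a₁₂ * a₁₂) - a₁₁ * (a₀₂ * a₀₂) - a₂₂ * (a₀₁ * a₀₁) # 0#
    where
    a₀₀ = coords H 0F
    a₀₁ = coords H 1F
    a₀₂ = coords H 2F
    a₁₁ = coords H 3F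
    a₁₂ = coords H 4F
    a₂₂ = coords H 5F

  HyperplanesThrough : ∀ {ℓ} → Line → Pred Hyperplane ℓ →
    Setoid (c ⊔ ℓ₁ ⊔ ℓ₂ ⊔ ℓ) (c ⊔ ℓ₁ ⊔ ℓ₂)
  HyperplanesThrough L 𝒞 = On.setoid {B = ∃ λ H → L ⊆ʰ H × 𝒞 H} (PG 5) proj₁

-- Meant for F of order q, E of order q² and ι an embedding, so that E is 𝔽_{q²} and
-- x ↦ x ^ q is the conjugation of E over F.

module Distribution {c ℓ₁ ℓ₂ c′ ℓ₁′ ℓ₂′} (q : ℕ)
  (F : HeytingField c ℓ₁ ℓ₂) (E : HeytingField c′ ℓ₁′ ℓ₂′)
  (ι : HeytingField.Carrier F → HeytingField.Carrier E) where

  open PG5 F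
  private
    module E  = CommutativeRing (ring E)
    module LE = LinearAlgebra E
  open Exp E.semiring using (_^_)
  open VecEquality E.setoid using (_≋_)

  conjugate : ∀ {n} → Vector E.Carrier n → Vector E.Carrier n
  conjugate l i = l i ^ q

  ℋ₂ᵢ : Pred Hyperplane (c ⊔ c′ ⊔ ℓ₁′)
  ℋ₂ᵢ H = ∃₂ λ a l → ¬ LE.Proportional l (conjugate l) ×
    (λ k → ι (coords H k)) ≋ ι a LE.∙ LE.product l (conjugate l)

  HasOD₄ : Line → Vec ℕ 4 → Set (c ⊔ ℓ₁ ⊔ ℓ₂ ⊔ c′ ⊔ ℓ₁′)
  HasOD₄ L (h₁ ∷ᵛ h₂ᵣ ∷ᵛ h₂ᵢ ∷ᵛ h₃ ∷ᵛ []ᵛ) =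
      HasCardinality (HyperplanesThrough L ℋ₁)  h₁
    × HasCardinality (HyperplanesThrough L ℋ₂ᵣ) h₂ᵣ
    × HasCardinality (HyperplanesThrough L ℋ₂ᵢ) h₂ᵢ
    × HasCardinality (HyperplanesThrough L ℋ₃)  h₃

IsEmbedding : ∀ {c ℓ₁ ℓ₂ c′ ℓ₁′ ℓ₂′} (F : HeytingField c ℓ₁ ℓ₂) (E : HeytingField c′ ℓ₁′ ℓ₂′) →
  (HeytingField.Carrier F → HeytingField.Carrier E) → Set (c ⊔ ℓ₁ ⊔ ℓ₁′)
IsEmbedding F E = IsRingMonomorphism (CommutativeRing.rawRing (ring F)) (CommutativeRing.rawRing (ring E))

{-# OPTIONS --safe #-}

-- Substituting A turns the conics through the line into the canonical ones, with coefficients (a , t , b , t , c , t),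
-- and preserves the four classes.  In characteristic 2 the discriminant of a conic is its value at the nucleus.  The
-- canonical conics with c = 1 are singular iff a = t (b + b² + t²), and then split over 𝔽_q iff t lies in the additive
-- subgroup Im ℘ of index 2, where ℘ z = z² + z; those with c = 0, t = 1 are singular iff b = 1, and then split iff
-- a ∈ Im ℘; those with c = t = 0 are X₀ (a X₀ + b X₂).  That the singular conics which do not split over 𝔽_q are pairs
-- of conjugate lines over 𝔽_q² is the solvability of ℘ z = t there for t ∈ 𝔽_q ∖ Im ℘: if θ ∉ 𝔽_q, then
-- w = θ / (θ + θ^q) satisfies w^q = w + 1, so ℘ w ∈ 𝔽_q ∖ Im ℘, and z is found in w + 𝔽_q.

module Submission where

open import Defs
open import Algebra.Apartness.Bundles using (HeytingField)
open import Algebra.Bundles using (CommutativeMonoid; CommutativeRing; RawRing)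
open import Algebra.Morphism.Structures using (IsRingMonomorphism)
open import Algebra.Solver.Ring.AlmostCommutativeRing
  using (fromCommutativeRing; Induced-equivalence; _-Raw-AlmostCommutative⟶_)
open import Data.Bool.Base using (Bool; true; false; if_then_else_)
open import Data.Bool.Properties using (xor-∧-commutativeRing)
open import Data.Fin.Base using (Fin; zero; suc; punchOut; toℕ)
open import Data.Fin.Patterns using (0F; 1F; 2F; 3F; 4F; 5F)
open import Data.Fin.Permutation using (Permutation; _⟨$⟩ʳ_; ↔⇒≡)
open import Data.Maybe.Base using (just; nothing)
open import Data.Nat.Base as ℕ using (ℕ; zero; suc; z≤n; s≤s)
open import Data.Nat.Divisibility using (_∣_; ∣1⇒≡1)
open import Data.Nat.Primality using (Prime; prime[2]; euclidsLemma; prime⇒irreducible)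
open import Data.Product.Base using (∃; ∃₂; _×_; _,_; proj₁; proj₂)
open import Data.Product.Function.NonDependent.Setoid using (_×-inverse_)
open import Data.Product.Relation.Binary.Pointwise.NonDependent using (×-setoid)
open import Data.Sum.Base using (_⊎_; inj₁; inj₂; [_,_]′)
open import Data.Sum.Function.Setoid using (_⊎-inverse_)
open import Data.Sum.Relation.Binary.Pointwise using (⊎-setoid)
open import Function.Base using (_∘_; id)
open import Function.Bundles using (Func; Inverse; Equivalence; _⇔_)
open import Level using (Level; _⊔_)
open import Relation.Binary.Bundles using (Setoid)
open import Relation.Binary.Core using (_Preserves_⟶_)
open import Relation.Binary.Definitions using (_Respects_; WeaklyDecidable)
open import Relation.Binary.PropositionalEquality as ≡ using (_≡_)
open import Relation.Nullary using (¬_; Dec; yes; no; does; contradiction; ¬?)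
open import Relation.Nullary.Decidable using (map′)
open import Relation.Unary as U using (Pred)
import Algebra.Apartness.Properties.HeytingCommutativeRing as HeytingProperties
import Algebra.Properties.CommutativeMonoid.Sum as MonoidSum
import Algebra.Properties.CommutativeSemiring.Exp as CommutativeExp
import Algebra.Properties.Group as GroupProperties
import Algebra.Properties.Monoid.Mult as MonoidMult
import Algebra.Properties.Semiring.Exp as Exp
import Algebra.Properties.Semiring.Mult as Mult
import Algebra.Properties.Semiring.Sum as Sum
import Algebra.Solver.Ring as RingSolver
import Data.Fin.Properties as Fin
import Data.Nat.Properties as ℕ
import Data.Product.Relation.Binary.Pointwise.NonDependent as ×
import Data.Sum.Relation.Binary.Pointwise as ⊎
import Data.Vec.Functional as Vector
import Data.Vec.Functional.Relation.Binary.Equality.Setoid as VecEquality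
import Function.Construct.Composition as Compose
import Function.Construct.Identity as Identity
import Function.Construct.Symmetry as Symmetry
import Relation.Binary.Construct.On as On
import Relation.Binary.Reasoning.Setoid as ≈-Reasoning

-- `HasCardinality` asks for a bijection, so each class is counted by its own parameter setoid of
-- normal forms; none is obtained by subtraction from the q³ + q² + q + 1 hyperplanes through the
-- line. The exclusions therefore need proofs of their own. If a conic with c = 1 splits over 𝔽_q,
-- its two cross terms x, y satisfy x + y = 1 and xy = t², so t² = ℘ x and t = ℘ (x + t). If it is a
-- pair of conjugate lines, the two forms take conjugate values at a rational point, so both vanish
-- at every rational zero of the conic; for t in Im ℘ there are enough such zeros to make the form a
-- multiple of X₀, hence proportional to its conjugate. The index of Im ℘ is 2 because the fibres of
-- ℘ over its image are the pairs z, z + 1. Hence two elements outside Im ℘ have their sum inside,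
-- which is why a translate of w by a rational element solves ℘ z = t. That elements with x^q = x
-- are rational comes from counting the roots of X^q + X.

private variable
  a b ℓ ℓ′ p : Level
  d m n : ℕ

-- Cardinalities of finite setoids.

-- Equality forgets the proof of `P`, so that an element with several witnesses, such as z and z + 1
-- for a value of ℘, is counted once.
Subsetoid : (S : Setoid a ℓ) → Pred (Setoid.Carrier S) p → Setoid (a ⊔ p) ℓ
Subsetoid S P = On.setoid {B = ∃ P} S proj₁

module _ {S : Setoid a ℓ} {T : Setoid b ℓ′} where
  private
    module S = Setoid S
    module T = Setoid T

  -- The chosen preimages need not respect equality: injectivity of `g` makes the choice a
  -- congruence.
  card-bijection : HasCardinality S n → (g : S.Carrier → T.Carrier) → g Preserves S._≈_ ⟶ T._≈_ →
    (∀ {x y} → g x T.≈ g y → x S.≈ y) → (∀ y → ∃ λ x → g x T.≈ y) → HasCardinality T n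
  card-bijection #S g g-cong g-inj g-surj = record
    { to        = to ∘ pre
    ; from      = g ∘ from
    ; to-cong   = λ {x} {y} x≈y → to-cong (g-inj (T.trans (gpre x) (T.trans x≈y (T.sym (gpre y)))))
    ; from-cong = g-cong ∘ from-cong
    ; inverse   =
        (λ {i} {y} y≈gi → inverseˡ (g-inj (T.trans (gpre y) y≈gi))) ,
        (λ {y} eq → T.trans (g-cong (inverseʳ eq)) (gpre y))
    }
    where
    open Inverse #S
    pre : T.Carrier → S.Carrier
    pre y = proj₁ (g-surj y)
    gpre : ∀ y → g (pre y) T.≈ y
    gpre y = proj₂ (g-surj y)

card-unique : {S : Setoid a ℓ} → HasCardinality S m → HasCardinality S n → m ≡ n
card-unique #S #S′ = ↔⇒≡ (Compose.inverse (Symmetry.inverse #S) #S′)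

card-× : {S : Setoid a ℓ} {T : Setoid b ℓ′} → HasCardinality S m → HasCardinality T n →
  HasCardinality (×-setoid S T) (m ℕ.* n)
card-× #S #T = Compose.inverse (Compose.inverse (#S ×-inverse #T) ×.Pointwise-≡↔≡) (Symmetry.inverse Fin.*↔×)

card-⊎ : {S : Setoid a ℓ} {T : Setoid b ℓ′} → HasCardinality S m → HasCardinality T n →
  HasCardinality (⊎-setoid S T) (m ℕ.+ n)
card-⊎ #S #T = Compose.inverse (Compose.inverse (#S ⊎-inverse #T) (⊎.Pointwise-≡↔≡ _ _)) (Symmetry.inverse Fin.+↔⊎)

-- Pigeonhole: if `j` were missed, punching it out would inject `Fin (suc n)` into `Fin n`.
injective⇒surjective : {f : Fin n → Fin n} → (∀ {i j} → f i ≡ f j → i ≡ j) → ∀ j → ∃ λ i → f i ≡ j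
injective⇒surjective {suc n} {f} f-inj j with Fin.any? (λ i → f i Fin.≟ j)
... | yes hit = hit
... | no miss = contradiction
  (Fin.injective⇒≤ {f = λ i → punchOut (j≢f i)} (f-inj ∘ Fin.punchOut-injective (j≢f _) (j≢f _))) ℕ.1+n≰n
  where
  j≢f : ∀ i → ¬ j ≡ f i
  j≢f i j≡fi = miss (i , ≡.sym j≡fi)

module _ {S : Setoid a ℓ} {T : Setoid b ℓ′} where
  private
    module S = Setoid S
    module T = Setoid T

  card-injective⇒surjective : HasCardinality S n → HasCardinality T n →
    (g : S.Carrier → T.Carrier) → g Preserves S._≈_ ⟶ T._≈_ →
    (∀ {x y} → g x T.≈ g y → x S.≈ y) → ∀ y → ∃ λ x → g x T.≈ y
  card-injective⇒surjective #S #T g g-cong g-inj y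
    with injective⇒surjective {f = T′.to ∘ g ∘ S′.from} (from-inj ∘ g-inj ∘ to-inj) (T′.to y)
    where
    module S′ = Inverse #S
    module T′ = Inverse #T
    to-inj : ∀ {u v} → T′.to u ≡ T′.to v → u T.≈ v
    to-inj eq = T.trans (T.sym (T′.inverseʳ (≡.sym eq))) (T′.inverseʳ ≡.refl)
    from-inj : ∀ {i j} → S′.from i S.≈ S′.from j → i ≡ j
    from-inj eq = ≡.trans (≡.sym (S′.inverseˡ S.refl)) (S′.inverseˡ eq)
  ... | i , eq = Inverse.from #S i ,
    T.trans (T.sym (Inverse.inverseʳ #T (≡.sym eq))) (Inverse.inverseʳ #T ≡.refl)

module _ {n : ℕ} {Q : Pred (Fin (suc n)) p} where

  card-consFin : Q zero → HasCardinality (Subsetoid (≡.setoid (Fin n)) (Q ∘ suc)) m →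
    HasCardinality (Subsetoid (≡.setoid (Fin (suc n))) Q) (suc m)
  card-consFin {m = m} q0 #Q = card-bijection {S = ≡.setoid (Fin (suc m))} {T = Subsetoid (≡.setoid (Fin (suc n))) Q}
    (Identity.inverse _) g (λ { {i} ≡.refl → ≡.refl {x = proj₁ (g i)} }) g-inj g-surj
    where
    open Inverse #Q
    g : Fin (suc m) → ∃ Q
    g zero    = zero , q0
    g (suc i) = suc (proj₁ (from i)) , proj₂ (from i)
    g-inj : ∀ {i j} → proj₁ (g i) ≡ proj₁ (g j) → i ≡ j
    g-inj {zero}  {zero}  eq = ≡.refl
    g-inj {suc i} {suc j} eq = ≡.cong suc
      (≡.trans (≡.sym (inverseˡ {x = i} {y = from i} ≡.refl)) (inverseˡ {x = j} {y = from i} (Fin.suc-injective eq)))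
    g-surj : (y : ∃ Q) → ∃ λ i → proj₁ (g i) ≡ proj₁ y
    g-surj (zero  , _) = zero , ≡.refl
    g-surj (suc i , q) = suc (to (i , q)) , ≡.cong suc (inverseʳ ≡.refl)

  card-skipFin : ¬ Q zero → HasCardinality (Subsetoid (≡.setoid (Fin n)) (Q ∘ suc)) m →
    HasCardinality (Subsetoid (≡.setoid (Fin (suc n))) Q) m
  card-skipFin ¬q0 #Q = card-bijection {T = Subsetoid (≡.setoid (Fin (suc n))) Q} #Q
    (λ (i , q) → suc i , q) (≡.cong suc) Fin.suc-injective
    λ { (zero , q) → contradiction q ¬q0 ; (suc i , q) → (i , q) , ≡.refl }

splitFin : (P : Pred (Fin n) p) → U.Decidable P → ∃₂ λ m k → m ℕ.+ k ≡ n ×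
  HasCardinality (Subsetoid (≡.setoid (Fin n)) P) m ×
  HasCardinality (Subsetoid (≡.setoid (Fin n)) (λ i → ¬ P i)) k
splitFin {zero} P P? = 0 , 0 , ≡.refl , empty , empty
  where
  empty : {Q : Pred (Fin 0) p} → HasCardinality (Subsetoid (≡.setoid (Fin 0)) Q) 0
  empty {Q = Q} = card-bijection {S = ≡.setoid (Fin 0)} {T = Subsetoid (≡.setoid (Fin 0)) Q}
    (Identity.inverse _) (λ ()) (λ { {()} }) (λ { {()} }) (λ ())
splitFin {suc n} P P? with splitFin (P ∘ suc) (P? ∘ suc) | P? zero
... | m , k , ≡.refl , #P , #¬P | yes p0  = suc m , k , ≡.refl , card-consFin p0 #P , card-skipFin (λ ¬p0 → ¬p0 p0) #¬P
... | m , k , ≡.refl , #P , #¬P | no  ¬p0 = m , suc k , ℕ.+-suc m k , card-skipFin ¬p0 #P , card-consFin ¬p0 #¬P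

module _ {S : Setoid a ℓ} (#S : HasCardinality S n) where
  private module S = Setoid S
  open Inverse #S

  card-any? : {P : Pred S.Carrier p} → P Respects S._≈_ → U.Decidable P → Dec (∃ P)
  card-any? resp P? = map′ (λ (i , pi) → from i , pi) (λ (x , px) → to x , resp (S.sym (inverseʳ ≡.refl)) px)
    (Fin.any? (P? ∘ from))

  card-≟ : ∀ x y → Dec (x S.≈ y)
  card-≟ x y = map′ (λ eq → S.trans (S.sym (inverseʳ (≡.sym eq))) (inverseʳ ≡.refl)) to-cong (to x Fin.≟ to y)

  -- Only the sum of the two sizes is known at this stage; the sizes themselves are pinned down
  -- later by comparing with explicit bijections through `card-unique`.
  card-split : (P : Pred S.Carrier p) → P Respects S._≈_ → U.Decidable P → ∃₂ λ m k → m ℕ.+ k ≡ n ×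
    HasCardinality (Subsetoid S P) m × HasCardinality (Subsetoid S (λ x → ¬ P x)) k
  card-split P resp P? with splitFin (P ∘ from) (P? ∘ from)
  ... | m , k , eq , #P , #¬P = m , k , eq , lift resp #P , lift (λ x≈y ¬px py → ¬px (resp (S.sym x≈y) py)) #¬P
    where
    lift : ∀ {k} {Q : Pred S.Carrier p} → Q Respects S._≈_ →
      HasCardinality (Subsetoid (≡.setoid (Fin n)) (Q ∘ from)) k → HasCardinality (Subsetoid S Q) k
    lift {Q = Q} resp #Q = card-bijection {T = Subsetoid S Q} #Q (λ (i , q) → from i , q) from-cong
      (λ eq → ≡.trans (≡.sym (inverseˡ S.refl)) (inverseˡ eq))
      (λ (x , q) → (to x , resp (S.sym (inverseʳ ≡.refl)) q) , inverseʳ ≡.refl)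

-- Arithmetic in characteristic two.

CharacteristicTwo : ∀ {c ℓ} → CommutativeRing c ℓ → Set ℓ
CharacteristicTwo R = 1# + 1# ≈ 0#
  where open CommutativeRing R

module CharTwo {c ℓ} (R : CommutativeRing c ℓ) (1+1≈0 : CharacteristicTwo R) where
  open CommutativeRing R hiding (zero)
  open Exp semiring using (_^_; ^-congˡ; ^-assocʳ)

  x+x≈0 : ∀ x → x + x ≈ 0#
  x+x≈0 x = trans (+-cong (sym (*-identityʳ x)) (sym (*-identityʳ x)))
    (trans (sym (distribˡ x 1# 1#)) (trans (*-congˡ 1+1≈0) (zeroʳ x)))

  -x≈x : ∀ x → - x ≈ x
  -x≈x x = sym (GroupProperties.inverseˡ-unique +-group x x (x+x≈0 x))

  private
    𝔽₂ : RawRing _ _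
    𝔽₂ = CommutativeRing.rawRing xor-∧-commutativeRing

    morphism : 𝔽₂ -Raw-AlmostCommutative⟶ fromCommutativeRing R
    morphism = record
      { ⟦_⟧    = λ b → if b then 1# else 0#
      ; +-homo = λ { true  true → sym 1+1≈0 ; true false → sym (+-identityʳ _) ; false _ → sym (+-identityˡ _) }
      ; *-homo = λ { true  _ → sym (*-identityˡ _) ; false _ → sym (zeroˡ _) }
      ; -‿homo = λ x → sym (-x≈x _)
      ; 0-homo = refl
      ; 1-homo = refl
      }

    _coeff≟_ : WeaklyDecidable (Induced-equivalence morphism)
    true  coeff≟ true  = just refl
    false coeff≟ false = just refl
    _     coeff≟ _     = nothing

  -- The coefficients are in 𝔽₂, so that the solver knows 1 + 1 ≈ 0.
  open RingSolver 𝔽₂ (fromCommutativeRing R) morphism _coeff≟_ public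
    using (solve; _:=_; _:+_; _:*_; con; Polynomial)

  x+y≈0⇒x≈y : ∀ {x y} → x + y ≈ 0# → x ≈ y
  x+y≈0⇒x≈y {x} {y} eq = trans (solve 2 (λ x y → x := x :+ y :+ y) refl x y)
    (trans (+-congʳ eq) (+-identityˡ y))

  x≈y⇒x+y≈0 : ∀ {x y} → x ≈ y → x + y ≈ 0#
  x≈y⇒x+y≈0 {x} {y} eq = trans (+-congʳ eq) (x+x≈0 y)

  -- The exponent is split as 2 · 2^h with the squaring done first, so that only the case of a
  -- square needs characteristic 2.
  frobenius : ∀ h x y → (x + y) ^ (2 ℕ.^ h) ≈ x ^ (2 ℕ.^ h) + y ^ (2 ℕ.^ h)
  frobenius zero    x y = trans (*-identityʳ _) (+-cong (sym (*-identityʳ x)) (sym (*-identityʳ y)))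
  frobenius (suc h) x y = trans (sym (^-assocʳ (x + y) 2 (2 ℕ.^ h)))
    (trans (^-congˡ (2 ℕ.^ h) square) (trans (frobenius h (x ^ 2) (y ^ 2))
      (+-cong (^-assocʳ x 2 (2 ℕ.^ h)) (^-assocʳ y 2 (2 ℕ.^ h)))))
    where
    square : (x + y) ^ 2 ≈ x ^ 2 + y ^ 2
    square = solve 2 (λ x y → let one = con true in
      (x :+ y) :* ((x :+ y) :* one) := x :* (x :* one) :+ y :* (y :* one)) refl x y

-- Finite fields: decidability, units, Fermat's theorem.

module _ (M : CommutativeMonoid a ℓ) where
  open CommutativeMonoid M
  open MonoidSum M using (sum; sum-cong-≋; sum-permute; sum-replicate; ∑-distrib-+)
  open MonoidMult monoid using () renaming (_×_ to _·_)

  -- Translation by `x` permutes the elements of `S`, so the total over `S` absorbs n copies of `x`.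
  -- The additive monoid gives n · 1 = 0, the multiplicative one over the units gives Fermat's
  -- theorem. The map `e` is there because the units form a setoid of their own, not the carrier of
  -- the monoid.
  sum-translate : {S : Setoid b ℓ′} (#S : HasCardinality S n) (e : Func S setoid) (f : Inverse S S) →
    ∀ x → (∀ s → Func.to e (Inverse.to f s) ≈ x ∙ Func.to e s) →
    n · x ∙ sum (Func.to e ∘ Inverse.from #S) ≈ sum (Func.to e ∘ Inverse.from #S)
  sum-translate {n = n} {S = S} #S e f x ef = begin
    n · x ∙ sum t                 ≈⟨ ∙-congʳ (sum-replicate n) ⟨
    sum (Vector.replicate n x) ∙ sum t   ≈⟨ ∑-distrib-+ (Vector.replicate n x) t ⟨
    sum (λ i → x ∙ t i)
      ≈⟨ sum-cong-≋ (λ i → trans (sym (ef (from i))) (Func.cong e (Setoid.sym S (inverseʳ ≡.refl)))) ⟩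
    sum (λ i → t (π ⟨$⟩ʳ i))      ≈⟨ sum-permute t π ⟨
    sum t                         ∎
    where
    open Inverse #S
    open ≈-Reasoning setoid
    t : Fin n → Carrier
    t = Func.to e ∘ from
    π : Permutation n n
    π = Compose.inverse (Compose.inverse (Symmetry.inverse #S) f) #S

module FiniteField {c ℓ₁ ℓ₂} (K : HeytingField c ℓ₁ ℓ₂) {n : ℕ} (#K : HasCardinality (setoidOf K) n) where
  open CommutativeRing (ring K) hiding (zero; ring)
  open HeytingField K using (_#_; #⇒invertible; tight; heytingCommutativeRing)
  open HeytingProperties heytingCommutativeRing using (1#0; x#0y#0→xy#0; invertibleʳ⇒#; x-0≈x; #-congʳ)
  open Exp semiring using (_^_)
  open Mult semiring using () renaming (_×_ to _·_)
  open ≈-Reasoning setoid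

  inverse : ∀ {x} → x # 0# → ∃ λ y → x * y ≈ 1#
  inverse {x} x#0 with #⇒invertible x#0
  ... | y , _ , eq = y , trans (*-congʳ (sym (x-0≈x x))) eq

  inverse⇒# : ∀ {x y} → x * y ≈ 1# → x # 0#
  inverse⇒# {x} {y} xy≈1 = invertibleʳ⇒# (y , trans (*-congʳ (x-0≈x x)) xy≈1)

  _≟_ : ∀ x y → Dec (x ≈ y)
  _≟_ = card-≟ #K

  -- Apartness from zero means invertibility, which a finite search for an inverse decides;
  -- tightness turns a failed search into equality with zero.
  zero? : ∀ x → x ≈ 0# ⊎ x # 0#
  zero? x with card-any? #K {P = λ y → x * y ≈ 1#} (λ y≈z xy≈1 → trans (*-congˡ (sym y≈z)) xy≈1) (λ y → (x * y) ≟ 1#)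
  ... | yes (_ , xy≈1) = inj₂ (inverse⇒# xy≈1)
  ... | no  ¬inv       = inj₁ (proj₁ (tight x 0#) (¬inv ∘ inverse))

  #⇒≉ : ∀ {x} → x # 0# → ¬ x ≈ 0#
  #⇒≉ {x} x#0 x≈0 = proj₂ (tight x 0#) x≈0 x#0

  ≉⇒# : ∀ {x} → ¬ x ≈ 0# → x # 0#
  ≉⇒# {x} x≉0 = [ (λ x≈0 → contradiction x≈0 x≉0) , id ]′ (zero? x)

  xy#0⇒x#0 : ∀ {x y} → x * y # 0# → x # 0#
  xy#0⇒x#0 {x} {y} xy#0 = ≉⇒# λ x≈0 → #⇒≉ xy#0 (trans (*-congʳ x≈0) (zeroˡ y))

  xy#0⇒y#0 : ∀ {x y} → x * y # 0# → y # 0#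
  xy#0⇒y#0 {x} {y} xy#0 = xy#0⇒x#0 (#-congʳ (*-comm x y) xy#0)

  xy≈0⇒x≈0∨y≈0 : ∀ {x y} → x * y ≈ 0# → x ≈ 0# ⊎ y ≈ 0#
  xy≈0⇒x≈0∨y≈0 {x} {y} xy≈0 with zero? x | zero? y
  ... | inj₁ x≈0 | _        = inj₁ x≈0
  ... | inj₂ _   | inj₁ y≈0 = inj₂ y≈0
  ... | inj₂ x#0 | inj₂ y#0 = contradiction xy≈0 (#⇒≉ (x#0y#0→xy#0 x#0 y#0))

  *-cancelˡ : ∀ {x y z} → x # 0# → x * y ≈ x * z → y ≈ z
  *-cancelˡ {x} {y} {z} x#0 xy≈xz with inverse x#0
  ... | x⁻¹ , xx⁻¹≈1 = begin
    y              ≈⟨ shift y ⟩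
    x⁻¹ * (x * y)  ≈⟨ *-congˡ xy≈xz ⟩
    x⁻¹ * (x * z)  ≈⟨ shift z ⟨
    z              ∎
    where
    shift : ∀ u → u ≈ x⁻¹ * (x * u)
    shift u = trans (sym (*-identityˡ u)) (trans (*-congʳ (trans (sym xx⁻¹≈1) (*-comm x x⁻¹))) (*-assoc x⁻¹ x u))

  Unit : Setoid (c ⊔ ℓ₂) ℓ₁
  Unit = Subsetoid setoid (_# 0#)

  card-units : ∃ λ m → suc m ≡ n × HasCardinality Unit m
  card-units with card-split #K (_≈ 0#) (λ x≈y x≈0 → trans (sym x≈y) x≈0) (_≟ 0#)
  ... | k , m , k+m≡n , #0 , #≉0 = m , ≡.trans (≡.cong (ℕ._+ m) (≡.sym k≡1)) k+m≡n ,
    card-bijection {T = Unit} #≉0 (λ (x , x≉0) → x , ≉⇒# x≉0) id id (λ (x , x#0) → (x , #⇒≉ x#0) , refl)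
    where
    k≡1 : k ≡ 1
    k≡1 = card-unique #0 (card-bijection {S = ≡.setoid (Fin 1)} {T = Subsetoid setoid (_≈ 0#)} (Identity.inverse _)
      (λ _ → 0# , refl) (λ _ → refl) (λ { {0F} {0F} _ → ≡.refl }) (λ (_ , x≈0) → 0F , sym x≈0))

  n·1≈0 : n · 1# ≈ 0#
  n·1≈0 = GroupProperties.identityˡ-unique +-group _ _
    (sum-translate +-commutativeMonoid #K (Identity.function setoid) +1 1# (λ _ → refl))
    where
    cancel : ∀ {u v} → u + v ≈ 0# → ∀ {x y} → y ≈ v + x → u + y ≈ x
    cancel u+v≈0 {x} y≈v+x = trans (+-congˡ y≈v+x) (trans (sym (+-assoc _ _ x)) (trans (+-congʳ u+v≈0) (+-identityˡ x)))
    +1 : Inverse setoid setoid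
    +1 = record
      { to        = 1# +_
      ; from      = - 1# +_
      ; to-cong   = +-congˡ
      ; from-cong = +-congˡ
      ; inverse   = cancel (-‿inverseʳ 1#) , cancel (-‿inverseˡ 1#)
      }

  private
    product#0 : ∀ {m} (t : Fin m → Carrier) → (∀ i → t i # 0#) → MonoidSum.sum *-commutativeMonoid t # 0#
    product#0 {zero}  t t#0 = 1#0
    product#0 {suc m} t t#0 = x#0y#0→xy#0 (t#0 zero) (product#0 (t ∘ suc) (t#0 ∘ suc))

  fermat : ∀ x → x ^ n ≈ x
  fermat x with card-units | zero? x
  ... | m , ≡.refl , #U | inj₁ x≈0 = trans (*-congʳ x≈0) (trans (zeroˡ _) (sym x≈0))
  ... | m , ≡.refl , #U | inj₂ x#0 with inverse x#0
  ...   | y , xy≈1 = trans (*-congˡ x^m≈1) (*-identityʳ x)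
    where
    y#0 : y # 0#
    y#0 = inverse⇒# (trans (*-comm y x) xy≈1)
    cancel : ∀ {u v} → u * v ≈ 1# → ∀ {z z′} → z′ ≈ v * z → u * z′ ≈ z
    cancel uv≈1 {z} z′≈vz = trans (*-congˡ z′≈vz) (trans (sym (*-assoc _ _ z)) (trans (*-congʳ uv≈1) (*-identityˡ z)))
    *x : Inverse Unit Unit
    *x = record
      { to        = λ (z , z#0) → x * z , x#0y#0→xy#0 x#0 z#0
      ; from      = λ (z , z#0) → y * z , x#0y#0→xy#0 y#0 z#0
      ; to-cong   = *-congˡ
      ; from-cong = *-congˡ
      ; inverse   = cancel xy≈1 , cancel (trans (*-comm y x) xy≈1)
      }
    Π : Carrier
    Π = MonoidSum.sum *-commutativeMonoid (proj₁ ∘ Inverse.from #U)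
    x^m≈1 : x ^ m ≈ 1#
    x^m≈1 = *-cancelˡ (product#0 _ (proj₂ ∘ Inverse.from #U)) (begin
      Π * x ^ m  ≈⟨ *-comm Π _ ⟩
      x ^ m * Π  ≈⟨ sum-translate *-commutativeMonoid #U (record { to = proj₁ ; cong = id }) *x x (λ _ → refl) ⟩
      Π          ≈⟨ *-identityʳ Π ⟨
      Π * 1#     ∎)

-- Even prime powers and the characteristic.

private
  2∣p^h⇒p≡2 : ∀ {p} → Prime p → ∀ h → 2 ∣ p ℕ.^ h → p ≡ 2
  2∣p^h⇒p≡2 p-prime zero 2∣1 with () ← ∣1⇒≡1 2∣1
  2∣p^h⇒p≡2 {p} p-prime (suc h) 2∣p*p^h with euclidsLemma p (p ℕ.^ h) prime[2] 2∣p*p^h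
  ... | inj₂ 2∣p^h = 2∣p^h⇒p≡2 p-prime h 2∣p^h
  ... | inj₁ 2∣p with prime⇒irreducible p-prime 2∣p
  ...   | inj₂ 2≡p = ≡.sym 2≡p

even-primePower : ∀ {q} → IsPrimePower q → 2 ∣ q → ∃ λ h → q ≡ 2 ℕ.^ suc h
even-primePower (p , suc h , p-prime , _ , ≡.refl) 2∣q with 2∣p^h⇒p≡2 p-prime (suc h) 2∣q
... | ≡.refl = h , ≡.refl

module _ {c ℓ₁ ℓ₂} (K : HeytingField c ℓ₁ ℓ₂) where
  open CommutativeRing (ring K) hiding (zero; ring)
  open Mult semiring using (×1-homo-*) renaming (_×_ to _·_)

  -- The integer 2^h vanishes in a field of that order; it is a product of factors 2, and a field
  -- has no zero divisors.
  characteristicTwo : ∀ h → HasCardinality (setoidOf K) (2 ℕ.^ h) → CharacteristicTwo (ring K)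
  characteristicTwo h #K = descend h n·1≈0
    where
    open FiniteField K #K
    open HeytingProperties (HeytingField.heytingCommutativeRing K) using (1#0)
    descend : ∀ h → (2 ℕ.^ h) · 1# ≈ 0# → 1# + 1# ≈ 0#
    descend zero    1+0≈0 = contradiction (trans (sym (+-identityʳ 1#)) 1+0≈0) (#⇒≉ 1#0)
    descend (suc h) eq with xy≈0⇒x≈0∨y≈0 (trans (sym (×1-homo-* 2 (2 ℕ.^ h))) eq)
    ... | inj₁ 2·1≈0   = trans (+-congˡ (sym (+-identityʳ 1#))) 2·1≈0
    ... | inj₂ 2^h·1≈0 = descend h 2^h·1≈0

-- Roots of polynomials and the image of ℘ in a finite field of characteristic two.

module EvenField {c ℓ₁ ℓ₂} (K : HeytingField c ℓ₁ ℓ₂) {n : ℕ} (#K : HasCardinality (setoidOf K) n)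
  (1+1≈0 : CharacteristicTwo (ring K)) where

  open import Data.Vec.Base using (Vec; []; _∷_; replicate)
  open CommutativeRing (ring K) hiding (zero; ring)
  open HeytingProperties (HeytingField.heytingCommutativeRing K) using (1#0)
  open Exp semiring using (_^_)
  open CharTwo (ring K) 1+1≈0
  open FiniteField K #K
  open Inverse #K using (to; to-cong; inverseʳ)

  -- Evaluates the monic polynomial of degree d with lower coefficients cs, constant term first.
  monic : Vec Carrier d → Carrier → Carrier
  monic []       x = 1#
  monic (c ∷ cs) x = c + x * monic cs x

  -- Synthetic division by X + r, which is X - r in characteristic 2: the coefficients of the
  -- quotient are the Horner values of the successive tails at `r`.
  quotient : Vec Carrier (suc d) → Carrier → Vec Carrier d
  quotient (_ ∷ [])           r = []
  quotient (_ ∷ cs@(_ ∷ _)) r = monic cs r ∷ quotient cs r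

  monic-quotient : (cs : Vec Carrier (suc d)) (r x : Carrier) →
    monic cs x ≈ monic cs r + (x + r) * monic (quotient cs r) x
  monic-quotient (c ∷ []) r x = solve 3 (λ c r x →
    c :+ x :* con true := (c :+ r :* con true) :+ (x :+ r) :* con true) refl c r x
  monic-quotient (c ∷ cs@(_ ∷ _)) r x = trans (+-congˡ (*-congˡ (monic-quotient cs r x)))
    (solve 5 (λ c r x u v → c :+ x :* (u :+ (x :+ r) :* v) := (c :+ r :* u) :+ (x :+ r) :* (u :+ x :* v)) refl
      c r x (monic cs r) (monic (quotient cs r) x))

  -- Dividing by X + r₀ lowers the degree by one, and the other roots survive because they differ
  -- from r₀.
  roots≤degree : (cs : Vec Carrier d) (r : Fin m → Carrier) → (∀ {i j} → r i ≈ r j → i ≡ j) →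
    (∀ i → monic cs (r i) ≈ 0#) → m ℕ.≤ d
  roots≤degree {m = zero}  cs r r-inj root = z≤n
  roots≤degree {m = suc m} []          r r-inj root = contradiction (root zero) (#⇒≉ 1#0)
  roots≤degree {m = suc m} cs@(_ ∷ _) r r-inj root =
    s≤s (roots≤degree (quotient cs (r zero)) (r ∘ suc) (Fin.suc-injective ∘ r-inj) λ i →
      [ (λ eq → contradiction (r-inj (x+y≈0⇒x≈y eq)) λ ()) , id ]′ (xy≈0⇒x≈0∨y≈0 (begin
        (r (suc i) + r zero) * monic (quotient cs (r zero)) (r (suc i))                   ≈⟨ +-identityˡ _ ⟨
        0# + (r (suc i) + r zero) * monic (quotient cs (r zero)) (r (suc i))              ≈⟨ +-congʳ (root zero) ⟨
        monic cs (r zero) + (r (suc i) + r zero) * monic (quotient cs (r zero)) (r (suc i))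
          ≈⟨ monic-quotient cs (r zero) (r (suc i)) ⟨
        monic cs (r (suc i))                                                             ≈⟨ root (suc i) ⟩
        0#                                                                               ∎)))
    where open ≈-Reasoning setoid

  -- The fixed elements are the roots of X^q + X, whose lower coefficients are 0, 1, 0, ..., 0. For
  -- q = 1 this polynomial would be zero, whence the bound 2 ≤ q.
  fixed≤exponent : ∀ q → 2 ℕ.≤ q → (r : Fin m → Carrier) → (∀ {i j} → r i ≈ r j → i ≡ j) →
    (∀ i → r i ^ q ≈ r i) → m ℕ.≤ q
  fixed≤exponent (suc zero) (s≤s ()) r
  fixed≤exponent (suc (suc k)) _ r r-inj fixed = roots≤degree (0# ∷ 1# ∷ replicate k 0#) r r-inj λ i →
    trans (+-identityˡ _) (trans (*-congˡ (+-congˡ (*-congˡ (power k (r i)))))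
      (trans (solve 2 (λ x y → x :* (con true :+ x :* y) := x :+ x :* (x :* y)) refl (r i) (r i ^ k))
        (x≈y⇒x+y≈0 (sym (fixed i)))))
    where
    power : ∀ k x → monic (replicate k 0#) x ≈ x ^ k
    power zero    x = refl
    power (suc k) x = trans (+-identityˡ _) (*-congˡ (power k x))

  -- The Artin-Schreier map, additive with kernel consisting of 0 and 1.
  ℘ : Carrier → Carrier
  ℘ z = z * z + z

  ℘-cong : ℘ Preserves _≈_ ⟶ _≈_
  ℘-cong x≈y = +-cong (*-cong x≈y x≈y) x≈y

  ℘-+ : ∀ x y → ℘ (x + y) ≈ ℘ x + ℘ y
  ℘-+ = solve 2 (λ x y → (x :+ y) :* (x :+ y) :+ (x :+ y) := (x :* x :+ x) :+ (y :* y :+ y)) refl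

  ℘-+1 : ∀ x → ℘ (x + 1#) ≈ ℘ x
  ℘-+1 = solve 1 (λ x → (x :+ con true) :* (x :+ con true) :+ (x :+ con true) := x :* x :+ x) refl

  ℘-fibre : ∀ {x y} → ℘ x ≈ ℘ y → x ≈ y ⊎ x ≈ y + 1#
  ℘-fibre {x} {y} eq with xy≈0⇒x≈0∨y≈0 (trans
    (solve 2 (λ x y → (x :+ y) :* (x :+ (y :+ con true)) := (x :* x :+ x) :+ (y :* y :+ y)) refl x y) (x≈y⇒x+y≈0 eq))
  ... | inj₁ x+y≈0   = inj₁ (x+y≈0⇒x≈y x+y≈0)
  ... | inj₂ x+y+1≈0 = inj₂ (x+y≈0⇒x≈y x+y+1≈0)

  x+1+1≈x : ∀ x → x + 1# + 1# ≈ x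
  x+1+1≈x = solve 1 (λ x → x :+ con true :+ con true := x) refl

  x+1≉x : ∀ x → ¬ x + 1# ≈ x
  x+1≉x x eq = #⇒≉ 1#0 (trans (solve 1 (λ x → con true := x :+ con true :+ x) refl x) (x≈y⇒x+y≈0 eq))

  Im℘ : Carrier → Set (c ⊔ ℓ₁)
  Im℘ t = ∃ λ z → ℘ z ≈ t

  Im℘? : ∀ t → Dec (Im℘ t)
  Im℘? t = card-any? #K (λ x≈y ℘x≈t → trans (℘-cong (sym x≈y)) ℘x≈t) (λ z → ℘ z ≟ t)

  Im℘-resp : ∀ {s t} → s ≈ t → Im℘ s → Im℘ t
  Im℘-resp s≈t (z , ℘z≈s) = z , trans ℘z≈s s≈t

  Image Coimage : Setoid (c ⊔ ℓ₁) ℓ₁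
  Image   = Subsetoid setoid Im℘
  Coimage = Subsetoid setoid (λ t → ¬ Im℘ t)

  private
    -- Chooses one of z and z + 1, using the enumeration of the field.
    Chosen : Carrier → Set
    Chosen z = toℕ (to z) ℕ.< toℕ (to (z + 1#))

    toℕ-cong : ∀ {x y} → x ≈ y → toℕ (to x) ≡ toℕ (to y)
    toℕ-cong = ≡.cong toℕ ∘ to-cong

    flipped : ∀ {z} → toℕ (to (z + 1#)) ℕ.< toℕ (to z) → Chosen (z + 1#)
    flipped {z} = ≡.subst (toℕ (to (z + 1#)) ℕ.<_) (≡.sym (toℕ-cong (x+1+1≈x z)))

    unflipped : ∀ {z} → Chosen (z + 1#) → ¬ Chosen z
    unflipped {z} chosen+1 = ℕ.<-asym (≡.subst (toℕ (to (z + 1#)) ℕ.<_) (toℕ-cong (x+1+1≈x z)) chosen+1)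

    ¬chosen⇒flipped : ∀ {z} → ¬ Chosen z → Chosen (z + 1#)
    ¬chosen⇒flipped {z} ¬chosen = flipped (ℕ.≤∧≢⇒< (ℕ.≮⇒≥ ¬chosen) λ eq →
      x+1≉x z (trans (sym (inverseʳ (≡.sym (Fin.toℕ-injective eq)))) (inverseʳ ≡.refl)))

    chosen? : ∀ z → Dec (Chosen z)
    chosen? z = toℕ (to z) ℕ.<? toℕ (to (z + 1#))

    Chosen-resp : ∀ {x y} → x ≈ y → Chosen x → Chosen y
    Chosen-resp x≈y = ≡.subst₂ ℕ._<_ (toℕ-cong x≈y) (toℕ-cong (+-congʳ x≈y))

  private
    -- The shift z ↦ z + 1 exchanges the chosen elements with the others, so they are half of the
    -- field. Each fibre of ℘ over its image contains exactly one chosen element, so ℘ maps them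
    -- bijectively onto the image.
    card-Chosen : ∀ {k k′} → k ℕ.+ k′ ≡ n → HasCardinality (Subsetoid setoid Chosen) k →
      HasCardinality (Subsetoid setoid (λ z → ¬ Chosen z)) k′ → k ℕ.+ k ≡ n × HasCardinality Image k
    card-Chosen {k} {k′} k+k′≡n #C #¬C = ≡.trans (≡.cong (k ℕ.+_) k≡k′) k+k′≡n ,
      card-bijection {T = Image} #C (λ (z , _) → ℘ z , z , refl) ℘-cong
        (λ {(x , cx)} {(y , cy)} eq → [ id , (λ x≈y+1 → contradiction cy (unflipped (Chosen-resp x≈y+1 cx))) ]′ (℘-fibre eq))
        surj
      where
      k≡k′ : k ≡ k′
      k≡k′ = card-unique {S = Subsetoid setoid (λ z → ¬ Chosen z)} (card-bijection {T = Subsetoid setoid (λ z → ¬ Chosen z)} #C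
        (λ (z , chosen) → z + 1# , λ chosen+1 → unflipped chosen+1 chosen) +-congʳ
        (λ {(x , _)} {(y , _)} eq → trans (sym (x+1+1≈x x)) (trans (+-congʳ eq) (x+1+1≈x y)))
        (λ (z , ¬chosen) → (z + 1# , ¬chosen⇒flipped ¬chosen) , x+1+1≈x z)) #¬C
      surj : ((t , _) : ∃ Im℘) → ∃ λ ((z , _) : ∃ Chosen) → ℘ z ≈ t
      surj (t , z , ℘z≈t) with chosen? z
      ... | yes chosen = (z , chosen) , ℘z≈t
      ... | no ¬chosen = (z + 1# , ¬chosen⇒flipped ¬chosen) , trans (℘-+1 z) ℘z≈t

    card-Coimage : ∀ {k m m′} → k ℕ.+ k ≡ n → HasCardinality Image k →
      m ℕ.+ m′ ≡ n → HasCardinality Image m → HasCardinality Coimage m′ → HasCardinality Coimage k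
    card-Coimage {k} {m} {m′} k+k≡n #I m+m′≡n #I′ #N = ≡.subst (HasCardinality Coimage) m′≡k #N
      where
      m′≡k : m′ ≡ k
      m′≡k = ℕ.+-cancelˡ-≡ k m′ k (≡.trans (≡.trans (≡.cong (ℕ._+ m′) (card-unique {S = Image} #I #I′)) m+m′≡n) (≡.sym k+k≡n))

  card-℘ : ∃ λ k → k ℕ.+ k ≡ n × HasCardinality Image k × HasCardinality Coimage k
  card-℘ =
    let k , k′ , k+k′≡n , #C , #¬C = card-split #K Chosen Chosen-resp chosen?
        m , m′ , m+m′≡n , #I′ , #N = card-split #K Im℘ Im℘-resp Im℘?
        k+k≡n , #I                 = card-Chosen k+k′≡n #C #¬C
    in  k , k+k≡n , #I , card-Coimage k+k≡n #I m+m′≡n #I′ #N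

  -- Im℘ and its complement are equinumerous, so translation by t maps Im℘ onto the complement.
  ∉Im℘-+ : ∀ {s t} → ¬ Im℘ s → ¬ Im℘ t → Im℘ (s + t)
  ∉Im℘-+ {s} {t} s∉ t∉ =
    let k , _ , #I , #N       = card-℘
        (u , u∈) , u+t≈s      = card-injective⇒surjective {S = Image} {T = Coimage} #I #N
          (λ (u , u∈) → u + t , ∉-translate u∈) +-congʳ (λ {x} {y} → +t-injective) (s , s∉)
    in  Im℘-resp (trans (sym (cancel u t)) (+-congʳ u+t≈s)) u∈
    where
    cancel : ∀ u t → u + t + t ≈ u
    cancel = solve 2 (λ u t → u :+ t :+ t := u) refl
    +t-injective : ∀ {x y} → x + t ≈ y + t → x ≈ y
    +t-injective {x} {y} eq = trans (sym (cancel x t)) (trans (+-congʳ eq) (cancel y t))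
    ∉-translate : ∀ {u} → Im℘ u → ¬ Im℘ (u + t)
    ∉-translate {u} (z , ℘z≈u) (w , ℘w≈u+t) = t∉ (z + w , trans (℘-+ z w)
      (trans (+-cong ℘z≈u ℘w≈u+t) (solve 2 (λ u t → u :+ (u :+ t) := t) refl u t)))

-- Conjugation of 𝔽_q² over 𝔽_q and roots of ℘ z = t.

module QuadraticExtension {c ℓ₁ ℓ₂ c′ ℓ₁′ ℓ₂′} (q h : ℕ) (q≡2^1+h : q ≡ 2 ℕ.^ suc h)
  (F : HeytingField c ℓ₁ ℓ₂) (#F : HasCardinality (setoidOf F) q)
  (E : HeytingField c′ ℓ₁′ ℓ₂′) (#E : HasCardinality (setoidOf E) (q ℕ.^ 2))
  (ι : HeytingField.Carrier F → HeytingField.Carrier E) (ι-embedding : IsEmbedding F E ι) where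

  private
    module F = CommutativeRing (ring F)

  1+1≈0ᶠ : CharacteristicTwo (ring F)
  1+1≈0ᶠ = characteristicTwo F (suc h) (≡.subst (HasCardinality (setoidOf F)) q≡2^1+h #F)

  open CommutativeRing (ring E) hiding (zero; ring)
  open IsRingMonomorphism ι-embedding public using ()
    renaming (+-homo to ι-+; *-homo to ι-*; 0#-homo to ι-0; 1#-homo to ι-1; ⟦⟧-cong to ι-cong; injective to ι-injective)

  1+1≈0ᴱ : CharacteristicTwo (ring E)
  1+1≈0ᴱ = trans (+-cong (sym ι-1) (sym ι-1)) (trans (sym (ι-+ F.1# F.1#)) (trans (ι-cong 1+1≈0ᶠ) ι-0))

  open HeytingField E using (_#_)
  open Exp semiring using (_^_; ^-congˡ; ^-congʳ; ^-assocʳ)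
  open CommutativeExp commutativeSemiring using (^-distrib-*)
  open CharTwo (ring E) 1+1≈0ᴱ
  open FiniteField E #E
  private
    module EF = EvenField F #F 1+1≈0ᶠ
    module EE = EvenField E #E 1+1≈0ᴱ

  conj : Carrier → Carrier
  conj x = x ^ q

  conj-cong : ∀ {x y} → x ≈ y → conj x ≈ conj y
  conj-cong = ^-congˡ q

  conj-+ : ∀ x y → conj (x + y) ≈ conj x + conj y
  conj-+ x y = ≡.subst (λ k → (x + y) ^ k ≈ x ^ k + y ^ k) (≡.sym q≡2^1+h) (frobenius (suc h) x y)

  conj-* : ∀ x y → conj (x * y) ≈ conj x * conj y
  conj-* x y = ^-distrib-* x y q

  conj-ι : ∀ x → conj (ι x) ≈ ι x
  conj-ι x = trans (sym (ι-^ q)) (ι-cong (FiniteField.fermat F #F x))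
    where
    ι-^ : ∀ n → ι (Exp._^_ F.semiring x n) ≈ ι x ^ n
    ι-^ zero    = ι-1
    ι-^ (suc n) = trans (ι-* x _) (*-congˡ (ι-^ n))

  conj-0 : conj 0# ≈ 0#
  conj-0 = trans (conj-cong (sym ι-0)) (trans (conj-ι F.0#) ι-0)

  conj-1 : conj 1# ≈ 1#
  conj-1 = trans (conj-cong (sym ι-1)) (trans (conj-ι F.1#) ι-1)

  conj-involutive : ∀ x → conj (conj x) ≈ x
  conj-involutive x = trans (^-assocʳ x q q) (trans (^-congʳ x (≡.cong (q ℕ.*_) (≡.sym (ℕ.*-identityʳ q)))) (fermat x))

  private
    2≤q : 2 ℕ.≤ q
    2≤q = ≡.subst (2 ℕ.≤_) (≡.sym q≡2^1+h) (ℕ.m≤m*n 2 (2 ℕ.^ h) ⦃ ℕ.m^n≢0 2 h ⦄)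

    base? : ∀ x → Dec (∃ λ a → ι a ≈ x)
    base? x = card-any? #F (λ a≈b ιa≈x → trans (ι-cong (F.sym a≈b)) ιa≈x) (λ a → ι a ≟ x)

  -- A fixed element outside the image of `ι`, listed together with the q elements of that image,
  -- would give q + 1 roots of X^q + X.
  fixed⇒base : ∀ {x} → conj x ≈ x → ∃ λ a → ι a ≈ x
  fixed⇒base {x} fixed with base? x
  ... | yes base = base
  ... | no ¬base = contradiction (EE.fixed≤exponent q 2≤q r r-inj r-fixed) ℕ.1+n≰n
    where
    open Inverse #F
    r : Fin (suc q) → Carrier
    r zero    = x
    r (suc i) = ι (from i)
    r-inj : ∀ {i j} → r i ≈ r j → i ≡ j
    r-inj {zero}  {zero}  eq = ≡.refl
    r-inj {zero}  {suc j} eq = contradiction (from j , sym eq) ¬base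
    r-inj {suc i} {zero}  eq = contradiction (from i , eq) ¬base
    r-inj {suc i} {suc j} eq =
      ≡.cong suc (≡.trans (≡.sym (inverseˡ F.refl)) (inverseˡ (ι-injective eq)))
    r-fixed : ∀ i → conj (r i) ≈ r i
    r-fixed zero    = fixed
    r-fixed (suc i) = conj-ι (from i)

  -- If `ι` were onto, choosing preimages would inject a set of q² elements into one of q < q²
  -- elements.
  nonbase : ∃ λ x → ¬ ∃ λ a → ι a ≈ x
  nonbase with card-any? #E {P = λ x → ¬ ∃ λ a → ι a ≈ x} (λ x≈y ¬base (a , ιa≈y) → ¬base (a , trans ιa≈y (sym x≈y))) (¬? ∘ base?)
  ... | yes found = found
  ... | no none   = contradiction (Fin.injective⇒≤ {f = f} f-inj) (ℕ.<⇒≱ q<q^2)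
    where
    pre : ∀ x → ∃ λ a → ι a ≈ x
    pre x with base? x
    ... | yes base = base
    ... | no ¬base = contradiction (x , ¬base) none
    f : Fin (q ℕ.^ 2) → Fin q
    f i = Inverse.to #F (proj₁ (pre (Inverse.from #E i)))
    f-inj : ∀ {i j} → f i ≡ f j → i ≡ j
    f-inj {i} {j} eq = ≡.trans (≡.sym (Inverse.inverseˡ #E refl)) (Inverse.inverseˡ #E
      (trans (sym (proj₂ (pre _))) (trans (ι-cong to-injective) (proj₂ (pre _)))))
      where
      to-injective : proj₁ (pre (Inverse.from #E i)) F.≈ proj₁ (pre (Inverse.from #E j))
      to-injective = F.trans (F.sym (Inverse.inverseʳ #F (≡.sym eq))) (Inverse.inverseʳ #F ≡.refl)
    q<q^2 : q ℕ.< q ℕ.^ 2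
    q<q^2 = ≡.subst₂ ℕ._<_ (ℕ.*-identityʳ q) (≡.cong (q ℕ.*_) (≡.sym (ℕ.*-identityʳ q)))
      (ℕ.*-monoʳ-< q ⦃ ℕ.>-nonZero (ℕ.<⇒≤ 2≤q) ⦄ 2≤q)

  private
    trace : Carrier → Carrier
    trace x = x + conj x

    trace≉0 : ∀ {x} → ¬ (∃ λ a → ι a ≈ x) → trace x # 0#
    trace≉0 ¬base = ≉⇒# λ s≈0 → ¬base (fixed⇒base (sym (x+y≈0⇒x≈y s≈0)))

    conj-trace : ∀ x → conj (trace x) ≈ trace x
    conj-trace x = trans (conj-+ x (conj x)) (trans (+-congˡ (conj-involutive x)) (+-comm (conj x) x))

    conj-inverse : ∀ {x y} → conj x ≈ x → x * y ≈ 1# → conj y ≈ y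
    conj-inverse {x} {y} fixed xy≈1 = *-cancelˡ (inverse⇒# xy≈1) (begin
      x * conj y       ≈⟨ *-congʳ fixed ⟨
      conj x * conj y  ≈⟨ conj-* x y ⟨
      conj (x * y)     ≈⟨ conj-cong xy≈1 ⟩
      conj 1#          ≈⟨ conj-1 ⟩
      1#               ≈⟨ xy≈1 ⟨
      x * y            ∎)
      where open ≈-Reasoning setoid

    -- In characteristic 2 the conjugate of x is x plus its trace; the trace is fixed by
    -- conjugation, so dividing by it turns the difference into 1.
    conj-x/trace : ∀ x {u} → trace x * u ≈ 1# → conj (x * u) ≈ x * u + 1#
    conj-x/trace x {u} su≈1 = begin
      conj (x * u)                  ≈⟨ conj-* x u ⟩
      conj x * conj u               ≈⟨ *-congˡ (conj-inverse (conj-trace x) su≈1) ⟩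
      conj x * u                    ≈⟨ solve 3 (λ x x′ u → x′ :* u := x :* u :+ (x :+ x′) :* u) refl x (conj x) u ⟩
      x * u + trace x * u           ≈⟨ +-congˡ su≈1 ⟩
      x * u + 1#                    ∎
      where open ≈-Reasoning setoid

    -- Conjugation moves `w` only within its fibre under ℘, so ℘ w is fixed.
    ℘-base : ∀ {w} → conj w ≈ w + 1# → ∃ λ n → ι n ≈ EE.℘ w
    ℘-base {w} conj-w = fixed⇒base (begin
      conj (w * w + w)             ≈⟨ conj-+ (w * w) w ⟩
      conj (w * w) + conj w        ≈⟨ +-congʳ (conj-* w w) ⟩
      EE.℘ (conj w)                ≈⟨ EE.℘-cong conj-w ⟩
      EE.℘ (w + 1#)                ≈⟨ EE.℘-+1 w ⟩
      EE.℘ w                       ∎)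
      where open ≈-Reasoning setoid

    ℘-generator : ∃₂ λ w n → ι n ≈ EE.℘ w × conj w ≈ w + 1#
    ℘-generator = at-nonbase nonbase
      where
      at-inverse : ∀ θ → (∃ λ u → trace θ * u ≈ 1#) → ∃₂ λ w n → ι n ≈ EE.℘ w × conj w ≈ w + 1#
      at-inverse θ (u , su≈1) =
        θ * u , proj₁ (℘-base (conj-x/trace θ su≈1)) , proj₂ (℘-base (conj-x/trace θ su≈1)) , conj-x/trace θ su≈1
      at-nonbase : (∃ λ x → ¬ ∃ λ a → ι a ≈ x) → ∃₂ λ w n → ι n ≈ EE.℘ w × conj w ≈ w + 1#
      at-nonbase (θ , ¬base) = at-inverse θ (inverse (trace≉0 ¬base))

    ι-℘ : ∀ x → ι (EF.℘ x) ≈ EE.℘ (ι x)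
    ι-℘ x = trans (ι-+ _ x) (+-congʳ (ι-* x x))

  -- Both n = ℘ w and t lie outside the image of ℘ on 𝔽_q, so n + t = ℘ x for a rational x. Then ℘
  -- (w + x) = n + (n + t) = t, and adding the fixed element x keeps conjugation equal to the shift
  -- by 1.
  ℘-root : ∀ t → ¬ EF.Im℘ t → ∃ λ z → EE.℘ z ≈ ι t × conj z ≈ z + 1#
  ℘-root t t∉ = at-generator ℘-generator
    where
    open ≈-Reasoning setoid
    at-generator : (∃₂ λ w n → ι n ≈ EE.℘ w × conj w ≈ w + 1#) → ∃ λ z → EE.℘ z ≈ ι t × conj z ≈ z + 1#
    at-generator (w , n , ιn≈℘w , conj-w) = translate (EF.∉Im℘-+ n∉ t∉)
      where
      moved : ∀ {w′} → conj w′ ≈ w′ → ¬ w ≈ w′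
      moved fixed w≈w′ = EE.x+1≉x w (trans (sym conj-w) (trans (conj-cong w≈w′) (trans fixed (sym w≈w′))))
      -- A rational x with ℘ x = n would force w to be x or x + 1, both fixed by conjugation, while
      -- w is not.
      n∉ : ¬ EF.Im℘ n
      n∉ (x , ℘x≈n) = [ moved (conj-ι x) , moved (trans (conj-+ (ι x) 1#) (+-cong (conj-ι x) conj-1)) ]′
        (EE.℘-fibre (trans (sym ιn≈℘w) (trans (ι-cong (F.sym ℘x≈n)) (ι-℘ x))))
      translate : EF.Im℘ (n F.+ t) → ∃ λ z → EE.℘ z ≈ ι t × conj z ≈ z + 1#
      translate (x , ℘x≈n+t) = w + ι x ,
        (begin
          EE.℘ (w + ι x)            ≈⟨ EE.℘-+ w (ι x) ⟩
          EE.℘ w + EE.℘ (ι x)       ≈⟨ +-cong ιn≈℘w (trans (ι-cong (F.sym ℘x≈n+t)) (ι-℘ x)) ⟨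
          ι n + ι (n F.+ t)         ≈⟨ +-congˡ (ι-+ n t) ⟩
          ι n + (ι n + ι t)         ≈⟨ solve 2 (λ n t → n :+ (n :+ t) := t) refl (ι n) (ι t) ⟩
          ι t                       ∎) ,
        (begin
          conj (w + ι x)            ≈⟨ conj-+ w (ι x) ⟩
          conj w + conj (ι x)       ≈⟨ +-cong conj-w (conj-ι x) ⟩
          w + 1# + ι x              ≈⟨ solve 2 (λ w x → w :+ con true :+ x := w :+ x :+ con true) refl w (ι x) ⟩
          w + ι x + 1#              ∎)

-- Ternary quadratic forms in characteristic two under linear substitution.

module Conic {c ℓ₁ ℓ₂} (K : HeytingField c ℓ₁ ℓ₂) {n : ℕ} (#K : HasCardinality (setoidOf K) n)
  (1+1≈0 : CharacteristicTwo (ring K)) where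

  open import Data.Vec.Functional using (Vector; []; _∷_)
  open CommutativeRing (ring K) hiding (zero; ring)
  open HeytingField K using (_#_)
  open CharTwo (ring K) 1+1≈0
  open FiniteField K #K
  open PG5 K
  open Sum semiring using (sum; sum-cong-≋; ∑-distrib-+; *-distribˡ-sum)
  open Mult semiring using () renaming (_×_ to _·_)
  open VecEquality setoid using (_≋_)

  dot : Vector Carrier 3 → Vector Carrier 3 → Carrier
  dot l v = sum λ k → l k * v k

  -- The usual cross product, whose signs disappear in characteristic 2. For two linear forms it is
  -- the common point of their lines, and it vanishes exactly when they are proportional.
  cross : Vector Carrier 3 → Vector Carrier 3 → Vector Carrier 3
  cross l m = l 1F * m 2F + l 2F * m 1F
            ∷ l 0F * m 2F + l 2F * m 0F
            ∷ l 0F * m 1F + l 1F * m 0F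
            ∷ []

  infixl 7 _◁_

  -- The linear form l ∘ A.
  _◁_ : Vector Carrier 3 → Matrix → Vector Carrier 3
  (l ◁ A) j = dot l λ k → A k j

  eval : Vector Carrier 6 → Vector Carrier 3 → Carrier
  eval f v = f 0F * (v 0F * v 0F) + f 1F * (v 0F * v 1F) + f 2F * (v 0F * v 2F)
           + f 3F * (v 1F * v 1F) + f 4F * (v 1F * v 2F) + f 5F * (v 2F * v 2F)

  -- The diagonal terms are zero in characteristic 2, but keeping them makes each mixed coefficient
  -- of `substitute A f` the value of `polar f` at two columns of A by definition.
  polar : Vector Carrier 6 → Vector Carrier 3 → Vector Carrier 3 → Carrier
  polar f v w = f 0F * (v 0F * w 0F + w 0F * v 0F) + f 1F * (v 0F * w 1F + w 0F * v 1F)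
              + f 2F * (v 0F * w 2F + w 0F * v 2F) + f 3F * (v 1F * w 1F + w 1F * v 1F)
              + f 4F * (v 1F * w 2F + w 1F * v 2F) + f 5F * (v 2F * w 2F + w 2F * v 2F)

  -- The quadratic form f ∘ A.
  substitute : Matrix → Vector Carrier 6 → Vector Carrier 6
  substitute A f = f 0F ∙ product (A 0F) (A 0F) ⊕ f 1F ∙ product (A 0F) (A 1F) ⊕ f 2F ∙ product (A 0F) (A 2F)
                 ⊕ f 3F ∙ product (A 1F) (A 1F) ⊕ f 4F ∙ product (A 1F) (A 2F) ⊕ f 5F ∙ product (A 2F) (A 2F)

  pairing : Vector Carrier 6 → Vector Carrier 6 → Carrier
  pairing f y = sum λ k → f k * y k

  -- Spans the radical of the polar form of f, unless zero.
  nucleus : Vector Carrier 6 → Vector Carrier 3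
  nucleus f = f 4F ∷ f 2F ∷ f 1F ∷ []

  discriminant : Vector Carrier 6 → Carrier
  discriminant f = 4 · (f 0F * f 3F * f 5F) + f 1F * f 2F * f 4F
    - f 0F * (f 4F * f 4F) - f 3F * (f 2F * f 2F) - f 5F * (f 1F * f 1F)

  private
    :dot : ∀ {k} → Vector (Polynomial k) 3 → Vector (Polynomial k) 3 → Polynomial k
    :dot l v = l 0F :* v 0F :+ (l 1F :* v 1F :+ (l 2F :* v 2F :+ con false))

    :cross : ∀ {k} → Vector (Polynomial k) 3 → Vector (Polynomial k) 3 → Vector (Polynomial k) 3
    :cross l m = l 1F :* m 2F :+ l 2F :* m 1F
              ∷ l 0F :* m 2F :+ l 2F :* m 0F
              ∷ l 0F :* m 1F :+ l 1F :* m 0F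
              ∷ []

    :product : ∀ {k} → Vector (Polynomial k) 3 → Vector (Polynomial k) 3 → Vector (Polynomial k) 6
    :product l m = l 0F :* m 0F ∷ l 0F :* m 1F :+ l 1F :* m 0F ∷ l 0F :* m 2F :+ l 2F :* m 0F
                ∷ l 1F :* m 1F ∷ l 1F :* m 2F :+ l 2F :* m 1F ∷ l 2F :* m 2F ∷ []

    :eval : ∀ {k} → Vector (Polynomial k) 6 → Vector (Polynomial k) 3 → Polynomial k
    :eval f v = f 0F :* (v 0F :* v 0F) :+ f 1F :* (v 0F :* v 1F) :+ f 2F :* (v 0F :* v 2F)
             :+ f 3F :* (v 1F :* v 1F) :+ f 4F :* (v 1F :* v 2F) :+ f 5F :* (v 2F :* v 2F)

    :polar : ∀ {k} → Vector (Polynomial k) 6 → Vector (Polynomial k) 3 → Vector (Polynomial k) 3 → Polynomial k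
    :polar f v w = f 0F :* (v 0F :* w 0F :+ w 0F :* v 0F) :+ f 1F :* (v 0F :* w 1F :+ w 0F :* v 1F)
                :+ f 2F :* (v 0F :* w 2F :+ w 0F :* v 2F) :+ f 3F :* (v 1F :* w 1F :+ w 1F :* v 1F)
                :+ f 4F :* (v 1F :* w 2F :+ w 1F :* v 2F) :+ f 5F :* (v 2F :* w 2F :+ w 2F :* v 2F)

  dot-cong : ∀ {l m v w} → l ≋ m → v ≋ w → dot l v ≈ dot m w
  dot-cong l≋m v≋w = sum-cong-≋ λ k → *-cong (l≋m k) (v≋w k)

  eval-product : ∀ l m v → eval (product l m) v ≈ dot l v * dot m v
  eval-product l m v = solve 9 (λ l₀ l₁ l₂ m₀ m₁ m₂ v₀ v₁ v₂ →
    let l = l₀ ∷ l₁ ∷ l₂ ∷ [] ; m = m₀ ∷ m₁ ∷ m₂ ∷ [] ; v = v₀ ∷ v₁ ∷ v₂ ∷ [] in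
    :eval (:product l m) v := :dot l v :* :dot m v) refl
    (l 0F) (l 1F) (l 2F) (m 0F) (m 1F) (m 2F) (v 0F) (v 1F) (v 2F)

  polar-product : ∀ l m v w → polar (product l m) v w ≈ dot l v * dot m w + dot l w * dot m v
  polar-product l m v w = solve 12 (λ l₀ l₁ l₂ m₀ m₁ m₂ v₀ v₁ v₂ w₀ w₁ w₂ →
    let l = l₀ ∷ l₁ ∷ l₂ ∷ [] ; m = m₀ ∷ m₁ ∷ m₂ ∷ [] ; v = v₀ ∷ v₁ ∷ v₂ ∷ [] ; w = w₀ ∷ w₁ ∷ w₂ ∷ [] in
    :polar (:product l m) v w := :dot l v :* :dot m w :+ :dot l w :* :dot m v) refl
    (l 0F) (l 1F) (l 2F) (m 0F) (m 1F) (m 2F) (v 0F) (v 1F) (v 2F) (w 0F) (w 1F) (w 2F)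

  product-cong : ∀ {l l′ m m′} → l ≋ l′ → m ≋ m′ → product l m ≋ product l′ m′
  product-cong l≋ m≋ = λ
    { 0F → *-cong (l≋ 0F) (m≋ 0F)
    ; 1F → +-cong (*-cong (l≋ 0F) (m≋ 1F)) (*-cong (l≋ 1F) (m≋ 0F))
    ; 2F → +-cong (*-cong (l≋ 0F) (m≋ 2F)) (*-cong (l≋ 2F) (m≋ 0F))
    ; 3F → *-cong (l≋ 1F) (m≋ 1F)
    ; 4F → +-cong (*-cong (l≋ 1F) (m≋ 2F)) (*-cong (l≋ 2F) (m≋ 1F))
    ; 5F → *-cong (l≋ 2F) (m≋ 2F)
    }

  substitute-product : ∀ A l m → substitute A (product l m) ≋ product (l ◁ A) (m ◁ A)
  substitute-product A l m = λ
    { 0F → eval-product l m (λ k → A k 0F)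
    ; 1F → polar-product l m (λ k → A k 0F) (λ k → A k 1F)
    ; 2F → polar-product l m (λ k → A k 0F) (λ k → A k 2F)
    ; 3F → eval-product l m (λ k → A k 1F)
    ; 4F → polar-product l m (λ k → A k 1F) (λ k → A k 2F)
    ; 5F → eval-product l m (λ k → A k 2F)
    }

  -- By `φ-substitute`, a linear functional at `substitute A f` is determined by its values on the
  -- products of two rows of A. Identities for substitution thus reduce to products of linear forms,
  -- where they are polynomial identities of low degree.
  record IsLinear (φ : Vector Carrier 6 → Carrier) : Set (c ⊔ ℓ₁) where
    field
      φ-cong : ∀ {f g} → f ≋ g → φ f ≈ φ g
      φ-⊕    : ∀ f g → φ (f ⊕ g) ≈ φ f + φ g
      φ-∙    : ∀ a f → φ (a ∙ f) ≈ a * φ f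

    φ-substitute : ∀ A f → φ (substitute A f) ≈
      f 0F * φ (product (A 0F) (A 0F)) + f 1F * φ (product (A 0F) (A 1F)) + f 2F * φ (product (A 0F) (A 2F))
      + f 3F * φ (product (A 1F) (A 1F)) + f 4F * φ (product (A 1F) (A 2F)) + f 5F * φ (product (A 2F) (A 2F))
    φ-substitute A f = split (split (split (split (split (φ-∙ _ _) _ _) _ _) _ _) _ _) _ _
      where
      split : ∀ {g x} → φ g ≈ x → ∀ a h → φ (g ⊕ a ∙ h) ≈ x + a * φ h
      split {g} φg≈x a h = trans (φ-⊕ g (a ∙ h)) (+-cong φg≈x (φ-∙ a h))

  pairing-linear : ∀ y → IsLinear (λ f → pairing f y)
  pairing-linear y = record
    { φ-cong = λ {f} {g} f≋g → sum-cong-≋ {x = λ k → f k * y k} {λ k → g k * y k} λ k → *-congʳ (f≋g k)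
    ; φ-⊕    = λ f g → trans (sum-cong-≋ λ k → distribʳ (y k) (f k) (g k)) (∑-distrib-+ (λ k → f k * y k) (λ k → g k * y k))
    ; φ-∙    = λ a f → trans (sum-cong-≋ λ k → *-assoc a (f k) (y k)) (sym (*-distribˡ-sum a (λ k → f k * y k)))
    }

  nucleus-cong : ∀ {f g} → f ≋ g → nucleus f ≋ nucleus g
  nucleus-cong f≋g = λ { 0F → f≋g 4F ; 1F → f≋g 2F ; 2F → f≋g 1F }

  dot-nucleus-linear : ∀ l → IsLinear (λ f → dot l (nucleus f))
  dot-nucleus-linear l = record
    { φ-cong = λ {f} {g} f≋g → dot-cong {l} {l} {nucleus f} {nucleus g} (λ _ → refl) (nucleus-cong f≋g)
    ; φ-⊕    = λ f g → solve 9 (λ l₀ l₁ l₂ a b c a′ b′ c′ → let l = l₀ ∷ l₁ ∷ l₂ ∷ [] in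
        :dot l (a :+ a′ ∷ b :+ b′ ∷ c :+ c′ ∷ []) := :dot l (a ∷ b ∷ c ∷ []) :+ :dot l (a′ ∷ b′ ∷ c′ ∷ [])) refl
        (l 0F) (l 1F) (l 2F) (f 4F) (f 2F) (f 1F) (g 4F) (g 2F) (g 1F)
    ; φ-∙    = λ x f → solve 7 (λ l₀ l₁ l₂ a b c x → let l = l₀ ∷ l₁ ∷ l₂ ∷ [] in
        :dot l (x :* a ∷ x :* b ∷ x :* c ∷ []) := x :* :dot l (a ∷ b ∷ c ∷ [])) refl
        (l 0F) (l 1F) (l 2F) (f 4F) (f 2F) (f 1F) x
    }

  eval-linear : ∀ v → IsLinear (λ f → eval f v)
  eval-linear v = record
    { φ-cong = λ f≋g → +-cong (+-cong (+-cong (+-cong (+-cong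
        (*-congʳ (f≋g 0F)) (*-congʳ (f≋g 1F))) (*-congʳ (f≋g 2F))) (*-congʳ (f≋g 3F))) (*-congʳ (f≋g 4F))) (*-congʳ (f≋g 5F))
    ; φ-⊕    = λ f g → solve 15 (λ v₀ v₁ v₂ f₀ f₁ f₂ f₃ f₄ f₅ g₀ g₁ g₂ g₃ g₄ g₅ → let v = v₀ ∷ v₁ ∷ v₂ ∷ [] in
        :eval (f₀ :+ g₀ ∷ f₁ :+ g₁ ∷ f₂ :+ g₂ ∷ f₃ :+ g₃ ∷ f₄ :+ g₄ ∷ f₅ :+ g₅ ∷ []) v
          := :eval (f₀ ∷ f₁ ∷ f₂ ∷ f₃ ∷ f₄ ∷ f₅ ∷ []) v :+ :eval (g₀ ∷ g₁ ∷ g₂ ∷ g₃ ∷ g₄ ∷ g₅ ∷ []) v) refl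
        (v 0F) (v 1F) (v 2F) (f 0F) (f 1F) (f 2F) (f 3F) (f 4F) (f 5F) (g 0F) (g 1F) (g 2F) (g 3F) (g 4F) (g 5F)
    ; φ-∙    = λ x f → solve 10 (λ v₀ v₁ v₂ f₀ f₁ f₂ f₃ f₄ f₅ x → let v = v₀ ∷ v₁ ∷ v₂ ∷ [] in
        :eval (x :* f₀ ∷ x :* f₁ ∷ x :* f₂ ∷ x :* f₃ ∷ x :* f₄ ∷ x :* f₅ ∷ []) v
          := x :* :eval (f₀ ∷ f₁ ∷ f₂ ∷ f₃ ∷ f₄ ∷ f₅ ∷ []) v) refl
        (v 0F) (v 1F) (v 2F) (f 0F) (f 1F) (f 2F) (f 3F) (f 4F) (f 5F) x
    }

  private
    +-cong₆ : ∀ {a₀ a₁ a₂ a₃ a₄ a₅ b₀ b₁ b₂ b₃ b₄ b₅} →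
      a₀ ≈ b₀ → a₁ ≈ b₁ → a₂ ≈ b₂ → a₃ ≈ b₃ → a₄ ≈ b₄ → a₅ ≈ b₅ →
      a₀ + a₁ + a₂ + a₃ + a₄ + a₅ ≈ b₀ + b₁ + b₂ + b₃ + b₄ + b₅
    +-cong₆ e₀ e₁ e₂ e₃ e₄ e₅ = +-cong (+-cong (+-cong (+-cong (+-cong e₀ e₁) e₂) e₃) e₄) e₅

  substitute-cong : ∀ A {f g} → f ≋ g → substitute A f ≋ substitute A g
  substitute-cong A f≋g i = +-cong₆ (*-congʳ (f≋g 0F)) (*-congʳ (f≋g 1F)) (*-congʳ (f≋g 2F))
    (*-congʳ (f≋g 3F)) (*-congʳ (f≋g 4F)) (*-congʳ (f≋g 5F))

  substitute-∙ : ∀ A a f → substitute A (a ∙ f) ≋ a ∙ substitute A f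
  substitute-∙ A a f i = solve 13 (λ a f₀ f₁ f₂ f₃ f₄ f₅ p₀ p₁ p₂ p₃ p₄ p₅ →
    (a :* f₀) :* p₀ :+ (a :* f₁) :* p₁ :+ (a :* f₂) :* p₂ :+ (a :* f₃) :* p₃ :+ (a :* f₄) :* p₄ :+ (a :* f₅) :* p₅
    := a :* (f₀ :* p₀ :+ f₁ :* p₁ :+ f₂ :* p₂ :+ f₃ :* p₃ :+ f₄ :* p₄ :+ f₅ :* p₅)) refl
    a (f 0F) (f 1F) (f 2F) (f 3F) (f 4F) (f 5F)
    (product (A 0F) (A 0F) i) (product (A 0F) (A 1F) i) (product (A 0F) (A 2F) i)
    (product (A 1F) (A 1F) i) (product (A 1F) (A 2F) i) (product (A 2F) (A 2F) i)

  substitute-linear : ∀ A i → IsLinear (λ f → substitute A f i)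
  substitute-linear A i = record
    { φ-cong = λ f≋g → substitute-cong A f≋g i
    ; φ-⊕    = λ f g → solve 18 (λ f₀ f₁ f₂ f₃ f₄ f₅ g₀ g₁ g₂ g₃ g₄ g₅ p₀ p₁ p₂ p₃ p₄ p₅ →
        (f₀ :+ g₀) :* p₀ :+ (f₁ :+ g₁) :* p₁ :+ (f₂ :+ g₂) :* p₂ :+ (f₃ :+ g₃) :* p₃ :+ (f₄ :+ g₄) :* p₄ :+ (f₅ :+ g₅) :* p₅
        := (f₀ :* p₀ :+ f₁ :* p₁ :+ f₂ :* p₂ :+ f₃ :* p₃ :+ f₄ :* p₄ :+ f₅ :* p₅)
        :+ (g₀ :* p₀ :+ g₁ :* p₁ :+ g₂ :* p₂ :+ g₃ :* p₃ :+ g₄ :* p₄ :+ g₅ :* p₅)) refl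
        (f 0F) (f 1F) (f 2F) (f 3F) (f 4F) (f 5F) (g 0F) (g 1F) (g 2F) (g 3F) (g 4F) (g 5F)
        (product (A 0F) (A 0F) i) (product (A 0F) (A 1F) i) (product (A 0F) (A 2F) i)
        (product (A 1F) (A 1F) i) (product (A 1F) (A 2F) i) (product (A 2F) (A 2F) i)
    ; φ-∙    = λ a f → substitute-∙ A a f i
    }

  substitute-identity : ∀ f → substitute 1ᴹ f ≋ f
  substitute-identity f = λ
    { 0F → solve 6 (:identity 0F) refl (f 0F) (f 1F) (f 2F) (f 3F) (f 4F) (f 5F)
    ; 1F → solve 6 (:identity 1F) refl (f 0F) (f 1F) (f 2F) (f 3F) (f 4F) (f 5F)
    ; 2F → solve 6 (:identity 2F) refl (f 0F) (f 1F) (f 2F) (f 3F) (f 4F) (f 5F)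
    ; 3F → solve 6 (:identity 3F) refl (f 0F) (f 1F) (f 2F) (f 3F) (f 4F) (f 5F)
    ; 4F → solve 6 (:identity 4F) refl (f 0F) (f 1F) (f 2F) (f 3F) (f 4F) (f 5F)
    ; 5F → solve 6 (:identity 5F) refl (f 0F) (f 1F) (f 2F) (f 3F) (f 4F) (f 5F)
    }
    where
    :identity : ∀ {k} → Fin 6 → (f₀ f₁ f₂ f₃ f₄ f₅ : Polynomial k) → Polynomial k × Polynomial k
    :identity i f₀ f₁ f₂ f₃ f₄ f₅ =
      let e₀ = con true  ∷ con false ∷ con false ∷ []
          e₁ = con false ∷ con true  ∷ con false ∷ []
          e₂ = con false ∷ con false ∷ con true  ∷ []
      in f₀ :* :product e₀ e₀ i :+ f₁ :* :product e₀ e₁ i :+ f₂ :* :product e₀ e₂ i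
         :+ f₃ :* :product e₁ e₁ i :+ f₄ :* :product e₁ e₂ i :+ f₅ :* :product e₂ e₂ i
         := (f₀ ∷ f₁ ∷ f₂ ∷ f₃ ∷ f₄ ∷ f₅ ∷ []) i

  -- Substitution is contravariant: the composite is substitution of B ⊗ A, and on products of rows
  -- of B this is immediate from `substitute-product`.
  substitute-inverse : ∀ {A B} → B ⊗ A ≈ᴹ 1ᴹ → ∀ f → substitute A (substitute B f) ≋ f
  substitute-inverse {A} {B} BA≈1 f i = begin
    substitute A (substitute B f) i  ≈⟨ φ-substitute B f ⟩
    _
      ≈⟨ +-cong₆ (term 0F 0F) (term 0F 1F) (term 0F 2F) (term 1F 1F) (term 1F 2F) (term 2F 2F) ⟩
    substitute 1ᴹ f i                ≈⟨ substitute-identity f i ⟩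
    f i                              ∎
    where
    open ≈-Reasoning setoid
    open IsLinear (substitute-linear A i)
    term : ∀ {a} j k → a * substitute A (product (B j) (B k)) i ≈ a * product (1ᴹ j) (1ᴹ k) i
    term j k = *-congˡ (trans (substitute-product A (B j) (B k) i) (product-cong (BA≈1 j) (BA≈1 k) i))

  coordinates : Matrix → Vector Carrier 6
  coordinates M = M 0F 0F ∷ M 0F 1F ∷ M 0F 2F ∷ M 1F 1F ∷ M 1F 2F ∷ M 2F 2F ∷ []

  -- An off-diagonal entry of the symmetric matrix occurs twice in the bilinear value, with
  -- coefficients lᵢmⱼ and lⱼmᵢ, and their sum is the mixed coefficient of the product.
  pairing-product : ∀ l m y → pairing (product l m) y ≈ dot (l ◁ matrix y) m
  pairing-product l m y = solve 12 (λ l₀ l₁ l₂ m₀ m₁ m₂ y₀ y₁ y₂ y₃ y₄ y₅ →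
    let l = l₀ ∷ l₁ ∷ l₂ ∷ [] ; m = m₀ ∷ m₁ ∷ m₂ ∷ [] ; f = :product l m in
    f 0F :* y₀ :+ (f 1F :* y₁ :+ (f 2F :* y₂ :+ (f 3F :* y₃ :+ (f 4F :* y₄ :+ (f 5F :* y₅ :+ con false)))))
    := :dot (:dot l (y₀ ∷ y₁ ∷ y₂ ∷ []) ∷ :dot l (y₁ ∷ y₃ ∷ y₄ ∷ []) ∷ :dot l (y₂ ∷ y₄ ∷ y₅ ∷ []) ∷ []) m) refl
    (l 0F) (l 1F) (l 2F) (m 0F) (m 1F) (m 2F) (y 0F) (y 1F) (y 2F) (y 3F) (y 4F) (y 5F)

  -- Substitution in conics is adjoint to the action M ↦ A M Aᵀ on points: the pairing with a
  -- product of rows i and j of A is the entry (i, j) of A M Aᵀ.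
  pairing-substitute : ∀ A f y → pairing (substitute A f) y ≈ pairing f (coordinates (A ⊗ matrix y ⊗ A ᵀ))
  pairing-substitute A f y = begin
    pairing (substitute A f) y  ≈⟨ φ-substitute A f ⟩
    _                           ≈⟨ +-cong₆ (term 0F 0F) (term 0F 1F) (term 0F 2F) (term 1F 1F) (term 1F 2F) (term 2F 2F) ⟩
    _                           ≈⟨ solve 6 (λ a b c d e f → a :+ b :+ c :+ d :+ e :+ f
                                     := a :+ (b :+ (c :+ (d :+ (e :+ (f :+ con false)))))) refl _ _ _ _ _ _ ⟩
    pairing f (coordinates (A ⊗ matrix y ⊗ A ᵀ)) ∎
    where
    open ≈-Reasoning setoid
    open IsLinear (pairing-linear y)
    term : ∀ {a} i j → a * pairing (product (A i) (A j)) y ≈ a * (A ⊗ matrix y ⊗ A ᵀ) i j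
    term i j = *-congˡ (pairing-product (A i) (A j) y)

  -- The term with factor 4 vanishes and the signs are immaterial. The value at the nucleus contains
  -- f₁f₂f₄ three times, which leaves it once.
  discriminant≈eval-nucleus : ∀ f → discriminant f ≈ eval f (nucleus f)
  discriminant≈eval-nucleus f = begin
    discriminant f
      ≈⟨ +-cong (+-cong (+-congˡ (-x≈x _)) (-x≈x _)) (-x≈x _) ⟩
    4 · (f 0F * f 3F * f 5F) + f 1F * f 2F * f 4F + f 0F * (f 4F * f 4F) + f 3F * (f 2F * f 2F) + f 5F * (f 1F * f 1F)
      ≈⟨ solve 6 (λ f₀ f₁ f₂ f₃ f₄ f₅ → let x = f₀ :* f₃ :* f₅ in
           (x :+ (x :+ (x :+ (x :+ con false)))) :+ f₁ :* f₂ :* f₄ :+ f₀ :* (f₄ :* f₄) :+ f₃ :* (f₂ :* f₂) :+ f₅ :* (f₁ :* f₁)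
           := :eval (f₀ ∷ f₁ ∷ f₂ ∷ f₃ ∷ f₄ ∷ f₅ ∷ []) (f₄ ∷ f₂ ∷ f₁ ∷ [])) refl
           (f 0F) (f 1F) (f 2F) (f 3F) (f 4F) (f 5F) ⟩
    eval f (nucleus f)  ∎
    where open ≈-Reasoning setoid

  eval-cong : ∀ f {v w} → v ≋ w → eval f v ≈ eval f w
  eval-cong f {v} {w} v≋w = +-cong₆ (entry 0F 0F) (entry 0F 1F) (entry 0F 2F) (entry 1F 1F) (entry 1F 2F) (entry 2F 2F)
    where
    entry : ∀ {a} i j → a * (v i * v j) ≈ a * (w i * w j)
    entry i j = *-congˡ (*-cong (v≋w i) (v≋w j))

  eval-∙ : ∀ f a v → eval f (a ∙ v) ≈ a * a * eval f v
  eval-∙ f a v = solve 10 (λ f₀ f₁ f₂ f₃ f₄ f₅ v₀ v₁ v₂ a → let f = f₀ ∷ f₁ ∷ f₂ ∷ f₃ ∷ f₄ ∷ f₅ ∷ [] in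
    :eval f (a :* v₀ ∷ a :* v₁ ∷ a :* v₂ ∷ []) := a :* a :* :eval f (v₀ ∷ v₁ ∷ v₂ ∷ [])) refl
    (f 0F) (f 1F) (f 2F) (f 3F) (f 4F) (f 5F) (v 0F) (v 1F) (v 2F) a

  eval-substitute : ∀ A f v → eval (substitute A f) v ≈ eval f (λ i → dot (A i) v)
  eval-substitute A f v = trans (φ-substitute A f)
    (+-cong₆ (term 0F 0F) (term 0F 1F) (term 0F 2F) (term 1F 1F) (term 1F 2F) (term 2F 2F))
    where
    open IsLinear (eval-linear v)
    term : ∀ {a} i j → a * eval (product (A i) (A j)) v ≈ a * (dot (A i) v * dot (A j) v)
    term i j = *-congˡ (eval-product (A i) (A j) v)

  determinant : Matrix → Carrier
  determinant A = dot (A 0F) (cross (A 1F) (A 2F))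

  private
    :triple : ∀ {k} → Fin 3 → (a₀ a₁ a₂ b₀ b₁ b₂ c₀ c₁ c₂ f₀ f₁ f₂ f₃ f₄ f₅ : Polynomial k) → Polynomial k × Polynomial k
    :triple i a₀ a₁ a₂ b₀ b₁ b₂ c₀ c₁ c₂ f₀ f₁ f₂ f₃ f₄ f₅ =
      let a = a₀ ∷ a₁ ∷ a₂ ∷ [] ; b = b₀ ∷ b₁ ∷ b₂ ∷ [] ; c = c₀ ∷ c₁ ∷ c₂ ∷ [] ; l = (a ∷ b ∷ c ∷ []) i in
      f₀ :* :dot l (:cross a a) :+ f₁ :* :dot l (:cross a b) :+ f₂ :* :dot l (:cross a c)
      :+ f₃ :* :dot l (:cross b b) :+ f₄ :* :dot l (:cross b c) :+ f₅ :* :dot l (:cross c c)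
      := :dot a (:cross b c) :* (f₄ ∷ f₂ ∷ f₁ ∷ []) i

  -- The nucleus of a product of two linear forms is their cross product. So row i of A applied to
  -- the nucleus yields triple products of rows, each of which is the determinant or zero.
  nucleus-substitute : ∀ A f → (λ i → dot (A i) (nucleus (substitute A f))) ≋ determinant A ∙ nucleus f
  nucleus-substitute A f = λ
    { 0F → trans (IsLinear.φ-substitute (dot-nucleus-linear (A 0F)) A f) (solve 15 (:triple 0F) refl
             (A 0F 0F) (A 0F 1F) (A 0F 2F) (A 1F 0F) (A 1F 1F) (A 1F 2F) (A 2F 0F) (A 2F 1F) (A 2F 2F)
             (f 0F) (f 1F) (f 2F) (f 3F) (f 4F) (f 5F))
    ; 1F → trans (IsLinear.φ-substitute (dot-nucleus-linear (A 1F)) A f) (solve 15 (:triple 1F) refl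
             (A 0F 0F) (A 0F 1F) (A 0F 2F) (A 1F 0F) (A 1F 1F) (A 1F 2F) (A 2F 0F) (A 2F 1F) (A 2F 2F)
             (f 0F) (f 1F) (f 2F) (f 3F) (f 4F) (f 5F))
    ; 2F → trans (IsLinear.φ-substitute (dot-nucleus-linear (A 2F)) A f) (solve 15 (:triple 2F) refl
             (A 0F 0F) (A 0F 1F) (A 0F 2F) (A 1F 0F) (A 1F 1F) (A 1F 2F) (A 2F 0F) (A 2F 1F) (A 2F 2F)
             (f 0F) (f 1F) (f 2F) (f 3F) (f 4F) (f 5F))
    }

  discriminant-substitute : ∀ A f → discriminant (substitute A f) ≈ determinant A * determinant A * discriminant f
  discriminant-substitute A f = begin
    discriminant (substitute A f)                              ≈⟨ discriminant≈eval-nucleus (substitute A f) ⟩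
    eval (substitute A f) (nucleus (substitute A f))           ≈⟨ eval-substitute A f (nucleus (substitute A f)) ⟩
    eval f (λ i → dot (A i) (nucleus (substitute A f)))        ≈⟨ eval-cong f (nucleus-substitute A f) ⟩
    eval f (determinant A ∙ nucleus f)                         ≈⟨ eval-∙ f (determinant A) (nucleus f) ⟩
    determinant A * determinant A * eval f (nucleus f)         ≈⟨ *-congˡ (discriminant≈eval-nucleus f) ⟨
    determinant A * determinant A * discriminant f             ∎
    where open ≈-Reasoning setoid

  discriminant-cong : ∀ {f g} → f ≋ g → discriminant f ≈ discriminant g
  discriminant-cong {f} {g} f≋g = trans (discriminant≈eval-nucleus f) (trans (IsLinear.φ-cong (eval-linear (nucleus f)) {f} {g} f≋g)
    (trans (eval-cong g {nucleus f} {nucleus g} (nucleus-cong {f} {g} f≋g)) (sym (discriminant≈eval-nucleus g))))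

  -- The nucleus of a pair of distinct lines is their intersection, a point of the pair; for
  -- proportional forms the nucleus is zero.
  discriminant-product : ∀ l m → discriminant (product l m) ≈ 0#
  discriminant-product l m = trans (discriminant≈eval-nucleus (product l m)) (solve 6 (λ l₀ l₁ l₂ m₀ m₁ m₂ →
    let l = l₀ ∷ l₁ ∷ l₂ ∷ [] ; m = m₀ ∷ m₁ ∷ m₂ ∷ [] in :eval (:product l m) (:cross l m) := con false) refl
    (l 0F) (l 1F) (l 2F) (m 0F) (m 1F) (m 2F))

  ◁-inverse : ∀ {A B} → A ⊗ B ≈ᴹ 1ᴹ → ∀ l → l ◁ A ◁ B ≋ l
  ◁-inverse {A} {B} AB≈1 l j = trans assoc (trans
    (sum-cong-≋ {x = λ k → l k * (A ⊗ B) k j} {λ k → l k * 1ᴹ k j} λ k → *-congˡ (AB≈1 k j)) (identity j))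
    where
    assoc : dot (l ◁ A) (λ k → B k j) ≈ dot l (λ k → (A ⊗ B) k j)
    assoc = solve 15 (λ l₀ l₁ l₂ b₀ b₁ b₂ a₀₀ a₀₁ a₀₂ a₁₀ a₁₁ a₁₂ a₂₀ a₂₁ a₂₂ →
      let l = l₀ ∷ l₁ ∷ l₂ ∷ [] ; b = b₀ ∷ b₁ ∷ b₂ ∷ [] in
      :dot (:dot l (a₀₀ ∷ a₁₀ ∷ a₂₀ ∷ []) ∷ :dot l (a₀₁ ∷ a₁₁ ∷ a₂₁ ∷ []) ∷ :dot l (a₀₂ ∷ a₁₂ ∷ a₂₂ ∷ []) ∷ []) b
      := :dot l (:dot (a₀₀ ∷ a₀₁ ∷ a₀₂ ∷ []) b ∷ :dot (a₁₀ ∷ a₁₁ ∷ a₁₂ ∷ []) b ∷ :dot (a₂₀ ∷ a₂₁ ∷ a₂₂ ∷ []) b ∷ [])) refl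
      (l 0F) (l 1F) (l 2F) (B 0F j) (B 1F j) (B 2F j)
      (A 0F 0F) (A 0F 1F) (A 0F 2F) (A 1F 0F) (A 1F 1F) (A 1F 2F) (A 2F 0F) (A 2F 1F) (A 2F 2F)
    identity : ∀ j → dot l (λ k → 1ᴹ k j) ≈ l j
    identity 0F = solve 3 (λ x y z → x :* con true :+ (y :* con false :+ (z :* con false :+ con false)) := x) refl (l 0F) (l 1F) (l 2F)
    identity 1F = solve 3 (λ x y z → x :* con false :+ (y :* con true :+ (z :* con false :+ con false)) := y) refl (l 0F) (l 1F) (l 2F)
    identity 2F = solve 3 (λ x y z → x :* con false :+ (y :* con false :+ (z :* con true :+ con false)) := z) refl (l 0F) (l 1F) (l 2F)

  proportional-◁ : ∀ A {l m} → Proportional l m → Proportional (l ◁ A) (m ◁ A)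
  proportional-◁ A {l} {m} (a , eq) = a , [ inj₁ ∘ apply {l} {m} , inj₂ ∘ apply {m} {l} ]′ eq
    where
    apply : ∀ {l m} → l ≋ a ∙ m → l ◁ A ≋ a ∙ (m ◁ A)
    apply {l} {m} l≋am j = trans (sum-cong-≋ {x = λ k → l k * A k j} {λ k → a * (m k * A k j)}
      λ k → trans (*-congʳ (l≋am k)) (*-assoc a (m k) (A k j))) (sym (*-distribˡ-sum a (λ k → m k * A k j)))

  proportional-resp : {l l′ m m′ : Vector Carrier 3} → l ≋ l′ → m ≋ m′ → Proportional l m → Proportional l′ m′
  proportional-resp l≋ m≋ (a , inj₁ eq) = a , inj₁ λ i → trans (sym (l≋ i)) (trans (eq i) (*-congˡ (m≋ i)))
  proportional-resp l≋ m≋ (a , inj₂ eq) = a , inj₂ λ i → trans (sym (m≋ i)) (trans (eq i) (*-congˡ (l≋ i)))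

  ¬proportional-◁ : ∀ {A B} → A ⊗ B ≈ᴹ 1ᴹ → ∀ {l m} → ¬ Proportional l m → ¬ Proportional (l ◁ A) (m ◁ A)
  ¬proportional-◁ {A} {B} AB≈1 {l} {m} ¬prop prop =
    ¬prop (proportional-resp {l ◁ A ◁ B} {l} {m ◁ A ◁ B} {m}
      (◁-inverse {A} {B} AB≈1 l) (◁-inverse {A} {B} AB≈1 m) (proportional-◁ B {l ◁ A} {m ◁ A} prop))

  proportional⇒cross≈0 : ∀ {l m} → Proportional l m → ∀ k → cross l m k ≈ 0#
  proportional⇒cross≈0 {l} {m} (a , eq) = λ
    { 0F → minor 1F 2F ; 1F → minor 0F 2F ; 2F → minor 0F 1F }
    where
    multiple : ∀ {l m} → l ≋ a ∙ m → ∀ i j → l i * m j + l j * m i ≈ 0#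
    multiple {l} {m} l≋am i j = trans (+-cong (*-congʳ (l≋am i)) (*-congʳ (l≋am j)))
      (solve 3 (λ a x y → a :* x :* y :+ a :* y :* x := con false) refl a (m i) (m j))
    minor : ∀ i j → l i * m j + l j * m i ≈ 0#
    minor i j = [ (λ l≋am → multiple l≋am i j)
                , (λ m≋al → trans (solve 4 (λ x y z w → x :* w :+ y :* z := z :* y :+ w :* x) refl (l i) (l j) (m i) (m j))
                    (multiple m≋al i j)) ]′ eq

  zeroVector? : ∀ {k} (v : Vector Carrier k) → (∀ i → v i ≈ 0#) ⊎ ∃ λ i → v i # 0#
  zeroVector? {zero}  v = inj₁ λ ()
  zeroVector? {suc k} v with zero? (v zero) | zeroVector? (v ∘ suc)
  ... | inj₂ v₀#0 | _               = inj₂ (zero , v₀#0)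
  ... | inj₁ _    | inj₂ (i , vᵢ#0) = inj₂ (suc i , vᵢ#0)
  ... | inj₁ v₀≈0 | inj₁ v≈0        = inj₁ λ { zero → v₀≈0 ; (suc i) → v≈0 i }

  cross≈0⇒proportional : ∀ {l m} → (∀ k → cross l m k ≈ 0#) → Proportional l m
  cross≈0⇒proportional {l} {m} cross≈0 = [ degenerate , pivot ]′ (zeroVector? l)
    where
    degenerate : (∀ i → l i ≈ 0#) → Proportional l m
    degenerate l≈0 = 0# , inj₁ λ i → trans (l≈0 i) (sym (zeroˡ (m i)))
    minor : ∀ i j → l i * m j ≈ l j * m i
    minor 0F 0F = refl
    minor 1F 1F = refl
    minor 2F 2F = refl
    minor 0F 1F = x+y≈0⇒x≈y (cross≈0 2F)
    minor 0F 2F = x+y≈0⇒x≈y (cross≈0 1F)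
    minor 1F 2F = x+y≈0⇒x≈y (cross≈0 0F)
    minor 1F 0F = sym (minor 0F 1F)
    minor 2F 0F = sym (minor 0F 2F)
    minor 2F 1F = sym (minor 1F 2F)
    pivot : (∃ λ i → l i # 0#) → Proportional l m
    pivot (i , lᵢ#0) = let u , lᵢu≈1 = inverse lᵢ#0 in m i * u , inj₂ λ j → begin
      m j                    ≈⟨ *-identityˡ (m j) ⟨
      1# * m j               ≈⟨ *-congʳ lᵢu≈1 ⟨
      l i * u * m j          ≈⟨ solve 3 (λ x u y → x :* u :* y := u :* (x :* y)) refl (l i) u (m j) ⟩
      u * (l i * m j)        ≈⟨ *-congˡ (minor i j) ⟩
      u * (l j * m i)        ≈⟨ solve 3 (λ u x y → u :* (x :* y) := y :* u :* x) refl u (l j) (m i) ⟩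
      m i * u * l j          ∎
      where open ≈-Reasoning setoid

-- Hyperplanes through a line of the orbit and their normal forms.

module Orbit {c ℓ₁ ℓ₂} (K : HeytingField c ℓ₁ ℓ₂) {n : ℕ} (#K : HasCardinality (setoidOf K) n)
  (1+1≈0 : CharacteristicTwo (ring K)) where

  open import Data.Vec.Functional using (Vector; []; _∷_)
  open CommutativeRing (ring K) hiding (zero; ring)
  open HeytingField K using (_#_; heytingCommutativeRing)
  open HeytingProperties heytingCommutativeRing using (1#0)
  open CharTwo (ring K) 1+1≈0
  open FiniteField K #K
  open PG5 K
  open Conic K #K 1+1≈0
  open Sum semiring using (sum-cong-≋; sum-replicate-zero; *-distribˡ-sum)
  open VecEquality setoid using (_≋_)

  Nonzero : Vector Carrier 6 → Set ℓ₂
  Nonzero f = ∃ λ i → f i # 0#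

  -- The forms vanishing on the representative of o₁₃,₃.
  Canonical : Vector Carrier 6 → Set ℓ₁
  Canonical f = f 1F ≈ f 3F × f 3F ≈ f 5F

  pairing-congʳ : ∀ f {x y} → x ≋ y → pairing f x ≈ pairing f y
  pairing-congʳ f {x} {y} x≋y = sum-cong-≋ {x = λ k → f k * x k} {λ k → f k * y k} λ k → *-congˡ (x≋y k)

  pairing-∙ʳ : ∀ f a y → pairing f (a ∙ y) ≈ a * pairing f y
  pairing-∙ʳ f a y = trans
    (sum-cong-≋ {x = λ k → f k * (a * y k)} {λ k → a * (f k * y k)}
      λ k → solve 3 (λ f a y → f :* (a :* y) := a :* (f :* y)) refl (f k) a (y k))
    (sym (*-distribˡ-sum a (λ k → f k * y k)))

  pairing-zeroʳ : ∀ f {y} → (∀ i → y i ≈ 0#) → pairing f y ≈ 0#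
  pairing-zeroʳ f {y} y≈0 = trans
    (sum-cong-≋ {x = λ k → f k * y k} {λ _ → 0#} λ k → trans (*-congˡ (y≈0 k)) (zeroʳ (f k)))
    (sum-replicate-zero 6)

  -- `coordinates` reads only the upper triangle, so symmetry is what lets `matrix` recover the
  -- image of a point. It holds because the product of two linear forms commutes.
  congruent-symmetric : ∀ A y i j → (A ⊗ matrix y ⊗ A ᵀ) i j ≈ (A ⊗ matrix y ⊗ A ᵀ) j i
  congruent-symmetric A y i j = trans (sym (pairing-product (A i) (A j) y))
    (trans (IsLinear.φ-cong (pairing-linear y) {product (A i) (A j)} {product (A j) (A i)} product-comm)
      (pairing-product (A j) (A i) y))
    where
    product-comm : product (A i) (A j) ≋ product (A j) (A i)
    product-comm = λ
      { 0F → *-comm _ _ ; 1F → cross-comm 0F 1F ; 2F → cross-comm 0F 2F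
      ; 3F → *-comm _ _ ; 4F → cross-comm 1F 2F ; 5F → *-comm _ _ }
      where
      cross-comm : ∀ k l → A i k * A j l + A i l * A j k ≈ A j k * A i l + A j l * A i k
      cross-comm k l = trans (+-comm _ _) (+-cong (*-comm _ _) (*-comm _ _))

  matrix-coordinates : ∀ M → (∀ i j → M i j ≈ M j i) → matrix (coordinates M) ≈ᴹ M
  matrix-coordinates M M-sym = λ
    { 0F 0F → refl ; 0F 1F → refl ; 0F 2F → refl
    ; 1F 0F → M-sym 0F 1F ; 1F 1F → refl ; 1F 2F → refl
    ; 2F 0F → M-sym 0F 2F ; 2F 1F → M-sym 1F 2F ; 2F 2F → refl }

  representative : Carrier → Carrier → Vector Carrier 6
  representative x y = 0# ∷ x ∷ 0# ∷ x + y ∷ 0# ∷ y ∷ []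

  -- The entry x + y makes f₃ contribute to both coefficients; their vanishing is the condition
  -- `Canonical`.
  pairing-representative : ∀ f x y → pairing f (representative x y) ≈ (f 1F + f 3F) * x + (f 3F + f 5F) * y
  pairing-representative f x y = solve 8 (λ f₀ f₁ f₂ f₃ f₄ f₅ x y →
    f₀ :* con false :+ (f₁ :* x :+ (f₂ :* con false :+ (f₃ :* (x :+ y) :+ (f₄ :* con false :+ (f₅ :* y :+ con false)))))
    := (f₁ :+ f₃) :* x :+ (f₃ :+ f₅) :* y) refl (f 0F) (f 1F) (f 2F) (f 3F) (f 4F) (f 5F) x y

  substitute-nonzero : ∀ {A B} → A ⊗ B ≈ᴹ 1ᴹ → ∀ f → Nonzero f → Nonzero (substitute A f)
  substitute-nonzero {A} {B} AB≈1 f (i , fᵢ#0) = [ (λ Af≈0 → contradiction (vanishes Af≈0) (#⇒≉ fᵢ#0)) , id ]′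
    (zeroVector? (substitute A f))
    where
    open ≈-Reasoning setoid
    vanishes : (∀ k → substitute A f k ≈ 0#) → f i ≈ 0#
    vanishes Af≈0 = begin
      f i                                     ≈⟨ substitute-inverse {B} {A} AB≈1 f i ⟨
      substitute B (substitute A f) i         ≈⟨ substitute-cong B {substitute A f} {0# ∙ f}
                                                  (λ k → trans (Af≈0 k) (sym (zeroˡ (f k)))) i ⟩
      substitute B (0# ∙ f) i                 ≈⟨ substitute-∙ B 0# f i ⟩
      0# * substitute B f i                   ≈⟨ zeroˡ _ ⟩
      0#                                      ∎

  module _ (L : Line) {A : Matrix} (L≈AR : ∀ X → X ∈ˡ L ⇔ Image A representative₁₃,₃ X) where

    contains⇒canonical : ∀ H → L ⊆ʰ H → Canonical (substitute A (coords H))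
    contains⇒canonical H L⊆H = x+y≈0⇒x≈y (trans coefficient₁ (vanishes 1# 0# (1F , 1#0)))
                             , x+y≈0⇒x≈y (trans coefficient₂ (vanishes 0# 1# (5F , 1#0)))
      where
      g : Vector Carrier 6
      g = substitute A (coords H)
      coefficient₁ : g 1F + g 3F ≈ pairing g (representative 1# 0#)
      coefficient₁ = sym (trans (pairing-representative g 1# 0#)
        (solve 2 (λ x y → x :* con true :+ y :* con false := x) refl _ _))
      coefficient₂ : g 3F + g 5F ≈ pairing g (representative 0# 1#)
      coefficient₂ = sym (trans (pairing-representative g 0# 1#)
        (solve 2 (λ x y → x :* con false :+ y :* con true := y) refl _ _))
      vanishes : ∀ x y → Nonzero (representative x y) → pairing g (representative x y) ≈ 0#
      vanishes x y nonzero = trans (pairing-substitute A (coords H) (representative x y))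
        -- The image of Y is a point only if its coordinates are not all zero. In the zero case the
        -- pairing vanishes anyway, which avoids deriving nonvanishing from the invertibility of A.
        ([ pairing-zeroʳ (coords H) , on-line ]′ (zeroVector? X))
        where
        X : Vector Carrier 6
        X = coordinates (A ⊗ matrix (representative x y) ⊗ A ᵀ)
        Y : Point 5
        Y = record { coords = representative x y ; nonzero = nonzero }
        on-line : Nonzero X → pairing (coords H) X ≈ 0#
        on-line X#0 = L⊆H (record { coords = X ; nonzero = X#0 }) (Equivalence.from (L≈AR (record { coords = X ; nonzero = X#0 }))
          ( Y
          , (x , y , λ { 0F 0F → refl ; 0F 1F → refl ; 0F 2F → refl
                       ; 1F 0F → refl ; 1F 1F → refl ; 1F 2F → refl
                       ; 2F 0F → refl ; 2F 1F → refl ; 2F 2F → refl })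
          , 1# , 1#0
          , λ i j → trans (matrix-coordinates (A ⊗ matrix (representative x y) ⊗ A ᵀ) (congruent-symmetric A (representative x y)) i j)
              (sym (*-identityˡ _))))

    canonical⇒contains : ∀ H → Canonical (substitute A (coords H)) → L ⊆ʰ H
    canonical⇒contains H (g₁≈g₃ , g₃≈g₅) X X∈L with Equivalence.to (L≈AR X) X∈L
    ... | Y , (x , y , Y≈R) , a , _ , X≈aAYAᵀ = begin
      pairing (coords H) (coords X)
        ≈⟨ pairing-congʳ (coords H) {coords X} {a ∙ coordinates AYAᵀ} X≋ ⟩
      pairing (coords H) (a ∙ coordinates AYAᵀ)
        ≈⟨ pairing-∙ʳ (coords H) a (coordinates AYAᵀ) ⟩
      a * pairing (coords H) (coordinates AYAᵀ)
        ≈⟨ *-congˡ (pairing-substitute A (coords H) (coords Y)) ⟨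
      a * pairing g (coords Y)
        ≈⟨ *-congˡ (pairing-congʳ g {coords Y} {representative x y} Y≋) ⟩
      a * pairing g (representative x y)                                    ≈⟨ *-congˡ (pairing-representative g x y) ⟩
      a * ((g 1F + g 3F) * x + (g 3F + g 5F) * y)
        ≈⟨ *-congˡ (+-cong (*-congʳ (x≈y⇒x+y≈0 g₁≈g₃)) (*-congʳ (x≈y⇒x+y≈0 g₃≈g₅))) ⟩
      a * (0# * x + 0# * y)
        ≈⟨ solve 3 (λ a x y → a :* (con false :* x :+ con false :* y) := con false) refl a x y ⟩
      0#                                                                    ∎
      where
      open ≈-Reasoning setoid
      g : Vector Carrier 6
      g = substitute A (coords H)
      AYAᵀ : Matrix
      AYAᵀ = A ⊗ matrix (coords Y) ⊗ A ᵀ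
      X≋ : coords X ≋ a ∙ coordinates AYAᵀ
      X≋ = λ { 0F → X≈aAYAᵀ 0F 0F ; 1F → X≈aAYAᵀ 0F 1F ; 2F → X≈aAYAᵀ 0F 2F
             ; 3F → X≈aAYAᵀ 1F 1F ; 4F → X≈aAYAᵀ 1F 2F ; 5F → X≈aAYAᵀ 2F 2F }
      Y≋ : coords Y ≋ representative x y
      Y≋ = λ { 0F → Y≈R 0F 0F ; 1F → Y≈R 0F 1F ; 2F → Y≈R 0F 2F
             ; 3F → Y≈R 1F 1F ; 4F → Y≈R 1F 2F ; 5F → Y≈R 2F 2F }

  conic : (a b c t : Carrier) → Vector Carrier 6
  conic a b c t = a ∷ t ∷ b ∷ t ∷ c ∷ t ∷ []

  conic-cong : ∀ {a a′ b b′ c c′ t t′} → a ≈ a′ → b ≈ b′ → c ≈ c′ → t ≈ t′ → conic a b c t ≋ conic a′ b′ c′ t′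
  conic-cong a≈ b≈ c≈ t≈ = λ { 0F → a≈ ; 1F → t≈ ; 2F → b≈ ; 3F → t≈ ; 4F → c≈ ; 5F → t≈ }

  canonical⇒conic : ∀ {f} → Canonical f → f ≋ conic (f 0F) (f 2F) (f 4F) (f 1F)
  canonical⇒conic (f₁≈f₃ , f₃≈f₅) = λ
    { 0F → refl ; 1F → refl ; 2F → refl ; 3F → sym f₁≈f₃ ; 4F → refl ; 5F → sym (trans f₁≈f₃ f₃≈f₅) }

  -- Canonical forms up to scalars, scaled by the first nonzero coefficient among those of X₁X₂, X₀X₁, X₀X₂, X₀².
  data Shape : Set c where
    shape₁ : (a b t : Carrier) → Shape
    shape₂ : (a b : Carrier) → Shape
    shape₃ : (a : Carrier) → Shape
    shape₄ : Shape

  ⟦_⟧ : Shape → Vector Carrier 6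
  ⟦ shape₁ a b t ⟧ = conic a b 1# t
  ⟦ shape₂ a b ⟧   = conic a b 0# 1#
  ⟦ shape₃ a ⟧     = conic a 1# 0# 0#
  ⟦ shape₄ ⟧       = conic 1# 0# 0# 0#

  shape-canonical : ∀ S → Canonical ⟦ S ⟧
  shape-canonical (shape₁ _ _ _) = refl , refl
  shape-canonical (shape₂ _ _)   = refl , refl
  shape-canonical (shape₃ _)     = refl , refl
  shape-canonical shape₄         = refl , refl

  shape-nonzero : ∀ S → Nonzero ⟦ S ⟧
  shape-nonzero (shape₁ _ _ _) = 4F , 1#0
  shape-nonzero (shape₂ _ _)   = 1F , 1#0
  shape-nonzero (shape₃ _)     = 2F , 1#0
  shape-nonzero shape₄         = 0F , 1#0

  unscale : ∀ {k} {f g : Vector Carrier k} {s u} → s * u ≈ 1# → f ≋ s ∙ g → g ≋ u ∙ f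
  unscale {f = f} {g} {s} {u} su≈1 f≋sg i = begin
    g i              ≈⟨ *-identityˡ (g i) ⟨
    1# * g i         ≈⟨ *-congʳ su≈1 ⟨
    s * u * g i      ≈⟨ solve 3 (λ s u x → s :* u :* x := u :* (s :* x)) refl s u (g i) ⟩
    u * (s * g i)    ≈⟨ *-congˡ (f≋sg i) ⟨
    u * f i          ∎
    where open ≈-Reasoning setoid

  private
    ⟦⟧-scale-one : ∀ {a} S S′ → a ≈ 1# → ⟦ S ⟧ ≋ a ∙ ⟦ S′ ⟧ → ⟦ S ⟧ ≋ ⟦ S′ ⟧
    ⟦⟧-scale-one S S′ a≈1 eq i = trans (eq i) (trans (*-congʳ a≈1) (*-identityˡ (⟦ S′ ⟧ i)))

    1≉x*0 : ∀ {x} → ¬ 1# ≈ x * 0#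
    1≉x*0 1≈x0 = #⇒≉ 1#0 (trans 1≈x0 (zeroʳ _))

    0≉x*1 : ∀ {x} → x # 0# → ¬ 0# ≈ x * 1#
    0≉x*1 x#0 0≈x1 = #⇒≉ x#0 (sym (trans 0≈x1 (*-identityʳ _)))

    1≈x*1⇒x≈1 : ∀ {x} → 1# ≈ x * 1# → x ≈ 1#
    1≈x*1⇒x≈1 eq = sym (trans eq (*-identityʳ _))

  -- Two forms of the same shape share a coefficient 1, which forces the scalar to be 1. For
  -- different shapes some coefficient is 1 in one and 0 in the other.
  ⟦⟧-injective : ∀ {a} → a # 0# → ∀ S S′ → ⟦ S ⟧ ≋ a ∙ ⟦ S′ ⟧ → ⟦ S ⟧ ≋ ⟦ S′ ⟧
  ⟦⟧-injective a#0 S@(shape₁ _ _ _) S′@(shape₁ _ _ _) eq = ⟦⟧-scale-one S S′ (1≈x*1⇒x≈1 (eq 4F)) eq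
  ⟦⟧-injective a#0 S@(shape₂ _ _)   S′@(shape₂ _ _)   eq = ⟦⟧-scale-one S S′ (1≈x*1⇒x≈1 (eq 1F)) eq
  ⟦⟧-injective a#0 S@(shape₃ _)     S′@(shape₃ _)     eq = ⟦⟧-scale-one S S′ (1≈x*1⇒x≈1 (eq 2F)) eq
  ⟦⟧-injective a#0 shape₄           shape₄            eq = λ _ → refl
  ⟦⟧-injective a#0 (shape₁ _ _ _) (shape₂ _ _)   eq = contradiction (eq 4F) 1≉x*0
  ⟦⟧-injective a#0 (shape₁ _ _ _) (shape₃ _)     eq = contradiction (eq 4F) 1≉x*0
  ⟦⟧-injective a#0 (shape₁ _ _ _) shape₄         eq = contradiction (eq 4F) 1≉x*0
  ⟦⟧-injective a#0 (shape₂ _ _)   (shape₃ _)     eq = contradiction (eq 1F) 1≉x*0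
  ⟦⟧-injective a#0 (shape₂ _ _)   shape₄         eq = contradiction (eq 1F) 1≉x*0
  ⟦⟧-injective a#0 (shape₃ _)     shape₄         eq = contradiction (eq 2F) 1≉x*0
  ⟦⟧-injective a#0 (shape₂ _ _)   (shape₁ _ _ _) eq = contradiction (eq 4F) (0≉x*1 a#0)
  ⟦⟧-injective a#0 (shape₃ _)     (shape₁ _ _ _) eq = contradiction (eq 4F) (0≉x*1 a#0)
  ⟦⟧-injective a#0 shape₄         (shape₁ _ _ _) eq = contradiction (eq 4F) (0≉x*1 a#0)
  ⟦⟧-injective a#0 (shape₃ _)     (shape₂ _ _)   eq = contradiction (eq 1F) (0≉x*1 a#0)
  ⟦⟧-injective a#0 shape₄         (shape₂ _ _)   eq = contradiction (eq 1F) (0≉x*1 a#0)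
  ⟦⟧-injective a#0 shape₄         (shape₃ _)     eq = contradiction (eq 2F) (0≉x*1 a#0)

  normalise : ∀ {f} → Canonical f → Nonzero f → ∃₂ λ S a → a # 0# × f ≋ a ∙ ⟦ S ⟧
  normalise {f} canonical (i , fᵢ#0) = by-leading (zero? c₀) (zero? t₀) (zero? b₀)
    where
    a₀ b₀ c₀ t₀ : Carrier
    a₀ = f 0F
    b₀ = f 2F
    c₀ = f 4F
    t₀ = f 1F
    over : ∀ {s u} → s * u ≈ 1# → ∀ x → x ≈ s * (u * x)
    over {s} {u} su≈1 x = trans (sym (*-identityˡ x)) (trans (*-congʳ (sym su≈1)) (*-assoc s u x))
    to-shape : ∀ {a b c t} S s → s # 0# → a₀ ≈ a → b₀ ≈ b → c₀ ≈ c → t₀ ≈ t → conic a b c t ≋ s ∙ ⟦ S ⟧ →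
      ∃₂ λ S a → a # 0# × f ≋ a ∙ ⟦ S ⟧
    to-shape S s s#0 a≈ b≈ c≈ t≈ eq = S , s , s#0 , λ k →
      trans (canonical⇒conic {f} canonical k) (trans (conic-cong a≈ b≈ c≈ t≈ k) (eq k))
    by-leading : c₀ ≈ 0# ⊎ c₀ # 0# → t₀ ≈ 0# ⊎ t₀ # 0# → b₀ ≈ 0# ⊎ b₀ # 0# → ∃₂ λ S a → a # 0# × f ≋ a ∙ ⟦ S ⟧
    by-leading (inj₂ c#0) _ _ = let u , cu≈1 = inverse c#0 in
      to-shape (shape₁ (u * a₀) (u * b₀) (u * t₀)) c₀ c#0
        (over cu≈1 a₀) (over cu≈1 b₀) (sym (*-identityʳ c₀)) (over cu≈1 t₀)
        λ { 0F → refl ; 1F → refl ; 2F → refl ; 3F → refl ; 4F → refl ; 5F → refl }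
    by-leading (inj₁ c≈0) (inj₂ t#0) _ = let u , tu≈1 = inverse t#0 in
      to-shape (shape₂ (u * a₀) (u * b₀)) t₀ t#0
        (over tu≈1 a₀) (over tu≈1 b₀) (trans c≈0 (sym (zeroʳ t₀))) (sym (*-identityʳ t₀))
        λ { 0F → refl ; 1F → refl ; 2F → refl ; 3F → refl ; 4F → refl ; 5F → refl }
    by-leading (inj₁ c≈0) (inj₁ t≈0) (inj₂ b#0) = let u , bu≈1 = inverse b#0 in
      to-shape (shape₃ (u * a₀)) b₀ b#0
        (over bu≈1 a₀) (sym (*-identityʳ b₀)) (trans c≈0 (sym (zeroʳ b₀))) (trans t≈0 (sym (zeroʳ b₀)))
        λ { 0F → refl ; 1F → refl ; 2F → refl ; 3F → refl ; 4F → refl ; 5F → refl }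
    by-leading (inj₁ c≈0) (inj₁ t≈0) (inj₁ b≈0) =
      to-shape shape₄ a₀ (leading i fᵢ#0)
        (sym (*-identityʳ a₀)) (trans b≈0 (sym (zeroʳ a₀))) (trans c≈0 (sym (zeroʳ a₀))) (trans t≈0 (sym (zeroʳ a₀)))
        λ { 0F → refl ; 1F → refl ; 2F → refl ; 3F → refl ; 4F → refl ; 5F → refl }
      where
      leading : ∀ i → f i # 0# → a₀ # 0#
      leading 0F f₀#0 = f₀#0
      leading 1F f₁#0 = contradiction t≈0 (#⇒≉ f₁#0)
      leading 2F f₂#0 = contradiction b≈0 (#⇒≉ f₂#0)
      leading 3F f₃#0 = contradiction (trans (sym (proj₁ canonical)) t≈0) (#⇒≉ f₃#0)
      leading 4F f₄#0 = contradiction c≈0 (#⇒≉ f₄#0)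
      leading 5F f₅#0 = contradiction (trans (sym (proj₂ canonical)) (trans (sym (proj₁ canonical)) t≈0)) (#⇒≉ f₅#0)

  -- What has to be known about a class of conics to count it on every line of the orbit: invariance
  -- under coordinate change and scaling, and a parametrisation by `T` of the shapes that belong to
  -- it. The field `scale` divides a scalar out, because `normalise` writes a form as a scalar times
  -- a shape.
  record NormalForms {p t ℓ} (𝒞 : Pred (Vector Carrier 6) p) (T : Setoid t ℓ) : Set (c ⊔ ℓ₁ ⊔ ℓ₂ ⊔ p ⊔ t ⊔ ℓ) where
    private module T = Setoid T
    field
      invariant       : ∀ {A B} → A ⊗ B ≈ᴹ 1ᴹ → B ⊗ A ≈ᴹ 1ᴹ → ∀ {f} → 𝒞 f → 𝒞 (substitute A f)
      scale           : ∀ {s u f g} → s * u ≈ 1# → f ≋ s ∙ g → 𝒞 f → 𝒞 g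
      shape           : T.Carrier → Shape
      shape-cong      : ∀ {s t} → s T.≈ t → ⟦ shape s ⟧ ≋ ⟦ shape t ⟧
      shape-injective : ∀ {s t} → ⟦ shape s ⟧ ≋ ⟦ shape t ⟧ → s T.≈ t
      sound           : ∀ t → 𝒞 ⟦ shape t ⟧
      complete        : ∀ S → 𝒞 ⟦ S ⟧ → ∃ λ t → ⟦ S ⟧ ≋ ⟦ shape t ⟧

  -- The parameter t is sent to the hyperplane of `substitute B` applied to its shape, B being the
  -- inverse of A. Substituting A brings the hyperplanes through the line back to canonical forms,
  -- where `normalise` finds the shape.
  card-normalForms : ∀ {p t ℓ m} {𝒞 : Pred (Vector Carrier 6) p} {T : Setoid t ℓ} → NormalForms 𝒞 T →
    HasCardinality T m → ∀ L → o₁₃,₃ L → HasCardinality (HyperplanesThrough L (𝒞 ∘ coords)) m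
  card-normalForms {𝒞 = 𝒞} {T} forms #T L (A , (B , AB≈1 , BA≈1) , L≈AR) =
    card-bijection {S = T} {T = HyperplanesThrough L (𝒞 ∘ coords)} #T g g-cong g-injective g-surjective
    where
    open NormalForms forms
    κ : Setoid.Carrier T → Vector Carrier 6
    κ t = ⟦ shape t ⟧
    module T = Setoid T
    A∘B : ∀ f → substitute A (substitute B f) ≋ f
    A∘B = substitute-inverse {A} {B} BA≈1
    B∘A : ∀ f → substitute B (substitute A f) ≋ f
    B∘A = substitute-inverse {B} {A} AB≈1
    hyperplane : T.Carrier → Hyperplane
    hyperplane t = record { coords = substitute B (κ t) ; nonzero = substitute-nonzero {B} {A} BA≈1 (κ t) (shape-nonzero (shape t)) }
    g : T.Carrier → ∃ λ H → L ⊆ʰ H × 𝒞 (coords H)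
    g t = hyperplane t , canonical⇒contains L {A} L≈AR (hyperplane t) canonical′ , invariant {B} {A} BA≈1 AB≈1 {κ t} (sound t)
      where
      canonical′ : Canonical (substitute A (substitute B (κ t)))
      canonical′ = trans (A∘B (κ t) 1F) (trans (proj₁ (shape-canonical (shape t))) (sym (A∘B (κ t) 3F)))
                 , trans (A∘B (κ t) 3F) (trans (proj₂ (shape-canonical (shape t))) (sym (A∘B (κ t) 5F)))
    g-cong : ∀ {s t} → s T.≈ t → hyperplane s ∼ hyperplane t
    g-cong {s} {t} s≈t = 1# , 1#0 , λ i → trans (substitute-cong B {κ s} {κ t} (shape-cong s≈t) i) (sym (*-identityˡ _))
    g-injective : ∀ {s t} → hyperplane s ∼ hyperplane t → s T.≈ t
    g-injective {s} {t} (a , a#0 , s≋at) = shape-injective (⟦⟧-injective a#0 (shape s) (shape t) λ i → begin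
      κ s i                                       ≈⟨ A∘B (κ s) i ⟨
      substitute A (substitute B (κ s)) i
        ≈⟨ substitute-cong A {substitute B (κ s)} {a ∙ substitute B (κ t)} s≋at i ⟩
      substitute A (a ∙ substitute B (κ t)) i     ≈⟨ substitute-∙ A a (substitute B (κ t)) i ⟩
      a * substitute A (substitute B (κ t)) i     ≈⟨ *-congˡ (A∘B (κ t) i) ⟩
      a * κ t i                                   ∎)
      where open ≈-Reasoning setoid
    g-surjective : ((H , _) : ∃ λ H → L ⊆ʰ H × 𝒞 (coords H)) → ∃ λ t → hyperplane t ∼ H
    g-surjective (H , L⊆H , H∈𝒞) = from-shape (normalise {f} (contains⇒canonical L {A} L≈AR H L⊆H)
      (substitute-nonzero {A} {B} AB≈1 (coords H) (nonzero H)))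
      where
      open ≈-Reasoning setoid
      f : Vector Carrier 6
      f = substitute A (coords H)
      from-shape : (∃₂ λ S a → a # 0# × f ≋ a ∙ ⟦ S ⟧) → ∃ λ t → hyperplane t ∼ H
      from-shape (S , a , a#0 , f≋aS) =
        let u , au≈1  = inverse a#0
            t , S≋κt  = complete S (scale {f = f} {⟦ S ⟧} au≈1 f≋aS (invariant {A} {B} AB≈1 BA≈1 {coords H} H∈𝒞))
        in t , Setoid.sym (PG 5) {H} {hyperplane t} (a , a#0 , λ i → begin
          coords H i                                 ≈⟨ B∘A (coords H) i ⟨
          substitute B f i
            ≈⟨ substitute-cong B {f} {a ∙ κ t} (λ k → trans (f≋aS k) (*-congˡ (S≋κt k))) i ⟩
          substitute B (a ∙ κ t) i                   ≈⟨ substitute-∙ B a (κ t) i ⟩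
          a * substitute B (κ t) i                   ∎)

-- Double lines, pairs of real lines, non-singular conics.

module Classes {c ℓ₁ ℓ₂} (K : HeytingField c ℓ₁ ℓ₂) {n : ℕ} (#K : HasCardinality (setoidOf K) n)
  (1+1≈0 : CharacteristicTwo (ring K)) where

  open import Data.Sum.Relation.Binary.Pointwise using (inj₁; inj₂)
  open import Data.Vec.Functional using (Vector; []; _∷_)
  open CommutativeRing (ring K) hiding (zero; ring)
  open HeytingField K using (_#_; heytingCommutativeRing)
  open HeytingProperties heytingCommutativeRing using (1#0; x#0y#0→xy#0; #-congʳ)
  open CharTwo (ring K) 1+1≈0
  open FiniteField K #K
  open EvenField K #K 1+1≈0
  open PG5 K hiding (Image)
  open Conic K #K 1+1≈0
  open Orbit K #K 1+1≈0
  open VecEquality setoid using (_≋_)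

  -- The coefficient a for which conic a b 1 t is singular.
  apex : Carrier → Carrier → Carrier
  apex b t = t * (b + b * b + t * t)

  apex-cong : ∀ {b b′ t t′} → b ≈ b′ → t ≈ t′ → apex b t ≈ apex b′ t′
  apex-cong b≈ t≈ = *-cong t≈ (+-cong (+-cong b≈ (*-cong b≈ b≈)) (*-cong t≈ t≈))

  discriminant-conic : ∀ a b c t → discriminant (conic a b c t) ≈ a * (c * c) + t * (b * c + b * b + t * t)
  discriminant-conic a b c t = trans (discriminant≈eval-nucleus (conic a b c t)) (solve 4 (λ a b c t →
    a :* (c :* c) :+ t :* (c :* b) :+ b :* (c :* t) :+ t :* (b :* b) :+ c :* (b :* t) :+ t :* (t :* t)
    := a :* (c :* c) :+ t :* (b :* c :+ b :* b :+ t :* t)) refl a b c t)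

  discriminant-shape₁ : ∀ a b t → discriminant ⟦ shape₁ a b t ⟧ ≈ a + apex b t
  discriminant-shape₁ a b t = trans (discriminant-conic a b 1# t) (solve 3 (λ a b t → let one = con true in
    a :* (one :* one) :+ t :* (b :* one :+ b :* b :+ t :* t) := a :+ t :* (b :+ b :* b :+ t :* t)) refl a b t)

  discriminant-shape₂ : ∀ a b → discriminant ⟦ shape₂ a b ⟧ ≈ (b + 1#) * (b + 1#)
  discriminant-shape₂ a b = trans (discriminant-conic a b 0# 1#) (solve 2 (λ a b → let one = con true in
    a :* (con false :* con false) :+ one :* (b :* con false :+ b :* b :+ one :* one) := (b :+ one) :* (b :+ one)) refl a b)

  singular-shape₁ : ∀ {a b t} → discriminant ⟦ shape₁ a b t ⟧ ≈ 0# → a ≈ apex b t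
  singular-shape₁ {a} {b} {t} disc≈0 = x+y≈0⇒x≈y (trans (sym (discriminant-shape₁ a b t)) disc≈0)

  singular-shape₂ : ∀ {a b} → discriminant ⟦ shape₂ a b ⟧ ≈ 0# → b ≈ 1#
  singular-shape₂ {a} {b} disc≈0 = x+y≈0⇒x≈y ([ id , id ]′ (xy≈0⇒x≈0∨y≈0 (trans (sym (discriminant-shape₂ a b)) disc≈0)))

  Double : Pred (Vector Carrier 6) _
  Double f = ∃₂ λ a l → f ≋ a ∙ product l l

  Split : Pred (Vector Carrier 6) _
  Split f = ∃₂ λ l m → ¬ Proportional l m × f ≋ product l m

  Nonsingular : Pred (Vector Carrier 6) _
  Nonsingular f = discriminant f # 0#

  -- Mixed coefficients of a square vanish in characteristic 2, while every shape other than
  -- `shape₄`, which is X₀², has a mixed coefficient 1.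
  double-normalForms : NormalForms Double (≡.setoid (Fin 1))
  double-normalForms = record
    { invariant       = λ {A} AB≈1 BA≈1 {f} (a , l , f≋all) → a , l ◁ A , λ i → trans (substitute-cong A {f} {a ∙ product l l} f≋all i)
        (trans (substitute-∙ A a (product l l) i) (*-congˡ (substitute-product A l l i)))
    ; scale           = λ {s} {u} {f} {g} su≈1 f≋sg (a , l , f≋all) → u * a , l , λ i →
        trans (unscale {f = f} {g} su≈1 f≋sg i) (trans (*-congˡ (f≋all i)) (sym (*-assoc u a _)))
    ; shape           = λ _ → shape₄
    ; shape-cong      = λ _ _ → refl
    ; shape-injective = λ { {0F} {0F} _ → ≡.refl }
    ; sound           = λ _ → 1# , (1# ∷ 0# ∷ 0# ∷ []) , λ
        { 0F → solve 0 (con true := con true :* (con true :* con true)) refl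
        ; 1F → solve 0 (con false := con true :* (con true :* con false :+ con false :* con true)) refl
        ; 2F → solve 0 (con false := con true :* (con true :* con false :+ con false :* con true)) refl
        ; 3F → solve 0 (con false := con true :* (con false :* con false)) refl
        ; 4F → solve 0 (con false := con true :* (con false :* con false :+ con false :* con false)) refl
        ; 5F → solve 0 (con false := con true :* (con false :* con false)) refl
        }
    ; complete        = λ
        { (shape₁ a b t) (x , l , eq) → contradiction (trans (eq 4F) (mixed x (l 1F) (l 2F))) (#⇒≉ 1#0)
        ; (shape₂ a b)   (x , l , eq) → contradiction (trans (eq 1F) (mixed x (l 0F) (l 1F))) (#⇒≉ 1#0)
        ; (shape₃ a)     (x , l , eq) → contradiction (trans (eq 2F) (mixed x (l 0F) (l 2F))) (#⇒≉ 1#0)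
        ; shape₄         _            → 0F , λ _ → refl
        }
    }
    where
    mixed : ∀ a x y → a * (x * y + y * x) ≈ 0#
    mixed = solve 3 (λ a x y → a :* (x :* y :+ y :* x) := con false) refl

  -- The unit measures the distance from singularity: a = apex b t + d in `shape₁` with b, t free,
  -- and b = 1 + d in `shape₂` with a free. The other two shapes are singular. This gives q²(q - 1)
  -- + q(q - 1).
  NonsingularParameters : Setoid _ _
  NonsingularParameters = ⊎-setoid (×-setoid setoid (×-setoid setoid Unit)) (×-setoid setoid Unit)

  nonsingular-normalForms : NormalForms Nonsingular NonsingularParameters
  nonsingular-normalForms = record
    { invariant       = λ {A} {B} AB≈1 BA≈1 {f} f# → xy#0⇒y#0 (#-congʳ (restore A B AB≈1 f) f#)
    ; scale           = λ {s} {u} {f} {g} su≈1 f≋sg f# →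
        xy#0⇒y#0 (#-congʳ (trans (discriminant-cong {f} {s ∙ g} f≋sg) (discriminant-∙ s g)) f#)
    ; shape           = shape
    ; shape-cong      = λ
        { (inj₁ (b≈ , t≈ , d≈)) → conic-cong (+-cong (apex-cong b≈ t≈) d≈) b≈ refl t≈
        ; (inj₂ (a≈ , d≈))      → conic-cong a≈ (+-congˡ d≈) refl refl
        }
    ; shape-injective = shape-injective _ _
    ; sound           = λ
        { (inj₁ (b , t , d , d#0)) → #-congʳ (sym (trans (discriminant-shape₁ _ b t)
            (solve 2 (λ x d → x :+ d :+ x := d) refl (apex b t) d))) d#0
        ; (inj₂ (a , d , d#0))     → #-congʳ (sym (trans (discriminant-shape₂ a (1# + d))
            (solve 1 (λ d → (con true :+ d :+ con true) :* (con true :+ d :+ con true) := d :* d) refl d))) (x#0y#0→xy#0 d#0 d#0)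
        }
    ; complete        = λ
        { (shape₁ a b t) f# → inj₁ (b , t , a + apex b t , #-congʳ (discriminant-shape₁ a b t) f#) ,
            conic-cong (solve 2 (λ a x → a := x :+ (a :+ x)) refl a (apex b t)) refl refl refl
        ; (shape₂ a b)   f# → inj₂ (a , b + 1# , xy#0⇒x#0 (#-congʳ (discriminant-shape₂ a b) f#)) ,
            conic-cong refl (solve 1 (λ b → b := con true :+ (b :+ con true)) refl b) refl refl
        ; (shape₃ a)     f# → contradiction (trans (discriminant-conic a 1# 0# 0#) (degenerate a 1#)) (#⇒≉ f#)
        ; shape₄         f# → contradiction (trans (discriminant-conic 1# 0# 0# 0#) (degenerate 1# 0#)) (#⇒≉ f#)
        }
    }
    where
    shape : Setoid.Carrier NonsingularParameters → Shape
    shape (inj₁ (b , t , d , _)) = shape₁ (apex b t + d) b t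
    shape (inj₂ (a , d , _))     = shape₂ a (1# + d)
    +-cancelˡ : ∀ {x x′ y y′} → x ≈ x′ → x + y ≈ x′ + y′ → y ≈ y′
    +-cancelˡ {x} {x′} {y} {y′} x≈x′ eq = trans (drop x y) (trans (+-cong x≈x′ eq) (sym (drop x′ y′)))
      where
      drop : ∀ x y → y ≈ x + (x + y)
      drop = solve 2 (λ x y → y := x :+ (x :+ y)) refl
    shape-injective : ∀ s t → ⟦ shape s ⟧ ≋ ⟦ shape t ⟧ → Setoid._≈_ NonsingularParameters s t
    shape-injective (inj₁ _) (inj₁ _) eq = inj₁ (eq 2F , eq 1F , +-cancelˡ (apex-cong (eq 2F) (eq 1F)) (eq 0F))
    shape-injective (inj₂ _) (inj₂ _) eq = inj₂ (eq 0F , +-cancelˡ refl (eq 2F))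
    shape-injective (inj₁ _) (inj₂ _) eq = contradiction (eq 4F) (#⇒≉ 1#0)
    shape-injective (inj₂ _) (inj₁ _) eq = contradiction (sym (eq 4F)) (#⇒≉ 1#0)
    degenerate : ∀ a b → a * (0# * 0#) + 0# * (b * 0# + b * b + 0# * 0#) ≈ 0#
    degenerate = solve 2 (λ a b → let o = con false in a :* (o :* o) :+ o :* (b :* o :+ b :* b :+ o :* o) := o) refl
    -- Writing the discriminant of f as a multiple of that of `substitute A f` shows the latter to
    -- be nonzero as a factor of a nonzero product.
    restore : ∀ A B → A ⊗ B ≈ᴹ 1ᴹ → ∀ f → discriminant f ≈ determinant B * determinant B * discriminant (substitute A f)
    restore A B AB≈1 f = trans (discriminant-cong {f} {substitute B (substitute A f)} (λ i → sym (substitute-inverse {B} {A} AB≈1 f i)))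
      (discriminant-substitute B (substitute A f))
    discriminant-∙ : ∀ s g → discriminant (s ∙ g) ≈ s * s * s * discriminant g
    discriminant-∙ s g = trans (discriminant≈eval-nucleus (s ∙ g)) (trans (IsLinear.φ-∙ (eval-linear (nucleus (s ∙ g))) s g)
      (trans (*-congˡ (trans (eval-cong g {nucleus (s ∙ g)} {s ∙ nucleus g} λ { 0F → refl ; 1F → refl ; 2F → refl })
        (eval-∙ g s (nucleus g)))) (trans (solve 2 (λ s x → s :* (s :* s :* x) := s :* s :* s :* x) refl s _)
        (*-congˡ (sym (discriminant≈eval-nucleus g))))))

  product-∙ : ∀ u l m → u ∙ product l m ≋ product (u ∙ l) m
  product-∙ u l m = λ { 0F → pure 0F ; 1F → mixed 0F 1F ; 2F → mixed 0F 2F ; 3F → pure 1F ; 4F → mixed 1F 2F ; 5F → pure 2F }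
    where
    pure : ∀ i → u * (l i * m i) ≈ u * l i * m i
    pure i = sym (*-assoc u (l i) (m i))
    mixed : ∀ i j → u * (l i * m j + l j * m i) ≈ u * l i * m j + u * l j * m i
    mixed i j = trans (distribˡ u _ _) (+-cong (sym (*-assoc u (l i) (m j))) (sym (*-assoc u (l j) (m i))))

  -- On X₀ = 0, the form t X₁² + X₁X₂ + t X₂² with t = z (z + 1) is (z X₁ + (z + 1) X₂) ((z + 1) X₁ + z X₂);
  -- the X₀-coefficients are then determined by a linear system.
  line₁ line₁′ : (z b : Carrier) → Vector Carrier 3
  line₁  z b = ℘ z + z * (℘ z + b) ∷ z ∷ z + 1# ∷ []
  line₁′ z b = b + z * (℘ z + b) ∷ z + 1# ∷ z ∷ []

  -- For b = 1 the form `shape₂` is a X₀² + X₀ (X₁ + X₂) + (X₁ + X₂)², binary in X₀ and X₁ + X₂; it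
  -- factors with coefficients z and z + 1 at X₀ when ℘ z = a.
  line₂ : Carrier → Vector Carrier 3
  line₂ z = z ∷ 1# ∷ 1# ∷ []

  factor₁ : ∀ {a b t z} → ℘ z ≈ t → a ≈ apex b t → ⟦ shape₁ a b t ⟧ ≋ product (line₁ z b) (line₁′ z b)
  factor₁ {a} {b} {t} {z} ℘z≈t a≈apex i = trans (conic-cong (trans a≈apex (apex-cong refl (sym ℘z≈t))) refl refl (sym ℘z≈t) i) (entry i)
    where
    entry : conic (apex b (℘ z)) b 1# (℘ z) ≋ product (line₁ z b) (line₁′ z b)
    entry = λ
      { 0F → solve 2 (λ z b → let t = z :* z :+ z in
          t :* (b :+ b :* b :+ t :* t) := (t :+ z :* (t :+ b)) :* (b :+ z :* (t :+ b))) refl z b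
      ; 1F → solve 2 (λ z b → let t = z :* z :+ z in
          t := (t :+ z :* (t :+ b)) :* (z :+ con true) :+ z :* (b :+ z :* (t :+ b))) refl z b
      ; 2F → solve 2 (λ z b → let t = z :* z :+ z in
          b := (t :+ z :* (t :+ b)) :* z :+ (z :+ con true) :* (b :+ z :* (t :+ b))) refl z b
      ; 3F → solve 1 (λ z → z :* z :+ z := z :* (z :+ con true)) refl z
      ; 4F → solve 1 (λ z → con true := z :* z :+ (z :+ con true) :* (z :+ con true)) refl z
      ; 5F → solve 1 (λ z → z :* z :+ z := (z :+ con true) :* z) refl z
      }

  factor₂ : ∀ {a b z} → ℘ z ≈ a → b ≈ 1# → ⟦ shape₂ a b ⟧ ≋ product (line₂ z) (line₂ (z + 1#))
  factor₂ {a} {b} {z} ℘z≈a b≈1 i = trans (conic-cong (sym ℘z≈a) b≈1 refl refl i) (entry i)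
    where
    entry : conic (℘ z) 1# 0# 1# ≋ product (line₂ z) (line₂ (z + 1#))
    entry = λ
      { 0F → solve 1 (λ z → z :* z :+ z := z :* (z :+ con true)) refl z
      ; 1F → mixed
      ; 2F → mixed
      ; 3F → sym (*-identityˡ 1#)
      ; 4F → solve 0 (con false := con true :* con true :+ con true :* con true) refl
      ; 5F → sym (*-identityˡ 1#)
      }
      where
      mixed : 1# ≈ z * 1# + 1# * (z + 1#)
      mixed = solve 1 (λ z → con true := z :* con true :+ con true :* (z :+ con true)) refl z

  cross≈1⇒¬proportional : ∀ {l m} k → cross l m k ≈ 1# → ¬ Proportional l m
  cross≈1⇒¬proportional {l} {m} k eq prop = #⇒≉ 1#0 (trans (sym eq) (proportional⇒cross≈0 {l} {m} prop k))

  lines₁-distinct : ∀ z b → ¬ Proportional (line₁ z b) (line₁′ z b)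
  lines₁-distinct z b = cross≈1⇒¬proportional {line₁ z b} {line₁′ z b} 0F
    (solve 1 (λ z → z :* z :+ (z :+ con true) :* (z :+ con true) := con true) refl z)

  lines₂-distinct : ∀ z → ¬ Proportional (line₂ z) (line₂ (z + 1#))
  lines₂-distinct z = cross≈1⇒¬proportional {line₂ z} {line₂ (z + 1#)} 1F
    (solve 1 (λ z → z :* con true :+ con true :* (z :+ con true) := con true) refl z)

  -- Singular `shape₁` with t in the image of ℘ and b free; singular `shape₂` with a in the image;
  -- and every `shape₃`, which is X₀ (a X₀ + X₂). With k elements in the image this gives kq + (k +
  -- q).
  SplitParameters : Setoid _ _
  SplitParameters = ⊎-setoid (×-setoid Image setoid) (⊎-setoid Image setoid)

  split-normalForms : NormalForms Split SplitParameters
  split-normalForms = record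
    { invariant       = λ {A} {B} AB≈1 BA≈1 {f} (l , m , l≁m , f≋lm) → l ◁ A , m ◁ A ,
        ¬proportional-◁ {A} {B} AB≈1 {l} {m} l≁m ,
        λ i → trans (substitute-cong A {f} {product l m} f≋lm i) (substitute-product A l m i)
    ; scale           = λ {s} {u} {f} {g} su≈1 f≋sg (l , m , l≁m , f≋lm) → u ∙ l , m ,
        (λ prop → l≁m (proportional-∙ {l} {m} su≈1 prop)) ,
        λ i → trans (unscale {f = f} {g} su≈1 f≋sg i) (trans (*-congˡ (f≋lm i)) (product-∙ u l m i))
    ; shape           = shape
    ; shape-cong      = λ
        { (inj₁ (t≈ , b≈))  → conic-cong (apex-cong b≈ t≈) b≈ refl t≈
        ; (inj₂ (inj₁ a≈))  → conic-cong a≈ refl refl refl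
        ; (inj₂ (inj₂ a≈))  → conic-cong a≈ refl refl refl
        }
    ; shape-injective = shape-injective _ _
    ; sound           = sound
    ; complete        = complete
    }
    where
    shape : Setoid.Carrier SplitParameters → Shape
    shape (inj₁ ((t , _) , b))  = shape₁ (apex b t) b t
    shape (inj₂ (inj₁ (a , _))) = shape₂ a 1#
    shape (inj₂ (inj₂ a))       = shape₃ a

    shape-injective : ∀ s t → ⟦ shape s ⟧ ≋ ⟦ shape t ⟧ → Setoid._≈_ SplitParameters s t
    shape-injective (inj₁ _)        (inj₁ _)        eq = inj₁ (eq 1F , eq 2F)
    shape-injective (inj₂ (inj₁ _)) (inj₂ (inj₁ _)) eq = inj₂ (inj₁ (eq 0F))
    shape-injective (inj₂ (inj₂ _)) (inj₂ (inj₂ _)) eq = inj₂ (inj₂ (eq 0F))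
    shape-injective (inj₁ _)        (inj₂ (inj₁ _)) eq = contradiction (eq 4F) (#⇒≉ 1#0)
    shape-injective (inj₁ _)        (inj₂ (inj₂ _)) eq = contradiction (eq 4F) (#⇒≉ 1#0)
    shape-injective (inj₂ (inj₁ _)) (inj₁ _)        eq = contradiction (sym (eq 4F)) (#⇒≉ 1#0)
    shape-injective (inj₂ (inj₂ _)) (inj₁ _)        eq = contradiction (sym (eq 4F)) (#⇒≉ 1#0)
    shape-injective (inj₂ (inj₁ _)) (inj₂ (inj₂ _)) eq = contradiction (eq 1F) (#⇒≉ 1#0)
    shape-injective (inj₂ (inj₂ _)) (inj₂ (inj₁ _)) eq = contradiction (sym (eq 1F)) (#⇒≉ 1#0)

    proportional-∙ : ∀ {l m : Vector Carrier 3} {s u} → s * u ≈ 1# → Proportional (u ∙ l) m → Proportional l m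
    proportional-∙ {l} {m} {s} {u} su≈1 (a , inj₁ ul≋am) = s * a , inj₁ λ i →
      trans (unscale {f = a ∙ m} {l} (trans (*-comm u s) su≈1) (λ i → sym (ul≋am i)) i) (sym (*-assoc s a (m i)))
    proportional-∙ {l} {m} {s} {u} su≈1 (a , inj₂ m≋aul) = a * u , inj₂ λ i →
      trans (m≋aul i) (sym (*-assoc a u (l i)))

    sound : ∀ t → Split ⟦ shape t ⟧
    sound (inj₁ ((t , z , ℘z≈t) , b))  = line₁ z b , line₁′ z b , lines₁-distinct z b , factor₁ ℘z≈t refl
    sound (inj₂ (inj₁ (a , z , ℘z≈a))) = line₂ z , line₂ (z + 1#) , lines₂-distinct z , factor₂ ℘z≈a refl
    sound (inj₂ (inj₂ a))              = e₀ , l , cross≈1⇒¬proportional {e₀} {l} 1F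
      (solve 1 (λ a → con true :* con true :+ con false :* a := con true) refl a) , λ
      { 0F → sym (*-identityˡ a)
      ; 1F → solve 1 (λ a → con false := con true :* con false :+ con false :* a) refl a
      ; 2F → solve 1 (λ a → con true := con true :* con true :+ con false :* a) refl a
      ; 3F → solve 0 (con false := con false :* con false) refl
      ; 4F → solve 0 (con false := con false :* con true :+ con false :* con false) refl
      ; 5F → solve 0 (con false := con false :* con true) refl
      }
      where
      e₀ l : Vector Carrier 3
      e₀ = 1# ∷ 0# ∷ 0# ∷ []
      l  = a ∷ 0# ∷ 1# ∷ []

    ℘-root : ∀ {x y} → 1# ≈ x + y → ℘ x ≈ x * y
    ℘-root {x} {y} 1≈x+y = trans (+-congˡ (trans (sym (*-identityʳ x)) (*-congˡ 1≈x+y)))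
      (solve 2 (λ x y → x :* x :+ x :* (x :+ y) := x :* y) refl x y)

    singular : ∀ S → Split ⟦ S ⟧ → discriminant ⟦ S ⟧ ≈ 0#
    singular S (l , m , _ , eq) = trans (discriminant-cong {⟦ S ⟧} {product l m} eq) (discriminant-product l m)

    complete : ∀ S → Split ⟦ S ⟧ → ∃ λ t → ⟦ S ⟧ ≋ ⟦ shape t ⟧
    complete S@(shape₁ a b t) split@(l , m , _ , eq) =
      inj₁ ((t , x + t , ℘[x+t]≈t) , b) , conic-cong (singular-shape₁ (singular S split)) refl refl refl
      where
      -- The two summands of the coefficient of X₁X₂ add up to 1 and multiply to (l₁m₁)(l₂m₂) = t².
      -- Hence ℘ x = t² = ℘ t + t, and x + t is the required preimage of t. For `shape₂` the
      -- summands of the coefficient of X₀X₁ multiply to a · 1, so no correction by t occurs.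
      x y : Carrier
      x = l 1F * m 2F
      y = l 2F * m 1F
      ℘[x+t]≈t : ℘ (x + t) ≈ t
      ℘[x+t]≈t = begin
        ℘ (x + t)                               ≈⟨ ℘-+ x t ⟩
        ℘ x + ℘ t                               ≈⟨ +-congʳ (℘-root (eq 4F)) ⟩
        x * y + ℘ t
          ≈⟨ +-congʳ (solve 4 (λ p q r s → p :* s :* (q :* r) := p :* r :* (q :* s)) refl (l 1F) (l 2F) (m 1F) (m 2F)) ⟩
        l 1F * m 1F * (l 2F * m 2F) + ℘ t       ≈⟨ +-congʳ (*-cong (eq 3F) (eq 5F)) ⟨
        t * t + ℘ t                             ≈⟨ solve 1 (λ t → t :* t :+ (t :* t :+ t) := t) refl t ⟩
        t                                       ∎
        where open ≈-Reasoning setoid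
    complete S@(shape₂ a b) split@(l , m , _ , eq) =
      inj₂ (inj₁ (a , x , ℘x≈a)) , conic-cong refl (singular-shape₂ (singular S split)) refl refl
      where
      x y : Carrier
      x = l 0F * m 1F
      y = l 1F * m 0F
      ℘x≈a : ℘ x ≈ a
      ℘x≈a = begin
        ℘ x                                     ≈⟨ ℘-root (eq 1F) ⟩
        x * y
          ≈⟨ solve 4 (λ p q r s → p :* s :* (q :* r) := p :* r :* (q :* s)) refl (l 0F) (l 1F) (m 0F) (m 1F) ⟩
        l 0F * m 0F * (l 1F * m 1F)             ≈⟨ *-cong (eq 0F) (eq 3F) ⟨
        a * 1#                                  ≈⟨ *-identityʳ a ⟩
        a                                       ∎
        where open ≈-Reasoning setoid
    complete (shape₃ a) _ = inj₂ (inj₂ a) , λ _ → refl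
    complete shape₄ (l , m , l≁m , eq) = contradiction
      (cross≈0⇒proportional {l} {m} λ { 0F → sym (eq 4F) ; 1F → sym (eq 2F) ; 2F → sym (eq 1F) }) l≁m

  -- A rational zero on the line X₀ = 0, available once t = ℘ z; replacing z by z + 1 gives a second
  -- one. Such zeros are what excludes conjugate pairs.
  shape₁-zero : ∀ {a b t z} → ℘ z ≈ t → eval ⟦ shape₁ a b t ⟧ (0# ∷ z + 1# ∷ z ∷ []) ≈ 0#
  shape₁-zero {a} {b} {t} {z} ℘z≈t = trans (solve 4 (λ a b t z → let o = con false ; w = z :+ con true in
    a :* (o :* o) :+ t :* (o :* w) :+ b :* (o :* z) :+ t :* (w :* w) :+ con true :* (w :* z) :+ t :* (z :* z)
    := (z :* z :+ z) :+ t) refl a b t z) (x≈y⇒x+y≈0 ℘z≈t)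

  shape₂-zero : ∀ {a b z} → ℘ z ≈ a → eval ⟦ shape₂ a b ⟧ (1# ∷ z ∷ 0# ∷ []) ≈ 0#
  shape₂-zero {a} {b} {z} ℘z≈a = trans (solve 3 (λ a b z → let o = con false ; one = con true in
    a :* (one :* one) :+ one :* (one :* z) :+ b :* (one :* o) :+ one :* (z :* z) :+ o :* (z :* o) :+ one :* (o :* o)
    := (z :* z :+ z) :+ a) refl a b z) (x≈y⇒x+y≈0 ℘z≈a)

  shape₂-zero∞ : ∀ a b → eval ⟦ shape₂ a b ⟧ (0# ∷ 1# ∷ 1# ∷ []) ≈ 0#
  shape₂-zero∞ = solve 2 (λ a b → let o = con false ; one = con true in
    a :* (o :* o) :+ one :* (o :* one) :+ b :* (o :* one) :+ one :* (one :* one) :+ o :* (one :* one) :+ one :* (one :* one)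
    := o) refl

  X₀∣f⇒zero : ∀ a b v → v 0F ≈ 0# → eval (conic a b 0# 0#) v ≈ 0#
  X₀∣f⇒zero a b v v₀≈0 = trans (eval-cong (conic a b 0# 0#) {v} {0# ∷ v 1F ∷ v 2F ∷ []} λ { 0F → v₀≈0 ; 1F → refl ; 2F → refl })
    (solve 4 (λ a b x y → let o = con false in
      a :* (o :* o) :+ o :* (o :* x) :+ b :* (o :* y) :+ o :* (x :* x) :+ o :* (x :* y) :+ o :* (y :* y) := o) refl a b (v 1F) (v 2F))

-- Pairs of conjugate imaginary lines.

module ImaginaryClass {c ℓ₁ ℓ₂ c′ ℓ₁′ ℓ₂′} (q h : ℕ) (q≡2^1+h : q ≡ 2 ℕ.^ suc h)
  (F : HeytingField c ℓ₁ ℓ₂) (#F : HasCardinality (setoidOf F) q)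
  (E : HeytingField c′ ℓ₁′ ℓ₂′) (#E : HasCardinality (setoidOf E) (q ℕ.^ 2))
  (ι : HeytingField.Carrier F → HeytingField.Carrier E) (ι-embedding : IsEmbedding F E ι) where

  open import Data.Sum.Relation.Binary.Pointwise using (inj₁; inj₂)
  open import Data.Vec.Functional using (Vector; []; _∷_)
  open QuadraticExtension q h q≡2^1+h F #F E #E ι ι-embedding
  open CommutativeRing (ring E) hiding (zero; ring)
  open HeytingProperties (HeytingField.heytingCommutativeRing E) using (1#0)
  open CharTwo (ring E) 1+1≈0ᴱ
  open FiniteField E #E
  open VecEquality setoid using (_≋_)

  private
    module F where
      open CommutativeRing (ring F) hiding (zero; ring) public
      open HeytingField F using (_#_) public
      open HeytingProperties (HeytingField.heytingCommutativeRing F) using (1#0) public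
      open FiniteField F #F public
      open EvenField F #F 1+1≈0ᶠ public
      open PG5 F hiding (Image) public
      open Conic F #F 1+1≈0ᶠ public
      open Orbit F #F 1+1≈0ᶠ public
      open Classes F #F 1+1≈0ᶠ public
      open VecEquality (setoidOf F) using (_≋_) public
    module E where
      open EvenField E #E 1+1≈0ᴱ public
      open PG5 E hiding (Image) public
      open Conic E #E 1+1≈0ᴱ public
      open Orbit E #E 1+1≈0ᴱ public
      open Classes E #E 1+1≈0ᴱ public

  open E using (_∙_)

  ι-dot : ∀ l v → ι (F.dot l v) ≈ E.dot (ι ∘ l) (ι ∘ v)
  ι-dot l v = trans (ι-+ _ _) (+-cong (ι-* _ _) (trans (ι-+ _ _) (+-cong (ι-* _ _) (trans (ι-+ _ _) (+-cong (ι-* _ _) ι-0)))))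

  private
    ι-sum₆ : ∀ {a₀ a₁ a₂ a₃ a₄ a₅ b₀ b₁ b₂ b₃ b₄ b₅} →
      ι a₀ ≈ b₀ → ι a₁ ≈ b₁ → ι a₂ ≈ b₂ → ι a₃ ≈ b₃ → ι a₄ ≈ b₄ → ι a₅ ≈ b₅ →
      ι (a₀ F.+ a₁ F.+ a₂ F.+ a₃ F.+ a₄ F.+ a₅) ≈ b₀ + b₁ + b₂ + b₃ + b₄ + b₅
    ι-sum₆ e₀ e₁ e₂ e₃ e₄ e₅ = add (add (add (add (add e₀ e₁) e₂) e₃) e₄) e₅
      where
      add : ∀ {a a′ b b′} → ι a ≈ b → ι a′ ≈ b′ → ι (a F.+ a′) ≈ b + b′
      add e e′ = trans (ι-+ _ _) (+-cong e e′)

  ι-eval : ∀ f v → ι (F.eval f v) ≈ E.eval (ι ∘ f) (ι ∘ v)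
  ι-eval f v = ι-sum₆ (term 0F 0F) (term 0F 1F) (term 0F 2F) (term 1F 1F) (term 1F 2F) (term 2F 2F)
    where
    term : ∀ {a} i j → ι (a F.* (v i F.* v j)) ≈ ι a * (ι (v i) * ι (v j))
    term i j = trans (ι-* _ _) (*-congˡ (ι-* _ _))

  ι-polar : ∀ f v w → ι (F.polar f v w) ≈ E.polar (ι ∘ f) (ι ∘ v) (ι ∘ w)
  ι-polar f v w = ι-sum₆ (term 0F 0F) (term 0F 1F) (term 0F 2F) (term 1F 1F) (term 1F 2F) (term 2F 2F)
    where
    term : ∀ {a} i j → ι (a F.* (v i F.* w j F.+ w i F.* v j)) ≈ ι a * (ι (v i) * ι (w j) + ι (w i) * ι (v j))
    term i j = trans (ι-* _ _) (*-congˡ (trans (ι-+ _ _) (+-cong (ι-* _ _) (ι-* _ _))))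

  ιᴹ : F.Matrix → E.Matrix
  ιᴹ A i j = ι (A i j)

  ι-substitute : ∀ A f → ι ∘ F.substitute A f ≋ E.substitute (ιᴹ A) (ι ∘ f)
  ι-substitute A f = λ
    { 0F → ι-eval f (λ k → A k 0F)
    ; 1F → ι-polar f (λ k → A k 0F) (λ k → A k 1F)
    ; 2F → ι-polar f (λ k → A k 0F) (λ k → A k 2F)
    ; 3F → ι-eval f (λ k → A k 1F)
    ; 4F → ι-polar f (λ k → A k 1F) (λ k → A k 2F)
    ; 5F → ι-eval f (λ k → A k 2F)
    }

  ιᴹ-inverse : ∀ A B → A F.⊗ B F.≈ᴹ F.1ᴹ → ιᴹ A E.⊗ ιᴹ B E.≈ᴹ E.1ᴹ
  ιᴹ-inverse A B AB≈1 i j = trans (sym (ι-dot (A i) (λ k → B k j))) (trans (ι-cong (AB≈1 i j)) (ι-if (does (i Fin.≟ j))))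
    where
    ι-if : (b : Bool) → ι (if b then F.1# else F.0#) ≈ (if b then 1# else 0#)
    ι-if true  = ι-1
    ι-if false = ι-0

  conj-dot : ∀ l v → conj (E.dot l (ι ∘ v)) ≈ E.dot (conj ∘ l) (ι ∘ v)
  conj-dot l v = trans (conj-+ _ _) (+-cong (term 0F)
    (trans (conj-+ _ _) (+-cong (term 1F) (trans (conj-+ _ _) (+-cong (term 2F) conj-0)))))
    where
    term : ∀ i → conj (l i * ι (v i)) ≈ conj (l i) * ι (v i)
    term i = trans (conj-* _ _) (*-congˡ (conj-ι (v i)))

  Imaginary : Pred (Vector F.Carrier 6) _
  Imaginary f = ∃₂ λ a l → ¬ E.Proportional l (conj ∘ l) × ι ∘ f ≋ ι a ∙ E.product l (conj ∘ l)

  -- A substitution with entries in 𝔽_q commutes with conjugation, so conjugate factors are sent to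
  -- conjugate factors.
  imaginary-invariant : ∀ {A B} → A F.⊗ B F.≈ᴹ F.1ᴹ → ∀ {f} → Imaginary f → Imaginary (F.substitute A f)
  imaginary-invariant {A} {B} AB≈1 {f} (a , l , l≁l̄ , f≋all̄) = a , l E.◁ ιᴹ A ,
    (λ prop → E.¬proportional-◁ {ιᴹ A} {ιᴹ B} (ιᴹ-inverse A B AB≈1) {l} {conj ∘ l} l≁l̄
      (E.proportional-resp {l E.◁ ιᴹ A} {l E.◁ ιᴹ A} {conj ∘ (l E.◁ ιᴹ A)} {(conj ∘ l) E.◁ ιᴹ A} (λ _ → refl) conj-◁ prop)) ,
    λ i → begin
      ι (F.substitute A f i)                                            ≈⟨ ι-substitute A f i ⟩
      E.substitute (ιᴹ A) (ι ∘ f) i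
        ≈⟨ E.substitute-cong (ιᴹ A) {ι ∘ f} {ι a ∙ E.product l (conj ∘ l)} f≋all̄ i ⟩
      E.substitute (ιᴹ A) (ι a ∙ E.product l (conj ∘ l)) i
        ≈⟨ E.substitute-∙ (ιᴹ A) (ι a) (E.product l (conj ∘ l)) i ⟩
      ι a * E.substitute (ιᴹ A) (E.product l (conj ∘ l)) i
        ≈⟨ *-congˡ (E.substitute-product (ιᴹ A) l (conj ∘ l) i) ⟩
      ι a * E.product (l E.◁ ιᴹ A) ((conj ∘ l) E.◁ ιᴹ A) i
        ≈⟨ *-congˡ (E.product-cong {l E.◁ ιᴹ A} {l E.◁ ιᴹ A} {conj ∘ (l E.◁ ιᴹ A)} {(conj ∘ l) E.◁ ιᴹ A} (λ _ → refl) conj-◁ i) ⟨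
      ι a * E.product (l E.◁ ιᴹ A) (conj ∘ (l E.◁ ιᴹ A)) i              ∎
    where
    open ≈-Reasoning setoid
    conj-◁ : conj ∘ (l E.◁ ιᴹ A) ≋ (conj ∘ l) E.◁ ιᴹ A
    conj-◁ j = conj-dot l (λ k → A k j)

  imaginary-scale : ∀ {s u f g} → s F.* u F.≈ F.1# → f F.≋ s F.∙ g → Imaginary f → Imaginary g
  imaginary-scale {s} {u} {f} {g} su≈1 f≋sg (a , l , l≁l̄ , f≋all̄) = u F.* a , l , l≁l̄ , λ i → begin
    ι (g i)                                     ≈⟨ ι-cong (F.unscale {f = f} {g} su≈1 f≋sg i) ⟩
    ι (u F.* f i)                               ≈⟨ ι-* u (f i) ⟩
    ι u * ι (f i)                               ≈⟨ *-congˡ (f≋all̄ i) ⟩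
    ι u * (ι a * E.product l (conj ∘ l) i)      ≈⟨ *-assoc (ι u) (ι a) _ ⟨
    ι u * ι a * E.product l (conj ∘ l) i        ≈⟨ *-congʳ (ι-* u a) ⟨
    ι (u F.* a) * E.product l (conj ∘ l) i      ∎
    where open ≈-Reasoning setoid

  -- Over 𝔽_q² the form is a product of linear forms, so its discriminant vanishes there, and `ι` is
  -- injective.
  imaginary-singular : ∀ {f} → Imaginary f → F.discriminant f F.≈ F.0#
  imaginary-singular {f} (a , l , _ , f≋all̄) = F.trans (F.discriminant≈eval-nucleus f) (ι-injective (begin
    ι (F.eval f (F.nucleus f))                                          ≈⟨ ι-eval f (F.nucleus f) ⟩
    E.eval (ι ∘ f) (ι ∘ F.nucleus f)
      ≈⟨ E.eval-cong (ι ∘ f) {ι ∘ F.nucleus f} {E.nucleus (ι ∘ f)} (λ { 0F → refl ; 1F → refl ; 2F → refl }) ⟩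
    E.eval (ι ∘ f) (E.nucleus (ι ∘ f))                                  ≈⟨ E.discriminant≈eval-nucleus (ι ∘ f) ⟨
    E.discriminant (ι ∘ f)
      ≈⟨ E.discriminant-cong {ι ∘ f} {E.product (ι a ∙ l) (conj ∘ l)} (λ i → trans (f≋all̄ i) (E.product-∙ (ι a) l (conj ∘ l) i)) ⟩
    E.discriminant (E.product (ι a ∙ l) (conj ∘ l))                     ≈⟨ E.discriminant-product (ι a ∙ l) (conj ∘ l) ⟩
    0#                                                                  ≈⟨ ι-0 ⟨
    ι F.0#                                                              ∎))
    where open ≈-Reasoning setoid

  -- The values of l and conj ∘ l at a rational point are conjugate, so if one of them vanishes, both do.
  imaginary-zero : ∀ {f} i → f i F.# F.0# → ((a , l , _) : Imaginary f) → ∀ v → F.eval f v F.≈ F.0# → E.dot l (ι ∘ v) ≈ 0#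
  imaginary-zero {f} i fᵢ#0 (a , l , _ , f≋all̄) v fv≈0 =
    [ (λ a≈0 → contradiction (trans (f≋all̄ i) (trans (*-congʳ a≈0) (zeroˡ _))) ιfᵢ≉0)
    , (λ lv*l̄v≈0 → [ id , (λ l̄v≈0 → trans (sym (conj-involutive _)) (trans (conj-cong (trans (conj-dot l v) l̄v≈0)) conj-0)) ]′
        (xy≈0⇒x≈0∨y≈0 lv*l̄v≈0))
    ]′ (xy≈0⇒x≈0∨y≈0 (begin
      ι a * (E.dot l (ι ∘ v) * E.dot (conj ∘ l) (ι ∘ v))   ≈⟨ *-congˡ (E.eval-product l (conj ∘ l) (ι ∘ v)) ⟨
      ι a * E.eval (E.product l (conj ∘ l)) (ι ∘ v)
        ≈⟨ E.IsLinear.φ-∙ (E.eval-linear (ι ∘ v)) (ι a) (E.product l (conj ∘ l)) ⟨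
      E.eval (ι a ∙ E.product l (conj ∘ l)) (ι ∘ v)
        ≈⟨ E.IsLinear.φ-cong (E.eval-linear (ι ∘ v)) {ι ∘ f} {ι a ∙ E.product l (conj ∘ l)} f≋all̄ ⟨
      E.eval (ι ∘ f) (ι ∘ v)                               ≈⟨ ι-eval f v ⟨
      ι (F.eval f v)                                       ≈⟨ ι-cong fv≈0 ⟩
      ι F.0#                                               ≈⟨ ι-0 ⟩
      0#                                                   ∎))
    where
    open ≈-Reasoning setoid
    ιfᵢ≉0 : ¬ ι (f i) ≈ 0#
    ιfᵢ≉0 ιfᵢ≈0 = F.#⇒≉ fᵢ#0 (ι-injective (trans ιfᵢ≈0 (sym ι-0)))

  ι-shape : ∀ a b c t → ι ∘ F.conic a b c t ≋ E.conic (ι a) (ι b) (ι c) (ι t)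
  ι-shape a b c t = λ { 0F → refl ; 1F → refl ; 2F → refl ; 3F → refl ; 4F → refl ; 5F → refl }

  ι-apex : ∀ b t → ι (F.apex b t) ≈ E.apex (ι b) (ι t)
  ι-apex b t = trans (ι-* _ _) (*-congˡ (trans (ι-+ _ _) (+-cong (trans (ι-+ _ _) (+-congˡ (ι-* b b))) (ι-* t t))))

  private
    conj-+1 : ∀ x → conj (x + 1#) ≈ conj x + 1#
    conj-+1 x = trans (conj-+ x 1#) (+-congˡ conj-1)

    conj-℘ : ∀ {z} → conj z ≈ z + 1# → conj (E.℘ z) ≈ E.℘ z
    conj-℘ {z} conj-z = trans (conj-+ _ _) (trans (+-cong (conj-* z z) refl) (trans (E.℘-cong conj-z) (E.℘-+1 z)))

    -- Such a form is a multiple of X₀, and so is its conjugate. Every exclusion from the imaginary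
    -- class ends in this contradiction.
    X₀∣l⇒rational : ∀ {l} → l 1F ≈ 0# → l 2F ≈ 0# → E.Proportional l (conj ∘ l)
    X₀∣l⇒rational {l} l₁≈0 l₂≈0 = E.cross≈0⇒proportional {l} {conj ∘ l} λ
      { 0F → kill l₂̄≈0 l₂≈0 ; 1F → kill l₂̄≈0 l₂≈0 ; 2F → kill l₁̄≈0 l₁≈0 }
      where
      l₁̄≈0 : conj (l 1F) ≈ 0#
      l₁̄≈0 = trans (conj-cong l₁≈0) conj-0
      l₂̄≈0 : conj (l 2F) ≈ 0#
      l₂̄≈0 = trans (conj-cong l₂≈0) conj-0
      kill : ∀ {a b x y} → y ≈ 0# → x ≈ 0# → a * y + x * b ≈ 0#
      kill {a} {b} y≈0 x≈0 = trans (+-cong (trans (*-congˡ y≈0) (zeroʳ a)) (trans (*-congʳ x≈0) (zeroˡ b))) (+-identityˡ 0#)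

  -- Conjugation replaces z by z + 1 and fixes ℘ z and b, which exchanges the two factors of the
  -- splitting of `shape₁`.
  line₁-conj : ∀ {z} b → conj z ≈ z + 1# → conj ∘ E.line₁ z (ι b) ≋ E.line₁′ z (ι b)
  line₁-conj {z} b conj-z = λ
    { 0F → begin
        conj (E.℘ z + z * (E.℘ z + ι b))               ≈⟨ conj-+ _ _ ⟩
        conj (E.℘ z) + conj (z * (E.℘ z + ι b))
          ≈⟨ +-cong (conj-℘ conj-z) (trans (conj-* _ _) (*-cong conj-z (trans (conj-+ _ _) (+-cong (conj-℘ conj-z) (conj-ι b))))) ⟩
        E.℘ z + (z + 1#) * (E.℘ z + ι b)
          ≈⟨ solve 3 (λ z t b → t :+ (z :+ con true) :* (t :+ b) := b :+ z :* (t :+ b)) refl z (E.℘ z) (ι b) ⟩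
        ι b + z * (E.℘ z + ι b)                        ∎
    ; 1F → conj-z
    ; 2F → trans (conj-+1 z) (trans (+-congʳ conj-z) (E.x+1+1≈x z))
    }
    where open ≈-Reasoning setoid

  line₂-conj : ∀ {z} → conj z ≈ z + 1# → conj ∘ E.line₂ z ≋ E.line₂ (z + 1#)
  line₂-conj conj-z = λ { 0F → conj-z ; 1F → conj-1 ; 2F → conj-1 }

  imaginary-of-conjugates : ∀ {f l m} → conj ∘ l ≋ m → ¬ E.Proportional l m → ι ∘ f ≋ E.product l m → Imaginary f
  imaginary-of-conjugates {f} {l} {m} l̄≋m l≁m f≋lm = F.1# , l ,
    (λ prop → l≁m (E.proportional-resp {l} {l} {conj ∘ l} {m} (λ _ → refl) l̄≋m prop)) ,
    λ i → trans (f≋lm i) (trans (E.product-cong {l} {l} {m} {conj ∘ l} (λ _ → refl) (λ k → sym (l̄≋m k)) i)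
      (sym (trans (*-congʳ ι-1) (*-identityˡ _))))

  -- The singular `shape₁` and `shape₂` that do not split over 𝔽_q, giving kq + k. The shapes
  -- divisible by X₀ contribute nothing.
  ImaginaryParameters : Setoid _ _
  ImaginaryParameters = ⊎-setoid (×-setoid F.Coimage F.setoid) F.Coimage

  imaginary-normalForms : F.NormalForms Imaginary ImaginaryParameters
  imaginary-normalForms = record
    { invariant       = λ {A} {B} AB≈1 _ {f} → imaginary-invariant {A} {B} AB≈1 {f}
    ; scale           = λ {s} {u} {f} {g} → imaginary-scale {s} {u} {f} {g}
    ; shape           = shape
    ; shape-cong      = λ
        { (inj₁ (t≈ , b≈)) → F.conic-cong (F.apex-cong b≈ t≈) b≈ F.refl t≈
        ; (inj₂ a≈)        → F.conic-cong a≈ F.refl F.refl F.refl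
        }
    ; shape-injective = shape-injective _ _
    ; sound           = sound
    ; complete        = complete
    }
    where
    shape : Setoid.Carrier ImaginaryParameters → F.Shape
    shape (inj₁ ((t , _) , b)) = F.shape₁ (F.apex b t) b t
    shape (inj₂ (a , _))       = F.shape₂ a F.1#

    shape-injective : ∀ s t → F.⟦ shape s ⟧ F.≋ F.⟦ shape t ⟧ → Setoid._≈_ ImaginaryParameters s t
    shape-injective (inj₁ _) (inj₁ _) eq = inj₁ (eq 1F , eq 2F)
    shape-injective (inj₂ _) (inj₂ _) eq = inj₂ (eq 0F)
    shape-injective (inj₁ _) (inj₂ _) eq = contradiction (eq 4F) (F.#⇒≉ F.1#0)
    shape-injective (inj₂ _) (inj₁ _) eq = contradiction (F.sym (eq 4F)) (F.#⇒≉ F.1#0)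

    sound₁ : ∀ {t} b → (∃ λ z → E.℘ z ≈ ι t × conj z ≈ z + 1#) → Imaginary F.⟦ F.shape₁ (F.apex b t) b t ⟧
    sound₁ {t} b (z , ℘z≈ιt , conj-z) = imaginary-of-conjugates {F.⟦ F.shape₁ (F.apex b t) b t ⟧} {E.line₁ z (ι b)} {E.line₁′ z (ι b)}
      (line₁-conj b conj-z) (E.lines₁-distinct z (ι b)) λ i →
      trans (ι-shape (F.apex b t) b F.1# t i) (trans (E.conic-cong refl refl ι-1 refl i)
        (E.factor₁ {ι (F.apex b t)} {ι b} {ι t} {z} ℘z≈ιt (ι-apex b t) i))

    sound₂ : ∀ {a} → (∃ λ z → E.℘ z ≈ ι a × conj z ≈ z + 1#) → Imaginary F.⟦ F.shape₂ a F.1# ⟧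
    sound₂ {a} (z , ℘z≈ιa , conj-z) = imaginary-of-conjugates {F.⟦ F.shape₂ a F.1# ⟧} {E.line₂ z} {E.line₂ (z + 1#)}
      (line₂-conj conj-z) (E.lines₂-distinct z) λ i →
      trans (ι-shape a F.1# F.0# F.1# i) (trans (E.conic-cong refl refl ι-0 ι-1 i)
        (E.factor₂ {ι a} {ι F.1#} {z} ℘z≈ιa ι-1 i))

    sound : ∀ t → Imaginary F.⟦ shape t ⟧
    sound (inj₁ ((t , t∉) , b)) = sound₁ b (℘-root t t∉)
    sound (inj₂ (a , a∉))       = sound₂ (℘-root a a∉)

    ι-+1 : ∀ z → ι (z F.+ F.1#) ≈ ι z + 1#
    ι-+1 z = trans (ι-+ z F.1#) (+-congˡ ι-1)

    vanish : ∀ {a b x y} → x ≈ 0# → y ≈ 0# → a * x + b * y ≈ 0#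
    vanish {a} {b} x≈0 y≈0 = trans (+-cong (trans (*-congˡ x≈0) (zeroʳ a)) (trans (*-congˡ y≈0) (zeroʳ b))) (+-identityˡ 0#)

    dot-ι : ∀ l v w → E.dot l (ι ∘ v) ≈ 0# → ι ∘ v ≋ w → E.dot l w ≈ 0#
    dot-ι l v w lv≈0 v≋w = trans (sym (E.dot-cong {l} {l} {ι ∘ v} {w} (λ _ → refl) v≋w)) lv≈0

    -- The conic contains all rational points of the line X₀ = 0; the two coordinate points on it
    -- already annihilate l₁ and l₂.
    X₀∣f⇒rational : ∀ {a b} i → F.conic a b F.0# F.0# i F.# F.0# →
      ((_ , l , _) : Imaginary (F.conic a b F.0# F.0#)) → E.Proportional l (conj ∘ l)
    X₀∣f⇒rational {a} {b} i fᵢ#0 im@(_ , l , _) = X₀∣l⇒rational {l}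
      (trans (solve 3 (λ x y z → y := x :* con false :+ (y :* con true :+ (z :* con false :+ con false))) refl (l 0F) (l 1F) (l 2F))
        (dot-ι l e₁ (0# ∷ 1# ∷ 0# ∷ []) (imaginary-zero {F.conic a b F.0# F.0#} i fᵢ#0 im e₁ (F.X₀∣f⇒zero a b e₁ F.refl))
          λ { 0F → ι-0 ; 1F → ι-1 ; 2F → ι-0 }))
      (trans (solve 3 (λ x y z → z := x :* con false :+ (y :* con false :+ (z :* con true :+ con false))) refl (l 0F) (l 1F) (l 2F))
        (dot-ι l e₂ (0# ∷ 0# ∷ 1# ∷ []) (imaginary-zero {F.conic a b F.0# F.0#} i fᵢ#0 im e₂ (F.X₀∣f⇒zero a b e₂ F.refl))
          λ { 0F → ι-0 ; 1F → ι-0 ; 2F → ι-1 }))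
      where
      e₁ e₂ : Vector F.Carrier 3
      e₁ = F.0# ∷ F.1# ∷ F.0# ∷ []
      e₂ = F.0# ∷ F.0# ∷ F.1# ∷ []

    complete : ∀ S → Imaginary F.⟦ S ⟧ → ∃ λ t → F.⟦ S ⟧ F.≋ F.⟦ shape t ⟧
    complete S@(F.shape₁ a b t) im@(_ , l , l≁l̄ , _) =
      inj₁ ((t , t∉) , b) , F.conic-cong (F.singular-shape₁ (imaginary-singular {F.⟦ S ⟧} im)) F.refl F.refl F.refl
      where
      -- For t = ℘ z the form l vanishes at the rational zeros (0, z + 1, z) and (0, z, z + 1). The
      -- matrix with rows (z + 1, z) and (z, z + 1) is its own inverse in characteristic 2, which
      -- gives l₁ = l₂ = 0.
      t∉ : ¬ F.Im℘ t
      t∉ (z , ℘z≈t) = l≁l̄ (X₀∣l⇒rational {l}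
        (trans (solve 4 (λ l₀ l₁ l₂ z → let w = z :+ con true in
          l₁ := w :* (l₀ :* con false :+ (l₁ :* w :+ (l₂ :* z :+ con false)))
            :+ z :* (l₀ :* con false :+ (l₁ :* z :+ (l₂ :* w :+ con false))))
          refl (l 0F) (l 1F) (l 2F) (ι z)) (vanish e e′))
        (trans (solve 4 (λ l₀ l₁ l₂ z → let w = z :+ con true in
          l₂ := z :* (l₀ :* con false :+ (l₁ :* w :+ (l₂ :* z :+ con false)))
            :+ w :* (l₀ :* con false :+ (l₁ :* z :+ (l₂ :* w :+ con false))))
          refl (l 0F) (l 1F) (l 2F) (ι z)) (vanish e e′)))
        where
        v v′ : Vector F.Carrier 3
        v  = F.0# ∷ z F.+ F.1# ∷ z ∷ []
        v′ = F.0# ∷ z ∷ z F.+ F.1# ∷ []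
        v′-zero : F.eval F.⟦ S ⟧ v′ F.≈ F.0#
        v′-zero = F.trans (F.eval-cong F.⟦ S ⟧ {v′} {F.0# ∷ (z F.+ F.1#) F.+ F.1# ∷ z F.+ F.1# ∷ []}
            (λ { 0F → F.refl ; 1F → F.sym (F.x+1+1≈x z) ; 2F → F.refl }))
          (F.shape₁-zero {a} {b} {t} {z F.+ F.1#} (F.trans (F.℘-+1 z) ℘z≈t))
        e : E.dot l (0# ∷ ι z + 1# ∷ ι z ∷ []) ≈ 0#
        e = dot-ι l v (0# ∷ ι z + 1# ∷ ι z ∷ []) (imaginary-zero {F.⟦ S ⟧} 4F F.1#0 im v (F.shape₁-zero {a} {b} {t} {z} ℘z≈t))
          λ { 0F → ι-0 ; 1F → ι-+1 z ; 2F → refl }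
        e′ : E.dot l (0# ∷ ι z ∷ ι z + 1# ∷ []) ≈ 0#
        e′ = dot-ι l v′ (0# ∷ ι z ∷ ι z + 1# ∷ []) (imaginary-zero {F.⟦ S ⟧} 4F F.1#0 im v′ v′-zero)
          λ { 0F → ι-0 ; 1F → refl ; 2F → ι-+1 z }
    complete S@(F.shape₂ a b) im@(_ , l , l≁l̄ , _) =
      inj₂ (a , a∉) , F.conic-cong F.refl (F.singular-shape₂ (imaginary-singular {F.⟦ S ⟧} im)) F.refl F.refl
      where
      -- For a = ℘ z the rational zeros are (1, z, 0), (1, z + 1, 0) and (0, 1, 1). The first two
      -- differ by (0, 1, 0), so l₁ = 0, and the third then gives l₂ = 0.
      a∉ : ¬ F.Im℘ a
      a∉ (z , ℘z≈a) = l≁l̄ (X₀∣l⇒rational {l} l₁≈0 (trans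
          (solve 3 (λ l₀ l₁ l₂ → l₂ := con true :* (l₀ :* con false :+ (l₁ :* con true :+ (l₂ :* con true :+ con false))) :+ con true :* l₁)
            refl (l 0F) (l 1F) (l 2F)) (vanish e∞ l₁≈0)))
        where
        e : ∀ {z} → F.℘ z F.≈ a → E.dot l (1# ∷ ι z ∷ 0# ∷ []) ≈ 0#
        e {z} ℘z≈a = dot-ι l v (1# ∷ ι z ∷ 0# ∷ []) (imaginary-zero {F.⟦ S ⟧} 1F F.1#0 im v (F.shape₂-zero {a} {b} {z} ℘z≈a))
          λ { 0F → ι-1 ; 1F → refl ; 2F → ι-0 }
          where
          v : Vector F.Carrier 3
          v = F.1# ∷ z ∷ F.0# ∷ []
        e∞ : E.dot l (0# ∷ 1# ∷ 1# ∷ []) ≈ 0#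
        e∞ = dot-ι l (F.0# ∷ F.1# ∷ F.1# ∷ []) (0# ∷ 1# ∷ 1# ∷ [])
          (imaginary-zero {F.⟦ S ⟧} 1F F.1#0 im (F.0# ∷ F.1# ∷ F.1# ∷ []) (F.shape₂-zero∞ a b))
          λ { 0F → ι-0 ; 1F → ι-1 ; 2F → ι-1 }
        l₁≈0 : l 1F ≈ 0#
        l₁≈0 = trans (solve 4 (λ l₀ l₁ l₂ z →
            l₁ := con true :* (l₀ :* con true :+ (l₁ :* z :+ (l₂ :* con false :+ con false)))
               :+ con true :* (l₀ :* con true :+ (l₁ :* (z :+ con true) :+ (l₂ :* con false :+ con false))))
            refl (l 0F) (l 1F) (l 2F) (ι z))
          (vanish (e ℘z≈a) (dot-ι′ (e (F.trans (F.℘-+1 z) ℘z≈a))))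
          where
          dot-ι′ : E.dot l (1# ∷ ι (z F.+ F.1#) ∷ 0# ∷ []) ≈ 0# → E.dot l (1# ∷ ι z + 1# ∷ 0# ∷ []) ≈ 0#
          dot-ι′ = trans (+-congˡ (+-congʳ (*-congˡ (sym (ι-+1 z)))))
    complete (F.shape₃ a) im@(_ , l , l≁l̄ , _) = contradiction (X₀∣f⇒rational {a} {F.1#} 2F F.1#0 im) l≁l̄
    complete F.shape₄     im@(_ , l , l≁l̄ , _) = contradiction (X₀∣f⇒rational {F.1#} {F.0#} 0F F.1#0 im) l≁l̄

-- Closed forms of the counts and the distribution.

open import Data.Nat.Base using (_+_; _*_; _∸_; _^_)
open import Data.Nat.DivMod using (_/_; m*n/n≡m)
open import Data.Nat.Tactic.RingSolver using (solve-∀)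
open import Data.Vec.Base using ([]; _∷_)

private
  -- With q = 2k the numerator is exactly twice the count, so the truncating division loses nothing.
  card-split≡ : ∀ k q → k + k ≡ q → k * q + (k + q) ≡ (q ^ 2 + 3 * q) / 2
  card-split≡ k q ≡.refl = ≡.trans (≡.sym (m*n/n≡m _ 2)) (≡.cong (_/ 2) (double k))
    where
    double : ∀ k → (k * (k + k) + (k + (k + k))) * 2 ≡ (k + k) * ((k + k) * 1) + 3 * (k + k)
    double = solve-∀

  card-imaginary≡ : ∀ k q → k + k ≡ q → k * q + k ≡ (q ^ 2 + q) / 2
  card-imaginary≡ k q ≡.refl = ≡.trans (≡.sym (m*n/n≡m _ 2)) (≡.cong (_/ 2) (double k))
    where
    double : ∀ k → (k * (k + k) + k) * 2 ≡ (k + k) * ((k + k) * 1) + (k + k)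
    double = solve-∀

  -- Adding q to the count gives q³ exactly, so the truncated subtraction is a genuine one.
  card-nonsingular≡ : ∀ m q → suc m ≡ q → q * (q * m) + q * m ≡ q ^ 3 ∸ q
  card-nonsingular≡ m q ≡.refl = ≡.trans (≡.sym (ℕ.m+n∸n≡m _ q)) (≡.cong (_∸ q) (cube m))
    where
    cube : ∀ m → suc m * (suc m * m) + suc m * m + suc m ≡ suc m * (suc m * (suc m * 1))
    cube = solve-∀

lemma4p13 : {c ℓ₁ ℓ₂ c′ ℓ₁′ ℓ₂′ : Level} (q : ℕ) → IsPrimePower q → 2 ∣ q →
    (F : HeytingField c ℓ₁ ℓ₂) → HasCardinality (setoidOf F) q →
    (E : HeytingField c′ ℓ₁′ ℓ₂′) → HasCardinality (setoidOf E) (q ^ 2) →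
    (ι : HeytingField.Carrier F → HeytingField.Carrier E) → IsEmbedding F E ι →
    (L : PG5.Line F) → PG5.o₁₃,₃ F L →
    Distribution.HasOD₄ q F E ι L
    (1 ∷ (q ^ 2 + 3 * q) / 2 ∷ (q ^ 2 + q) / 2 ∷ q ^ 3 ∸ q ∷ [])
lemma4p13 q q-primePower 2∣q F #F E #E ι ι-embedding L L∈o₁₃,₃ = with-exponent (even-primePower q-primePower 2∣q)
  where
  OD₄ : Set _
  OD₄ = Distribution.HasOD₄ q F E ι L (1 ∷ (q ^ 2 + 3 * q) / 2 ∷ (q ^ 2 + q) / 2 ∷ q ^ 3 ∸ q ∷ [])

  with-exponent : (∃ λ h → q ≡ 2 ^ suc h) → OD₄
  with-exponent (h , q≡2^1+h) = with-counts card-℘ card-units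
    where
    open QuadraticExtension q h q≡2^1+h F #F E #E ι ι-embedding using (1+1≈0ᶠ)
    open Orbit F #F 1+1≈0ᶠ using (card-normalForms)
    open Classes F #F 1+1≈0ᶠ using (double-normalForms; split-normalForms; nonsingular-normalForms)
    open ImaginaryClass q h q≡2^1+h F #F E #E ι ι-embedding using (imaginary-normalForms)
    open EvenField F #F 1+1≈0ᶠ using (Image; Coimage; card-℘)
    open FiniteField F #F using (Unit; card-units)
    with-counts : (∃ λ k → k + k ≡ q × HasCardinality Image k × HasCardinality Coimage k) →
      (∃ λ m → suc m ≡ q × HasCardinality Unit m) → OD₄
    with-counts (k , k+k≡q , #I , #N) (m , 1+m≡q , #U) =
        card-normalForms double-normalForms (Identity.inverse _) L L∈o₁₃,₃
      , ≡.subst (HasCardinality _) (card-split≡ k q k+k≡q)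
          (card-normalForms split-normalForms (card-⊎ (card-× #I #F) (card-⊎ #I #F)) L L∈o₁₃,₃)
      , ≡.subst (HasCardinality _) (card-imaginary≡ k q k+k≡q)
          (card-normalForms imaginary-normalForms (card-⊎ (card-× #N #F) #N) L L∈o₁₃,₃)
      , ≡.subst (HasCardinality _) (card-nonsingular≡ m q 1+m≡q)
          (card-normalForms nonsingular-normalForms (card-⊎ (card-× #F (card-× #F #U)) (card-× #F #U)) L L∈o₁₃,₃)
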